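{- Let $G$ be a finite simple graph with $\operatorname{mad}(G) < 7$. Then $\tau(G) \leq 2\nu(G)$.
   Context: $\nu(G)$ is the maximum number of pairwise edge-disjoint triangles in $G$. $\tau(G)$ is the minimum size of an edge set $Y \subseteq E(G)$ such that $G - Y$ is triangle-free. The maximum average degree is $\operatorname{mad}(G) = \max\{2|E(H)|/|V(H)| : H \subseteq G,\ V(H)\neq\emptyset\}$. -}

module Defs where

open import Data.Fin using (Fin; _<_)
open import Data.Fin.Properties as Fin using (_<?_; all?)
open import Data.Integer using (+_)
open import Data.List
  using (List; []; _∷_; _++_; map; filter; length; allFin; cartesianProduct; mapMaybe)
import Data.List.Extrema as Extrema
import Data.List.Extrema.Nat as ℕ-Extrema
open import Data.List.NonEmpty as List⁺ using (List⁺; toList)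
import Data.List.Membership.DecPropositional as DecMembership
open import Data.List.Membership.Propositional using (_∈_; _∉_)
open import Data.List.Relation.Binary.Disjoint.Propositional using (Disjoint)
open import Data.List.Relation.Unary.All as All using (All)
open import Data.List.Relation.Unary.AllPairs using (AllPairs; allPairs?)
open import Data.Nat as ℕ using (ℕ)
open import Data.Product using (_×_; _,_)
open import Data.Product.Properties using (≡-dec)
open import Data.Rational using (ℚ; 0ℚ; _/_)
import Data.Rational.Properties as ℚ
open import Level using (0ℓ)
open import Relation.Binary
  using (Rel; Decidable; DecTotalOrder; DecidableEquality; Symmetric)
open import Relation.Nullary using (¬_; Dec; ¬?; _×-dec_)
open import Relation.Nullary.Decidable using (map′)

record Graph (n : ℕ) : Set₁ where
  field
    _~_     : Rel (Fin n) 0ℓ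
    ~-sym   : Symmetric _~_
    ~-irref : ∀ {v} → ¬ (v ~ v)
    _~?_    : Decidable _~_

-- The sublists of a duplicate-free list represent its subsets,
-- each exactly once.
sublists : ∀ {A : Set} → List A → List (List A)
sublists []       = [] ∷ []
sublists (x ∷ xs) = map (x ∷_) (sublists xs) ++ sublists xs

-- An unordered edge or triangle is represented by its increasing tuple of
-- vertices.
Edge Triangle : ℕ → Set
Edge n     = Fin n × Fin n
Triangle n = Fin n × Fin n × Fin n

triangleEdges : ∀ {n} → Triangle n → List (Edge n)
triangleEdges (u , v , w) = (u , v) ∷ (u , w) ∷ (v , w) ∷ []

module _ {n : ℕ} where

  _≟ᴱ_ : DecidableEquality (Edge n)
  _≟ᴱ_ = ≡-dec Fin._≟_ Fin._≟_

  open DecMembership _≟ᴱ_ using (_∈?_)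
  open DecMembership (Fin._≟_ {n}) using () renaming (_∈?_ to _∈ⱽ?_)

  EdgeDisjoint : Rel (Triangle n) 0ℓ
  EdgeDisjoint s t = Disjoint (triangleEdges s) (triangleEdges t)

  edgeDisjoint? : Decidable EdgeDisjoint
  edgeDisjoint? s t = map′
    (λ a (p , q) → All.lookup a p q)
    (λ d → All.tabulate λ p q → d (p , q))
    (All.all? (λ e → ¬? (e ∈? triangleEdges t)) (triangleEdges s))

  module _ (G : Graph n) where
    open Graph G

    IsEdge : Edge n → Set
    IsEdge (u , v) = u < v × u ~ v

    isEdge? : ∀ e → Dec (IsEdge e)
    isEdge? (u , v) = u <? v ×-dec u ~? v

    edges : List (Edge n)
    edges = filter isEdge? (cartesianProduct (allFin n) (allFin n))

    IsTriangle : Triangle n → Set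
    IsTriangle t = All IsEdge (triangleEdges t)

    isTriangle? : ∀ t → Dec (IsTriangle t)
    isTriangle? t = All.all? isEdge? (triangleEdges t)

    triangles : List (Triangle n)
    triangles = filter isTriangle?
      (cartesianProduct (allFin n) (cartesianProduct (allFin n) (allFin n)))

    TriangleFree : Set
    TriangleFree = ∀ u v w → ¬ IsTriangle (u , v , w)

    triangleFree? : Dec TriangleFree
    triangleFree? = all? λ u → all? λ v → all? λ w → ¬? (isTriangle? (u , v , w))

  _─_ : Graph n → List (Edge n) → Graph n
  G ─ Y = record
    { _~_     = λ u v → u ~ v × (u , v) ∉ Y × (v , u) ∉ Y
    ; ~-sym   = λ (uv , p , q) → ~-sym uv , q , p
    ; ~-irref = λ (vv , _) → ~-irref vv
    ; _~?_    = λ u v → u ~? v ×-dec ¬? ((u , v) ∈? Y) ×-dec ¬? ((v , u) ∈? Y)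
    }
    where open Graph G

  ν : Graph n → ℕ
  ν G = ℕ-Extrema.max 0 (map length
    (filter (allPairs? edgeDisjoint?) (sublists (triangles G))))

  -- The default length (edges G) is itself attained, by Y = E(G).
  τ : Graph n → ℕ
  τ G = ℕ-Extrema.min (length (edges G)) (map length
    (filter (λ Y → triangleFree? (G ─ Y)) (sublists (edges G))))

  -- Not necessarily induced subgraphs H, as pairs (V(H) , E(H)) with V(H)
  -- nonempty.
  IsSubgraph : List⁺ (Fin n) × List (Edge n) → Set
  IsSubgraph (S , F) = All (λ (u , v) → u ∈ toList S × v ∈ toList S) F

  isSubgraph? : ∀ H → Dec (IsSubgraph H)
  isSubgraph? (S , F) =
    All.all? (λ (u , v) → u ∈ⱽ? toList S ×-dec v ∈ⱽ? toList S) F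

  subgraphs : Graph n → List (List⁺ (Fin n) × List (Edge n))
  subgraphs G = filter isSubgraph?
    (cartesianProduct (mapMaybe List⁺.fromList (sublists (allFin n)))
                      (sublists (edges G)))

  averageDegree : List⁺ (Fin n) × List (Edge n) → ℚ
  averageDegree (S , F) = + (2 ℕ.* length F) / List⁺.length S

  -- Average degrees are nonnegative, so the default 0 only matters for n = 0,
  -- where there are no nonempty subgraphs.
  mad : Graph n → ℚ
  mad G = Extrema.max (DecTotalOrder.totalOrder ℚ.≤-decTotalOrder) 0ℚ
    (map averageDegree (subgraphs G))

module Submission where

-- Deleting edges from a counterexample with the fewest edges cannot preserve it.
-- So it contains no edge-disjoint triangles T and edges X, |X| ≤ 2 |T|, such that
-- each edge of T lies in X or in no triangle avoiding X.  Searching small pictures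
-- for such pairs (T , X) shows the following, where "low" vertices are those of
-- degree at most 6 and isolated vertices are disregarded:
--   * low vertices have degree 5 or 6 and are pairwise nonadjacent; among the
--     neighbours of a low vertex nonadjacency is a matching, with at most one edge
--     if the degree is 5;
--   * two low vertices have at most three common neighbours;
--   * a vertex sharing at least four neighbours with an adjacent low vertex has
--     degree at least 8, and if it has exactly 8 it has only one such low neighbour.
-- Let every low vertex w receive 2/3 from each neighbour u with at least four
-- neighbours in common with w.  There are at least three such u, so w ends with at
-- least 7.  A vertex u of degree d which pays at least two low vertices has, by the
-- second point, at least 6 neighbours adjacent to these two, none of them low;
-- hence it pays at most (d ∸ 6) · 2/3, which is at most d ∸ 7 once d ≥ 9.  So the
-- average degree is at least 7.

open import Defs
open import Data.Bool as Bool using (Bool; true; false; if_then_else_; _∧_; not; T; T?)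
open import Data.Bool.Properties using (T-∧; ∧-comm; ∧-zeroʳ)
open import Data.Empty using (⊥; ⊥-elim)
open import Data.Fin as Fin using (Fin)
import Data.Fin.Properties as Fin
import Data.Integer as ℤ
import Data.Integer.Properties as ℤ
open import Data.List
  using (List; []; _∷_; _++_; map; filter; length; allFin; tabulate; cartesianProduct;
         concatMap; upTo)
import Data.List.Extrema as Extrema
open import Data.List.Extrema.Nat using (xs≤max; min≤xs)
import Data.List.Membership.DecPropositional as DecMembership
open import Data.List.Membership.Propositional using (_∈_; _∉_; find; lose)
open import Data.List.Membership.Propositional.Properties
open import Data.List.NonEmpty as List⁺ using (List⁺; _∷_; toList)
open import Data.List.Properties
  using (length-++; length-map; filter-notAll; filter-++; map-cong; map-tabulate)
open import Data.List.Relation.Unary.All as All using (All; []; _∷_)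
import Data.List.Relation.Unary.All.Properties as All
open import Data.List.Relation.Unary.AllPairs as AllPairs using (AllPairs; []; _∷_; allPairs?)
import Data.List.Relation.Unary.AllPairs.Properties as AllPairs
open import Data.List.Relation.Unary.Any as Any using (Any; here; there)
import Data.List.Relation.Unary.Any.Properties as Any
open import Data.List.Relation.Unary.Unique.Propositional using (Unique)
import Data.List.Relation.Unary.Unique.Propositional.Properties as Unique
open import Data.Maybe.Relation.Unary.Any using (just)
open import Data.Nat as ℕ using (ℕ; zero; suc; _+_; _*_; _^_; _≤_; z≤n; s≤s; z<s; s<s)
import Data.Nat.DivMod as ℕ
open import Data.Nat.Divisibility using (divides)
open import Data.Nat.ListAction using (sum)
import Data.Nat.Properties as ℕ
open import Algebra.Properties.CommutativeMonoid.Sum ℕ.+-0-commutativeMonoid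
  using (∑-distrib-+; ∑-comm; sum-cong-≗; sum-replicate-zero) renaming (sum to ∑)
open import Algebra.Properties.Semiring.Sum ℕ.+-*-semiring using (*-distribˡ-sum)
open import Data.Nat.Tactic.RingSolver using (solve-∀)
open import Data.Product using (_×_; _,_; proj₁; proj₂; ∃-syntax; swap)
open import Data.Product.Properties using (≡-dec)
open import Data.Rational as ℚ using (0ℚ)
import Data.Rational.Properties as ℚ
open import Data.Rational.Unnormalised using (mkℚᵘ; *<*)
import Data.Rational.Unnormalised.Properties as ℚᵘ
open import Data.Sum as Sum using (_⊎_; inj₁; inj₂; [_,_]′)
open import Data.Unit using (tt)
open import Function using (_∘_; _$_; id)
open import Function.Bundles using (Equivalence)
open import Level using (0ℓ)
open import Relation.Binary
  using (Rel; Symmetric; DecidableEquality; DecTotalOrder; tri<; tri≈; tri>)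
open import Relation.Binary.PropositionalEquality
open import Relation.Nullary using (¬_; Dec; yes; no; ¬?; does; contradiction)
open import Relation.Nullary.Decidable
  using (_⊎-dec_; _×-dec_; _→-dec_; dec-true; dec-false; decidable-stable; toWitness)
open import Relation.Unary using (Pred; Decidable)
open ≡-Reasoning

-- A picture must speak about unboundedly large graphs. Only a few closed vertices have their whole
-- neighbourhood in it, so only an edge at a closed vertex can be shown to lie in no triangle
-- avoiding X; any other edge of T has to be put into X. This decides what the certificates look
-- like. They are built on each other: once nonadjacency among the neighbours of a low vertex is
-- known to be a matching, one absent edge forces many present ones, which keeps the later case
-- analyses short. The amount 2/3 is dictated by degree 5: such a vertex lacks 2 and is sure of only
-- three payers. Degree 8 is then the one degree of a payer at which the general bound on payments
-- is too weak, and the configuration excluded there is exactly the one that survives the counting.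
-- Irreducibility is a negative statement, so the induction produces solutions only up to double
-- negation. This is harmless because the final inequality is decidable.

module _ {A : Set} where

  -- `ν`, `τ` and `mad` range over sublists, which keep the order of the ambient list. An arbitrary
  -- set is brought into this form by filtering that list.
  filter-∈-sublists : {P : Pred A 0ℓ} (P? : Decidable P) (xs : List A) →
                      filter P? xs ∈ sublists xs
  filter-∈-sublists P? []       = here refl
  filter-∈-sublists P? (x ∷ xs) with does (P? x)
  ... | true  = ∈-++⁺ˡ (∈-map⁺ (x ∷_) (filter-∈-sublists P? xs))
  ... | false = ∈-++⁺ʳ (map (x ∷_) (sublists xs)) (filter-∈-sublists P? xs)

  length-mono-⊆ : DecidableEquality A → {xs ys : List A} → Unique xs →
                  (∀ {x} → x ∈ xs → x ∈ ys) → length xs ≤ length ys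
  length-mono-⊆ _≟_ []                 sub = z≤n
  length-mono-⊆ _≟_ {x ∷ _} {ys} (x∉xs ∷ uniq) sub =
    ℕ.≤-trans
      (s≤s (length-mono-⊆ _≟_ uniq λ y∈xs →
        ∈-filter⁺ (¬? ∘ (x ≟_)) (sub (there y∈xs)) (All.lookup x∉xs y∈xs)))
      (filter-notAll (¬? ∘ (x ≟_)) ys (Any.map (λ x≡y x≢y → x≢y x≡y) (sub (here refl))))

  length-filter-mono : {P Q : Pred A 0ℓ} (P? : Decidable P) (Q? : Decidable Q) →
                       (∀ {x} → P x → Q x) → (xs : List A) →
                       length (filter P? xs) ≤ length (filter Q? xs)
  length-filter-mono P? Q? P⇒Q []       = z≤n
  length-filter-mono P? Q? P⇒Q (x ∷ xs) with P? x | Q? x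
  ... | yes _ | yes _ = s≤s (length-filter-mono P? Q? P⇒Q xs)
  ... | yes p | no ¬q = contradiction (P⇒Q p) ¬q
  ... | no _  | yes _ = ℕ.m≤n⇒m≤1+n (length-filter-mono P? Q? P⇒Q xs)
  ... | no _  | no _  = length-filter-mono P? Q? P⇒Q xs

  length-filter-strict : {P Q : Pred A 0ℓ} (P? : Decidable P) (Q? : Decidable Q) →
                         (∀ {x} → P x → Q x) → {x : A} {xs : List A} →
                         x ∈ xs → Q x → ¬ P x →
                         length (filter P? xs) ℕ.< length (filter Q? xs)
  length-filter-strict P? Q? P⇒Q {xs = y ∷ ys} (here refl) q ¬p with P? y | Q? y
  ... | yes p | _     = contradiction p ¬p
  ... | no _  | yes _ = s≤s (length-filter-mono P? Q? P⇒Q ys)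
  ... | no _  | no ¬q = contradiction q ¬q
  length-filter-strict P? Q? P⇒Q {xs = y ∷ ys} (there x∈ys) q ¬p with P? y | Q? y
  ... | yes _ | yes _ = s≤s (length-filter-strict P? Q? P⇒Q x∈ys q ¬p)
  ... | yes p | no ¬q = contradiction (P⇒Q p) ¬q
  ... | no _  | yes _ = ℕ.m≤n⇒m≤1+n (length-filter-strict P? Q? P⇒Q x∈ys q ¬p)
  ... | no _  | no _  = length-filter-strict P? Q? P⇒Q x∈ys q ¬p

  module _ {R : Rel A 0ℓ} where

    allPairs-lookup : Symmetric R → {xs : List A} → AllPairs R xs →
                      ∀ {x y} → x ∈ xs → y ∈ xs → x ≢ y → R x y
    allPairs-lookup R-sym (_ ∷ _)   (here refl)  (here refl)  x≢y = contradiction refl x≢y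
    allPairs-lookup R-sym (Rx ∷ _)  (here refl)  (there y∈xs) x≢y = All.lookup Rx y∈xs
    allPairs-lookup R-sym (Rx ∷ _)  (there x∈xs) (here refl)  x≢y = R-sym (All.lookup Rx x∈xs)
    allPairs-lookup R-sym (_ ∷ Rxs) (there x∈xs) (there y∈xs) x≢y =
      allPairs-lookup R-sym Rxs x∈xs y∈xs x≢y

    allPairs-tabulate : {xs : List A} → Unique xs →
                        (∀ {x y} → x ∈ xs → y ∈ xs → x ≢ y → R x y) → AllPairs R xs
    allPairs-tabulate []            f = []
    allPairs-tabulate (x∉xs ∷ uniq) f =
      All.tabulate (λ y∈xs → f (here refl) (there y∈xs) (All.lookup x∉xs y∈xs)) ∷
      allPairs-tabulate uniq (λ x∈xs y∈xs → f (there x∈xs) (there y∈xs))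

-- Reductions and minimal counterexamples

infix 4 _∈±_

-- The labels of a picture know nothing of the order on `Fin n`, so an edge may be listed with its
-- ends in either order.
_∈±_ : {A : Set} → A × A → List (A × A) → Set
e ∈± Y = e ∈ Y ⊎ swap e ∈ Y

∈±? : {A : Set} → DecidableEquality A → (e : A × A) (Y : List (A × A)) → Dec (e ∈± Y)
∈±? _≟_ e Y = e ∈? Y ⊎-dec swap e ∈? Y
  where open DecMembership (≡-dec _≟_ _≟_) using (_∈?_)

∈±-++⁻ : {A : Set} {e : A × A} (X : List (A × A)) {Y : List (A × A)} →
         e ∈± X ++ Y → e ∈± X ⊎ e ∈± Y
∈±-++⁻ X (inj₁ e∈) = Sum.map inj₁ inj₁ (∈-++⁻ X e∈)
∈±-++⁻ X (inj₂ e∈) = Sum.map inj₂ inj₂ (∈-++⁻ X e∈)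

module _ {n : ℕ} where

  infix 4 _∈±?_

  _∈±?_ : (e : Edge n) (Y : List (Edge n)) → Dec (e ∈± Y)
  _∈±?_ = ∈±? Fin._≟_

  record Solution (G : Graph n) : Set where
    field
      packing   : List (Triangle n)
      disjoint  : AllPairs EdgeDisjoint packing
      triangle  : All (IsTriangle G) packing
      cover     : List (Edge n)
      covers    : TriangleFree (G ─ cover)
      bound     : length cover ≤ 2 * length packing

  -- (X , D) takes G to G ─ (X ++ D), losing at least length T in ν and at most
  -- length X in τ: no triangle through an edge of D survives in G ─ X.
  module _ (G : Graph n) where
    open Graph G

    Removable : List (Edge n) → Edge n → Set
    Removable X (u , v) =
      (u , v) ∈± X ⊎ (∀ x → u ~ x → v ~ x → (u , x) ∈± X ⊎ (v , x) ∈± X)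

    Irreducible : Set
    Irreducible =
      (T : List (Triangle n)) (X D : List (Edge n)) →
      AllPairs EdgeDisjoint T → All (IsTriangle G) T →
      length X ≤ 2 * length T →
      All (λ t → All (_∈± D) (triangleEdges t)) T →
      -- An actual edge of the graph in `D` makes the deletion proper, so that induction on the
      -- number of edges can descend.
      All (Removable X) D → Any (λ (u , v) → u ~ v) D → ⊥

  edgeDisjoint-irrefl : ∀ {t} → ¬ EdgeDisjoint {n} t t
  edgeDisjoint-irrefl d = d (here refl , here refl)

  edgeDisjoint-sym : Symmetric (EdgeDisjoint {n})
  edgeDisjoint-sym d (p , q) = d (q , p)

  module _ {G : Graph n} where
    open Graph G

    private
      isEdge-─ : ∀ {Y e} → IsEdge (G ─ Y) e → IsEdge G e × ¬ e ∈± Y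
      isEdge-─ (u<v , u~v , ∉₁ , ∉₂) = (u<v , u~v) , [ ∉₁ , ∉₂ ]′

      isEdge-─⁺ : ∀ {Y e} → IsEdge G e → ¬ e ∈± Y → IsEdge (G ─ Y) e
      isEdge-─⁺ (u<v , u~v) ∉ = u<v , u~v , ∉ ∘ inj₁ , ∉ ∘ inj₂

    triangleFree-─ : ∀ {Y Y′} → (∀ {e} → IsEdge G e → e ∈± Y → e ∈± Y′) →
                     TriangleFree (G ─ Y) → TriangleFree (G ─ Y′)
    triangleFree-─ sub free u v w t =
      free u v w (All.map (λ e → let (p , ∉) = isEdge-─ e in isEdge-─⁺ p (∉ ∘ sub p)) t)

    allEdges : ∀ e → e ∈ cartesianProduct (allFin n) (allFin n)
    allEdges (u , v) = ∈-cartesianProduct⁺ (∈-allFin u) (∈-allFin v)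

    isEdge⇒∈-edges : ∀ {e} → IsEdge G e → e ∈ edges G
    isEdge⇒∈-edges = ∈-filter⁺ (isEdge? G) (allEdges _)

    edges-unique : Unique (edges G)
    edges-unique = Unique.filter⁺ (isEdge? G)
      (Unique.cartesianProduct⁺ (Unique.allFin⁺ n) (Unique.allFin⁺ n))

    triangles-unique : Unique (triangles G)
    triangles-unique = Unique.filter⁺ (isTriangle? G)
      (Unique.cartesianProduct⁺ (Unique.allFin⁺ n)
        (Unique.cartesianProduct⁺ (Unique.allFin⁺ n) (Unique.allFin⁺ n)))

    order : Edge n → Edge n
    order (u , v) = if does (u Fin.<? v) then (u , v) else (v , u)

    order-< : ∀ {u v} → u Fin.< v → order (u , v) ≡ (u , v)
    order-< {u} {v} u<v = cong (if_then (u , v) else (v , u)) (dec-true (u Fin.<? v) u<v)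

    order-> : ∀ {u v} → v Fin.< u → order (u , v) ≡ (v , u)
    order-> {u} {v} v<u = cong (if_then (u , v) else (v , u)) (dec-false (u Fin.<? v) (Fin.<-asym v<u))

    -- A cover `Y` may repeat edges, reverse them or list pairs that are not edges. The edges of `G`
    -- that it names form a sublist of `edges G`, and they all occur in `map order Y`, so there are
    -- no more of them than entries of `Y`.
    τ≤cover : ∀ {Y} → TriangleFree (G ─ Y) → τ G ≤ length Y
    τ≤cover {Y} free = ℕ.≤-trans
      (All.lookup (min≤xs (length (edges G)) _)
        (∈-map⁺ length (∈-filter⁺ (λ Z → triangleFree? (G ─ Z))
          (filter-∈-sublists (_∈±? Y) (edges G))
          (triangleFree-─ (λ e e∈Y → inj₁ (∈-filter⁺ (_∈±? Y) (isEdge⇒∈-edges e) e∈Y)) free))))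
      (subst (length (filter (_∈±? Y) (edges G)) ≤_) (length-map order Y)
        (length-mono-⊆ _≟ᴱ_ (Unique.filter⁺ (_∈±? Y) edges-unique) ordered))
      where
      ordered : ∀ {e} → e ∈ filter (_∈±? Y) (edges G) → e ∈ map order Y
      ordered e∈ with e∈E , e∈Y ← ∈-filter⁻ (_∈±? Y) {xs = edges G} e∈
                 with _ , (u<v , _) ←
                      ∈-filter⁻ (isEdge? G) {xs = cartesianProduct (allFin n) (allFin n)} e∈E
                 with e∈Y
      ... | inj₁ e∈Y = subst (_∈ _) (order-< u<v) (∈-map⁺ order e∈Y)
      ... | inj₂ e∈Y = subst (_∈ _) (order-> u<v) (∈-map⁺ order e∈Y)

    -- The entries of `T` are distinct, since no triangle is edge-disjoint from itself. Hence
    -- filtering `triangles G` by membership in `T` gives a packing in the right order that is at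
    -- least as long.
    packing≤ν : ∀ {T} → AllPairs EdgeDisjoint T → All (IsTriangle G) T → length T ≤ ν G
    packing≤ν {T} disj tri = ℕ.≤-trans
      (length-mono-⊆ _≟_ (AllPairs.map (λ { {s} d refl → edgeDisjoint-irrefl {s} d }) disj)
        λ t∈T → ∈-filter⁺ (_∈ᵀ? T) (isTriangle (All.lookup tri t∈T)) t∈T)
      (All.lookup (xs≤max 0 _)
        (∈-map⁺ length (∈-filter⁺ (allPairs? edgeDisjoint?)
          (filter-∈-sublists (_∈ᵀ? T) (triangles G))
          (allPairs-tabulate (Unique.filter⁺ (_∈ᵀ? T) triangles-unique)
            λ {s} {t} s∈ t∈ → allPairs-lookup {R = EdgeDisjoint}
              (λ {s} {t} → edgeDisjoint-sym {s} {t}) disj (inT s∈) (inT t∈)))))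
      where
      _≟_ : DecidableEquality (Triangle n)
      _≟_ = ≡-dec Fin._≟_ _≟ᴱ_
      open DecMembership _≟_ using () renaming (_∈?_ to _∈ᵀ?_)
      isTriangle : ∀ {t} → IsTriangle G t → t ∈ triangles G
      isTriangle {u , v , w} = ∈-filter⁺ (isTriangle? G)
        (∈-cartesianProduct⁺ (∈-allFin u) (allEdges (v , w)))
      inT : ∀ {t} → t ∈ filter (_∈ᵀ? T) (triangles G) → t ∈ T
      inT = proj₂ ∘ ∈-filter⁻ (_∈ᵀ? T) {xs = triangles G}

    solution⇒τ≤2ν : Solution G → τ G ≤ 2 * ν G
    solution⇒τ≤2ν s = ℕ.≤-trans (τ≤cover covers)
      (ℕ.≤-trans bound (ℕ.*-monoʳ-≤ 2 (packing≤ν disjoint triangle)))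
      where open Solution s

    length-edges-─ : ∀ {D} → Any (λ (u , v) → u ~ v) D →
                     length (edges (G ─ D)) ℕ.< length (edges G)
    length-edges-─ {D} any with (u , v) , e∈D , u~v ← find any
                           with Fin.<-cmp u v
    ... | tri< u<v _ _ = length-filter-strict (isEdge? (G ─ D)) (isEdge? G) (proj₁ ∘ isEdge-─)
            (allEdges (u , v)) (u<v , u~v) λ p → proj₂ (isEdge-─ p) (inj₁ e∈D)
    ... | tri≈ _ refl _ = contradiction u~v ~-irref
    ... | tri> _ _ v<u = length-filter-strict (isEdge? (G ─ D)) (isEdge? G) (proj₁ ∘ isEdge-─)
            (allEdges (v , u)) (v<u , ~-sym u~v) λ p → proj₂ (isEdge-─ p) (inj₂ e∈D)

    -- The sides of `T` lie in the deleted `D`, so `T` is edge-disjoint from any packing of what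
    -- remains. A triangle avoiding `X` has no side in `D`: that side would be in `X`, or
    -- removability would put another side into `X`. So it survives in the smaller graph and meets
    -- the old cover.
    extend : ∀ T X D → AllPairs EdgeDisjoint T → All (IsTriangle G) T →
             length X ≤ 2 * length T →
             All (λ t → All (_∈± D) (triangleEdges t)) T →
             All (Removable G X) D →
             Solution (G ─ (X ++ D)) → Solution G
    extend T X D disj tri |X|≤ T⊆D rem s = record
      { packing  = T ++ packing
      ; disjoint = AllPairs.++⁺ disj disjoint
          (All.map (λ {s} t⊆D → All.map (λ {t} → apart {s} {t} t⊆D) triangle) T⊆D)
      ; triangle = All.++⁺ tri (All.map (All.map (proj₁ ∘ isEdge-─)) triangle)
      ; cover    = X ++ cover
      ; covers   = free
      ; bound    = bound′
      }
      where
      open Solution s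

      apart : ∀ {s t} → All (_∈± D) (triangleEdges s) → IsTriangle (G ─ (X ++ D)) t →
              EdgeDisjoint s t
      apart t⊆D t (p , q) =
        proj₂ (isEdge-─ (All.lookup t q)) (Sum.map (∈-++⁺ʳ X) (∈-++⁺ʳ X) (All.lookup t⊆D p))

      bound′ : length (X ++ cover) ≤ 2 * length (T ++ packing)
      bound′ rewrite length-++ X {cover} | length-++ T {packing}
                   | ℕ.*-distribˡ-+ 2 (length T) (length packing) = ℕ.+-mono-≤ |X|≤ bound

      removable : ∀ {e} → e ∈± D → Removable G X e
      removable (inj₁ e∈D) = All.lookup rem e∈D
      removable (inj₂ e∈D) = Sum.map Sum.swap (λ f x p q → Sum.swap (f x q p)) (All.lookup rem e∈D)

      free : TriangleFree (G ─ (X ++ cover))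
      free u v w t@(uv ∷ uw ∷ vw ∷ []) = covers u v w (step uv ¬uv ∷ step uw ¬uw ∷ step vw ¬vw ∷ [])
        where
        G~ : ∀ {e} → IsEdge (G ─ (X ++ cover)) e → proj₁ e ~ proj₂ e
        G~ = proj₂ ∘ proj₁ ∘ isEdge-─
        ∉X : ∀ {e} → IsEdge (G ─ (X ++ cover)) e → ¬ e ∈± X
        ∉X p = proj₂ (isEdge-─ p) ∘ Sum.map ∈-++⁺ˡ ∈-++⁺ˡ
        survives : ∀ {e} x → IsEdge (G ─ (X ++ cover)) e → proj₁ e ~ x → proj₂ e ~ x →
                   ¬ (proj₁ e , x) ∈± X → ¬ (proj₂ e , x) ∈± X → ¬ e ∈± D
        survives x p ux vx ¬ux ¬vx e∈D =
          [ ∉X p , (λ f → [ ¬ux , ¬vx ]′ (f x ux vx)) ]′ (removable e∈D)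
        ¬uv : ¬ (u , v) ∈± D
        ¬uv = survives w uv (G~ uw) (G~ vw) (∉X uw) (∉X vw)
        ¬uw : ¬ (u , w) ∈± D
        ¬uw = survives v uw (G~ uv) (~-sym (G~ vw)) (∉X uv) (∉X vw ∘ Sum.swap)
        ¬vw : ¬ (v , w) ∈± D
        ¬vw = survives u vw (~-sym (G~ uv)) (~-sym (G~ uw)) (∉X uv ∘ Sum.swap) (∉X uw ∘ Sum.swap)
        step : ∀ {e} → IsEdge (G ─ (X ++ cover)) e → ¬ e ∈± D →
               IsEdge ((G ─ (X ++ D)) ─ cover) e
        step p ¬D with (q@(u<v , u~v) , ∉) ← isEdge-─ p =
          u<v
          , (u~v , (λ m → bad (inj₁ m)) , λ m → bad (inj₂ m))
          , (λ m → ∉ (inj₁ (∈-++⁺ʳ X m))) , λ m → ∉ (inj₂ (∈-++⁺ʳ X m))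
          where
          bad : ¬ _ ∈± X ++ D
          bad = [ ∉X p , ¬D ]′ ∘ ∈±-++⁻ X

  -- Hence a minimal counterexample is irreducible.
  irreducible-induction :
    (P : Graph n → Set) → (∀ {G} Y → P G → P (G ─ Y)) →
    (∀ G → P G → Irreducible G → ¬ ¬ Solution G) →
    ∀ G → P G → ¬ ¬ Solution G
  irreducible-induction P P-─ base G = go (suc (length (edges G))) G ℕ.≤-refl
    where
    go : ∀ k G → length (edges G) ℕ.< k → P G → ¬ ¬ Solution G
    -- Under the assumption `none`, every reduction of `G` is refuted by the induction hypothesis,
    -- because `extend` would carry a solution of the smaller graph back to `G`.
    go (suc k) G (s≤s e<k) PG none = base G PG irr none
      where
      irr : Irreducible G
      irr T X D disj tri bnd T⊆D rem any =
        go k (G ─ (X ++ D)) (ℕ.<-≤-trans (length-edges-─ {G} (Any.++⁺ʳ X any)) e<k) (P-─ (X ++ D) PG)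
          (none ∘ extend T X D disj tri bnd T⊆D rem)


-- List positions and binary digits

module _ {A : Set} (d : A) where

  at : List A → ℕ → A
  at []       _       = d
  at (x ∷ _)  zero    = x
  at (_ ∷ xs) (suc i) = at xs i

  at-∈ : ∀ xs {i} → i ℕ.< length xs → at xs i ∈ xs
  at-∈ (x ∷ xs) {zero}  _         = here refl
  at-∈ (x ∷ xs) {suc i} (s<s i<l) = there (at-∈ xs i<l)

  ∈-at : ∀ {x xs} → x ∈ xs → ∃[ i ] i ℕ.< length xs × x ≡ at xs i
  ∈-at (here x≡y)   = 0 , z<s , x≡y
  ∈-at (there x∈xs) = let (i , i<l , x≡) = ∈-at x∈xs in suc i , s<s i<l , x≡

  at-injective : ∀ {xs i j} → Unique xs → i ℕ.< length xs → j ℕ.< length xs →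
                 at xs i ≡ at xs j → i ≡ j
  at-injective {_ ∷ _}  {zero}  {zero}  _          _       _       _  = refl
  at-injective {_ ∷ xs} {zero}  {suc j} (x∉xs ∷ _) _       (s<s q) eq =
    contradiction eq (All.lookup x∉xs (at-∈ xs q))
  at-injective {_ ∷ xs} {suc i} {zero}  (x∉xs ∷ _) (s<s p) _       eq =
    contradiction (sym eq) (All.lookup x∉xs (at-∈ xs p))
  at-injective {_ ∷ _}  {suc i} {suc j} (_ ∷ uniq) (s<s p) (s<s q) eq =
    cong suc (at-injective uniq p q eq)

  at-++ : ∀ xs {ys i} → i ℕ.< length xs → at (xs ++ ys) i ≡ at xs i
  at-++ (x ∷ xs) {i = zero}  _       = refl
  at-++ (x ∷ xs) {i = suc i} (s<s p) = at-++ xs p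

bit : ℕ → ℕ → Bool
bit zero    c = (c ℕ.% 2) ℕ.≡ᵇ 1
bit (suc a) c = bit a (c ℕ./ 2)

fromBits : List Bool → ℕ
fromBits []           = 0
fromBits (true  ∷ bs) = suc (fromBits bs * 2)
fromBits (false ∷ bs) = fromBits bs * 2

module _ where
  open import Data.Nat.DivMod using (m*n/n≡m; m*n%n≡0; [m+kn]%n≡m%n; +-distrib-/-∣ʳ)

  half-odd : ∀ m → suc (m * 2) ℕ./ 2 ≡ m
  half-odd m = trans (+-distrib-/-∣ʳ 1 {m * 2} {2} (divides m refl)) (m*n/n≡m m 2)

  bit-fromBits : ∀ bs {a} → a ℕ.< length bs → bit a (fromBits bs) ≡ at false bs a
  bit-fromBits (true  ∷ bs) {zero}  _ = cong (ℕ._≡ᵇ 1) ([m+kn]%n≡m%n 1 (fromBits bs) 2)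
  bit-fromBits (false ∷ bs) {zero}  _ = cong (ℕ._≡ᵇ 1) (m*n%n≡0 (fromBits bs) 2)
  bit-fromBits (true  ∷ bs) {suc a} (s<s p) =
    trans (cong (bit a) (half-odd (fromBits bs))) (bit-fromBits bs p)
  bit-fromBits (false ∷ bs) {suc a} (s<s p) =
    trans (cong (bit a) (m*n/n≡m (fromBits bs) 2)) (bit-fromBits bs p)

  bit-zero : ∀ a → bit a 0 ≡ false
  bit-zero zero    = refl
  bit-zero (suc a) = bit-zero a

fromBits-< : ∀ bs → fromBits bs ℕ.< 2 ^ length bs
fromBits-< []           = s≤s z≤n
fromBits-< (true  ∷ bs) rewrite ℕ.*-comm 2 (2 ^ length bs) = ℕ.*-monoˡ-≤ 2 (fromBits-< bs)
fromBits-< (false ∷ bs) rewrite ℕ.*-comm 2 (2 ^ length bs) =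
  ℕ.≤-trans (ℕ.n≤1+n _) (ℕ.*-monoˡ-≤ 2 (fromBits-< bs))

-- Local pictures and the checker for their certificates

-- A vertex of a local picture is a pair (c , i).  The pairs (0 , i) are the
-- named vertices, of which the first r have all their neighbours in the
-- picture; for c > 0, the (c , i) are the other vertices whose adjacencies to
-- those r vertices are the binary digits of c.
Label LEdge LTriangle : Set
Label     = ℕ × ℕ
LEdge     = Label × Label
LTriangle = Label × Label × Label

_≟ᴸ_ : DecidableEquality Label
_≟ᴸ_ = ≡-dec ℕ._≟_ ℕ._≟_

-- In the trees below the label (c , i) is written as the number 10 c + i, and
-- edges and triangles as the concatenation of two-digit labels.
label : ℕ → Label
label ℓ = ℓ ℕ./ 10 , ℓ ℕ.% 10

edge : ℕ → LEdge
edge e = label (e ℕ./ 100) , label (e ℕ.% 100)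

triangle : ℕ → LTriangle
triangle t = label (t ℕ./ 10000) , edge (t ℕ.% 10000)

sides : LTriangle → List LEdge
sides (i , j , k) = (i , j) ∷ (i , k) ∷ (j , k) ∷ []

-- A case analysis showing that a picture is reducible: split e t₀ t₁ continues with
-- t₀ if e is absent and with t₁ if it is present; forced (x y) w z uses that y is
-- not the one neighbour of w, other than x, to which x is nonadjacent, namely z;
-- reduce T X D deletes X, the edges of T and the edges D.
data Tree : Set where
  split   : ℕ → Tree → Tree → Tree
  forced  : ℕ → ℕ → ℕ → Tree → Tree
  reduce  : List ℕ → List ℕ → List ℕ → Tree

-- `sizes` gives the number of vertices in each class, and `matched` lists the named vertices at
-- which nonadjacency between neighbours is a matching. No graph occurs, so a tree is checked once
-- and applies to every graph with these sizes.
module Check (r : ℕ) (sizes matched : List ℕ) where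

  size : ℕ → ℕ
  size = at 0 sizes

  labels : List Label
  labels = concatMap (λ c → map (c ,_) (upTo (size c))) (upTo (2 ^ r))

  Valid Closed : Label → Set
  Valid  (c , i) = c ℕ.< 2 ^ r × i ℕ.< size c
  Closed (c , i) = c ≡ 0 × i ℕ.< r

  valid? : ∀ i → Dec (Valid i)
  valid? (c , i) = c ℕ.<? 2 ^ r ×-dec i ℕ.<? size c

  closed? : ∀ i → Dec (Closed i)
  closed? (c , i) = c ℕ.≟ 0 ×-dec i ℕ.<? r

  -- The class of an unnamed vertex settles its adjacency to each closed vertex. Between two named
  -- or two unnamed vertices the labels settle nothing.
  Linked : Bool → Rel Label 0ℓ
  Linked b i j = Closed i × proj₁ j ≢ 0 × bit (proj₂ i) (proj₁ j) ≡ b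

  linked? : ∀ b i j → Dec (Linked b i j)
  linked? b i j = closed? i ×-dec ¬? (proj₁ j ℕ.≟ 0) ×-dec (bit (proj₂ i) (proj₁ j) Bool.≟ b)

  -- Validity is demanded because an index out of range would denote the default vertex of `at`.
  Known : Bool → List LEdge → Rel Label 0ℓ
  Known b F i j = Valid i × Valid j × ((i , j) ∈± F ⊎ Linked b i j ⊎ Linked b j i)

  known? : ∀ b F i j → Dec (Known b F i j)
  known? b F i j = valid? i ×-dec valid? j ×-dec
    (∈±? _≟ᴸ_ (i , j) F ⊎-dec linked? b i j ⊎-dec linked? b j i)

  module _ (X A : List LEdge) where

    -- The third vertex of a triangle on the edge is a neighbour of the closed vertex `i` and hence
    -- among `labels`. Thus a finite check shows that no such triangle avoids `X`.
    Shut : Rel Label 0ℓ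
    Shut i j = Closed i × All (λ k →
      (i , k) ∈± X ⊎ (j , k) ∈± X ⊎ Known false A i k ⊎ Known false A j k ⊎ k ≡ i ⊎ k ≡ j) labels

    shut? : ∀ i j → Dec (Shut i j)
    shut? i j = closed? i ×-dec All.all? (λ k →
      ∈±? _≟ᴸ_ (i , k) X ⊎-dec ∈±? _≟ᴸ_ (j , k) X ⊎-dec
      known? false A i k ⊎-dec known? false A j k ⊎-dec k ≟ᴸ i ⊎-dec k ≟ᴸ j) labels

    Gone : Pred LEdge 0ℓ
    Gone (i , j) = (i , j) ∈± X ⊎ Shut i j ⊎ Shut j i

    gone? : Decidable Gone
    gone? (i , j) = ∈±? _≟ᴸ_ (i , j) X ⊎-dec shut? i j ⊎-dec shut? j i

  Apart : Rel LTriangle 0ℓ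
  Apart s t = All (λ e → ¬ e ∈± sides t) (sides s)

  Holds : (P A : List LEdge) → Tree → Set
  Holds P A (split e t₀ t₁)    = Holds P (edge e ∷ A) t₀ × Holds (edge e ∷ P) A t₁
  Holds P A (forced e w z t)   =
    let x , y = edge e in
    w ∈ matched × All (Known true P (label w)) (x ∷ y ∷ label z ∷ []) × Known false A x (label z) ×
    x ≢ y × x ≢ label z × y ≢ label z × Holds (edge e ∷ P) A t
  Holds P A (reduce T X D) =
    let T′ = map triangle T ; D′ = concatMap sides T′ ++ map edge D in
    All (All (λ (i , j) → Known true P i j) ∘ sides) T′ ×
    AllPairs Apart T′ ×
    length X ≤ 2 * length T ×
    All (Gone (map edge X) A) D′ ×
    -- A leaf may pack no triangle and just delete an edge lying in no triangle. This condition
    -- excludes leaves that delete nothing.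
    Any (λ (i , j) → Known true P i j) D′

  holds? : ∀ P A t → Dec (Holds P A t)
  holds? P A (split e t₀ t₁) = holds? P (edge e ∷ A) t₀ ×-dec holds? (edge e ∷ P) A t₁
  holds? P A (forced e w z t) =
    let x , y = edge e in
    w ∈? matched ×-dec All.all? (known? true P (label w)) (x ∷ y ∷ label z ∷ []) ×-dec
    known? false A x (label z) ×-dec ¬? (x ≟ᴸ y) ×-dec ¬? (x ≟ᴸ label z) ×-dec ¬? (y ≟ᴸ label z) ×-dec
    holds? (edge e ∷ P) A t
    where open DecMembership ℕ._≟_ using (_∈?_)
  holds? P A (reduce T X D) =
    let T′ = map triangle T ; D′ = concatMap sides T′ ++ map edge D in
    All.all? (All.all? (λ (i , j) → known? true P i j) ∘ sides) T′ ×-dec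
    allPairs? (λ s t → All.all? (λ e → ¬? (∈±? _≟ᴸ_ e (sides t))) (sides s)) T′ ×-dec
    length X ℕ.≤? 2 * length T ×-dec
    All.all? (gone? (map edge X) A) D′ ×-dec
    Any.any? (λ (i , j) → known? true P i j) D′


-- Soundness of the checker

module _ {n : ℕ} (G : Graph n) where
  open Graph G

  triple : Fin n → Fin n → Fin n → List (Edge n)
  triple u v w = (u , v) ∷ (u , w) ∷ (v , w) ∷ []

  -- `IsTriangle` wants increasing vertices, whereas the order of the labels is unrelated to that of
  -- the vertices they denote.
  sort : Fin n → Fin n → Fin n → Triangle n
  sort u v w with u Fin.<? v | u Fin.<? w | v Fin.<? w
  ... | yes _ | _     | yes _ = u , v , w
  ... | yes _ | yes _ | no _  = u , w , v
  ... | yes _ | no _  | no _  = w , u , v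
  ... | no _  | yes _ | _     = v , u , w
  ... | no _  | no _  | yes _ = v , w , u
  ... | no _  | no _  | no _  = w , v , u

  private
    ≮⇒> : ∀ {u v} → u ~ v → ¬ u Fin.< v → v Fin.< u
    ≮⇒> {u} {v} u~v u≮v with Fin.<-cmp u v
    ... | tri< u<v _ _  = contradiction u<v u≮v
    ... | tri≈ _ refl _ = contradiction u~v ~-irref
    ... | tri> _ _ v<u  = v<u

  sort-triangle : ∀ {u v w} → u ~ v → u ~ w → v ~ w →
                  IsTriangle G (sort u v w) × All (_∈± triple u v w) (triangleEdges (sort u v w))
  sort-triangle {u} {v} {w} uv uw vw with u Fin.<? v | u Fin.<? w | v Fin.<? w
  ... | yes p | _     | yes r = ((p , uv) ∷ (Fin.<-trans p r , uw) ∷ (r , vw) ∷ []) ,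
        (inj₁ (here refl) ∷ inj₁ (there (here refl)) ∷ inj₁ (there (there (here refl))) ∷ [])
  ... | yes p | yes q | no r  = ((q , uw) ∷ (p , uv) ∷ (≮⇒> vw r , ~-sym vw) ∷ []) ,
        (inj₁ (there (here refl)) ∷ inj₁ (here refl) ∷ inj₂ (there (there (here refl))) ∷ [])
  ... | yes p | no q  | no r  = ((≮⇒> uw q , ~-sym uw) ∷ (≮⇒> vw r , ~-sym vw) ∷ (p , uv) ∷ []) ,
        (inj₂ (there (here refl)) ∷ inj₂ (there (there (here refl))) ∷ inj₁ (here refl) ∷ [])
  ... | no p  | yes q | _     =
        ((≮⇒> uv p , ~-sym uv) ∷ (Fin.<-trans (≮⇒> uv p) q , vw) ∷ (q , uw) ∷ []) ,
        (inj₂ (here refl) ∷ inj₁ (there (there (here refl))) ∷ inj₁ (there (here refl)) ∷ [])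
  ... | no p  | no q  | yes r = ((r , vw) ∷ (≮⇒> uv p , ~-sym uv) ∷ (≮⇒> uw q , ~-sym uw) ∷ []) ,
        (inj₁ (there (there (here refl))) ∷ inj₂ (here refl) ∷ inj₂ (there (here refl)) ∷ [])
  ... | no p  | no q  | no r  =
        ((≮⇒> vw r , ~-sym vw) ∷ (≮⇒> uw q , ~-sym uw) ∷ (≮⇒> uv p , ~-sym uv) ∷ []) ,
        (inj₂ (there (there (here refl))) ∷ inj₂ (there (here refl)) ∷ inj₂ (here refl) ∷ [])

  MatchedNonadjacency : Fin n → Set
  MatchedNonadjacency v = ∀ {x y z} → v ~ x → v ~ y → v ~ z → x ≢ y → x ≢ z → y ≢ z →
                          ¬ x ~ y → ¬ x ~ z → ⊥

-- The closed vertices are `s ∷ ss`, nonempty so that `s` can be the default of `at`. Those in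
-- `others` are named without being closed.
module Picture {n : ℕ} (G : Graph n) (s : Fin n) (ss others : List (Fin n)) where
  open Graph G

  private
    r = suc (length ss)

  named : List (Fin n)
  named = s ∷ ss ++ others

  open DecMembership (Fin._≟_ {n}) using (_∈?_)

  code : Fin n → ℕ
  code x = fromBits (map (λ v → does (v ~? x)) (s ∷ ss))

  -- Class 0 also receives the unnamed vertices with no closed neighbour. They are outside `part 0`,
  -- and outside the picture altogether.
  class : Fin n → ℕ
  class x = if does (x ∈? named) then 0 else code x

  part : ℕ → List (Fin n)
  part zero    = named
  part (suc c) = filter (λ x → class x ℕ.≟ suc c) (allFin n)

  vertex : Label → Fin n
  vertex (c , i) = at s (part c) i

  ∈-part⁻ : ∀ {c x} → x ∈ part (suc c) → class x ≡ suc c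
  ∈-part⁻ {c} = proj₂ ∘ ∈-filter⁻ (λ x → class x ℕ.≟ suc c) {xs = allFin n}

  named-class : ∀ {x} → x ∈ named → class x ≡ 0
  named-class {x} x∈ = cong (if_then 0 else code x) (dec-true (x ∈? named) x∈)

  unnamed-class : ∀ {x} → x ∉ named → class x ≡ code x
  unnamed-class {x} x∉ = cong (if_then 0 else code x) (dec-false (x ∈? named) x∉)

  code-< : ∀ x → code x ℕ.< 2 ^ r
  code-< x = subst (λ k → code x ℕ.< 2 ^ k) (length-map _ (s ∷ ss))
    (fromBits-< (map (λ v → does (v ~? x)) (s ∷ ss)))

  class-code : ∀ {x c} → class x ≡ suc c → code x ≡ suc c
  class-code {x} = if-suc (does (x ∈? named))
    where
    if-suc : ∀ b {m c} → (if b then 0 else m) ≡ suc c → m ≡ suc c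
    if-suc false eq = eq

  part-class : ∀ {c x} → x ∈ part c → class x ≡ c
  part-class {zero}  = named-class
  part-class {suc c} = ∈-part⁻

  bit-code : ∀ {a x} → a ℕ.< r → bit a (code x) ≡ does (at s (s ∷ ss) a ~? x)
  bit-code {a} {x} a<r =
    trans (bit-fromBits (map (λ v → does (v ~? x)) (s ∷ ss))
            (subst (a ℕ.<_) (sym (length-map _ (s ∷ ss))) a<r))
          (at-map (s ∷ ss) a<r)
    where
    at-map : ∀ vs {a} → a ℕ.< length vs →
             at false (map (λ v → does (v ~? x)) vs) a ≡ does (at s vs a ~? x)
    at-map (v ∷ vs) {zero}  _       = refl
    at-map (v ∷ vs) {suc a} (s<s p) = at-map vs p

  module _ (uniq : Unique named) where

    private
      part-unique : ∀ c → Unique (part c)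
      part-unique zero    = uniq
      part-unique (suc c) = Unique.filter⁺ (λ x → class x ℕ.≟ suc c) (Unique.allFin⁺ n)

    module _ (irr : Irreducible G) (sizes matched : List ℕ)
             (sizes-≡ : All (λ c → length (part c) ≡ at 0 sizes c) (upTo (2 ^ r)))
             (matching : All (MatchedNonadjacency G ∘ vertex ∘ label) matched) where

      open Check r sizes matched

      private
        size-≡ : ∀ {c} → c ℕ.< 2 ^ r → length (part c) ≡ size c
        size-≡ c< = All.lookup sizes-≡ (∈-upTo⁺ c<)

        in-part : ∀ {c i} → Valid (c , i) → i ℕ.< length (part c)
        in-part {i = i} (c< , i<) = subst (i ℕ.<_) (sym (size-≡ c<)) i<

        vertex-∈ : ∀ {i} → Valid i → vertex i ∈ part (proj₁ i)
        vertex-∈ {c , i} v = at-∈ s (part c) (in-part v)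

        -- A vertex determines its class, so parts are disjoint, and each is free of repetitions.
        -- This is what carries edge-disjointness from labels to `G`.
        vertex-injective : ∀ {i j} → Valid i → Valid j → vertex i ≡ vertex j → i ≡ j
        vertex-injective {c , i} {d , j} p q eq
          with refl ← trans (sym (part-class {c} (vertex-∈ p)))
                        (trans (cong class eq) (part-class {d} (vertex-∈ q)))
          = cong (c ,_) (at-injective s (part-unique c) (in-part p) (in-part q) eq)

        closed-vertex : ∀ {i} → Closed i → vertex i ≡ at s (s ∷ ss) (proj₂ i)
        closed-vertex (refl , a<r) = at-++ s (s ∷ ss) a<r

        bit-closed : ∀ {i x} → Closed i → bit (proj₂ i) (code x) ≡ does (vertex i ~? x)
        bit-closed {i} {x} cl rewrite closed-vertex cl = bit-code (proj₂ cl)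

        linked : ∀ {b i j} → Valid j → Linked b i j → does (vertex i ~? vertex j) ≡ b
        linked {j = zero , _}  _  (_ , ≢0 , _)   = contradiction refl ≢0
        linked {i = i} {j = suc c , k} vj (cl , _ , eq) =
          trans (sym (bit-closed cl))
            (trans (cong (bit (proj₂ i)) (class-code (∈-part⁻ {c} (vertex-∈ vj)))) eq)

        reflect : ∀ {u v b} → does (u ~? v) ≡ b → if b then u ~ v else ¬ u ~ v
        reflect {u} {v} refl with u ~? v
        ... | yes p = p
        ... | no ¬p = ¬p

        in-labels : ∀ {c x} → c ℕ.< 2 ^ r → x ∈ part c → ∃[ k ] k ∈ labels × x ≡ vertex k
        in-labels {c} c< x∈ with k , k< , x≡ ← ∈-at s x∈ =
          (c , k) , ∈-concatMap⁺ (λ c → map (c ,_) (upTo (size c))) {xs = upTo (2 ^ r)}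
            (lose (∈-upTo⁺ c<) (∈-map⁺ (c ,_) (∈-upTo⁺ (subst (k ℕ.<_) (size-≡ c<) k<)))) , x≡

        -- An unnamed neighbour of `i` has the digit of `i` set in its code. The code is therefore
        -- not 0, and the part with that number contains the vertex.
        neighbour : ∀ {i x} → Closed i → vertex i ~ x → ∃[ k ] k ∈ labels × x ≡ vertex k
        neighbour {i} {x} cl i~x with x ∈? named
        ... | yes x∈ = in-labels (ℕ.m^n>0 2 r) x∈
        ... | no x∉ with code x in code≡
        ...   | zero  = contradiction
                (trans (sym (bit-zero (proj₂ i)))
                  (trans (cong (bit (proj₂ i)) (sym code≡))
                    (trans (bit-closed cl) (dec-true (vertex i ~? x) i~x))))
                λ ()
        ...   | suc c = in-labels (subst (ℕ._< 2 ^ r) code≡ (code-< x))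
                (∈-filter⁺ (λ x → class x ℕ.≟ suc c) (∈-allFin x) (trans (unnamed-class x∉) code≡))

        image : LEdge → Edge n
        image (i , j) = vertex i , vertex j

        ∈±-image : ∀ {e F} → e ∈± F → image e ∈± map image F
        ∈±-image = Sum.map (∈-map⁺ image) (∈-map⁺ image)

        Present Absent : LEdge → Set
        Present (i , j) = vertex i ~ vertex j
        Absent  (i , j) = ¬ vertex i ~ vertex j

      module _ {P A : List LEdge} where

        present : All Present P → ∀ {i j} → Known true P i j → Present (i , j)
        present ps (_ , _ , inj₁ (inj₁ e∈)) = All.lookup ps e∈
        present ps (_ , _ , inj₁ (inj₂ e∈)) = ~-sym (All.lookup ps e∈)
        present ps (_ , vj , inj₂ (inj₁ l)) = reflect (linked vj l)
        present ps (vi , _ , inj₂ (inj₂ l)) = ~-sym (reflect (linked vi l))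

        absent : All Absent A → ∀ {i j} → Known false A i j → Absent (i , j)
        absent as (_ , _ , inj₁ (inj₁ e∈)) = All.lookup as e∈
        absent as (_ , _ , inj₁ (inj₂ e∈)) = All.lookup as e∈ ∘ ~-sym
        absent as (_ , vj , inj₂ (inj₁ l)) = reflect (linked vj l)
        absent as (vi , _ , inj₂ (inj₂ l)) = reflect (linked vi l) ∘ ~-sym

        removable : All Absent A → ∀ {X e} → Gone X A e → Removable G (map image X) (image e)
        removable as (inj₁ e∈X) = inj₁ (∈±-image e∈X)
        removable as {X} {i , j} (inj₂ shut) = inj₂ (third shut)
          where
          shut⇒ : ∀ {i j} → Shut X A i j → ∀ x → vertex i ~ x → vertex j ~ x →
                  (vertex i , x) ∈± map image X ⊎ (vertex j , x) ∈± map image X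
          shut⇒ (cl , all) x i~x j~x
            with k , k∈ , refl ← neighbour cl i~x
            with All.lookup all k∈
          ... | inj₁ ik∈X                                    = inj₁ (∈±-image ik∈X)
          ... | inj₂ (inj₁ jk∈X)                             = inj₂ (∈±-image jk∈X)
          ... | inj₂ (inj₂ (inj₁ ¬ik))                       = contradiction i~x (absent as ¬ik)
          ... | inj₂ (inj₂ (inj₂ (inj₁ ¬jk)))                = contradiction j~x (absent as ¬jk)
          ... | inj₂ (inj₂ (inj₂ (inj₂ (inj₁ refl))))        = contradiction i~x ~-irref
          ... | inj₂ (inj₂ (inj₂ (inj₂ (inj₂ refl))))        = contradiction j~x ~-irref
          third : Shut X A i j ⊎ Shut X A j i → ∀ x → vertex i ~ x → vertex j ~ x →
                  (vertex i , x) ∈± map image X ⊎ (vertex j , x) ∈± map image X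
          third (inj₁ sh) = shut⇒ sh
          third (inj₂ sh) x p q = Sum.swap (shut⇒ sh x q p)

        private
          ValidEdge : LEdge → Set
          ValidEdge (i , j) = Valid i × Valid j

        image-injective : ∀ {e f} → ValidEdge e → ValidEdge f → image e ≡ image f → e ≡ f
        image-injective (p , q) (p′ , q′) eq =
          cong₂ _,_ (vertex-injective p p′ (cong proj₁ eq)) (vertex-injective q q′ (cong proj₂ eq))

        ∈±-image⁻ : ∀ {E F e} → All ValidEdge E → All ValidEdge F →
                    e ∈± map image E → e ∈± map image F → ∃[ f ] f ∈ E × f ∈± F
        ∈±-image⁻ {E} {F} vE vF (inj₁ p) q = same p q
          where
          same : ∀ {e} → e ∈ map image E → e ∈± map image F → ∃[ f ] f ∈ E × f ∈± F
          same p (inj₁ q) with f , f∈ , refl ← ∈-map⁻ image p with g , g∈ , eq ← ∈-map⁻ image q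
            with refl ← image-injective (All.lookup vE f∈) (All.lookup vF g∈) eq = f , f∈ , inj₁ g∈
          same p (inj₂ q) with f , f∈ , refl ← ∈-map⁻ image p with g , g∈ , eq ← ∈-map⁻ image q
            with refl ← image-injective (swap (All.lookup vE f∈)) (All.lookup vF g∈) eq = f , f∈ , inj₂ g∈
        ∈±-image⁻ vE vF (inj₂ p) q = ∈±-image⁻ vE vF (inj₁ p) (Sum.swap q)

      -- Induction on the tree. A `split` is decided in `G`, a `forced` edge cannot be absent by the
      -- matching at `w`, and at a leaf the images of `T`, `X` and `D` contradict irreducibility.
      sound : ∀ t {P A} → Holds P A t → All Present P → All Absent A → ⊥
      sound (split e t₀ t₁) (h₀ , h₁) ps as
        with vertex (proj₁ (edge e)) ~? vertex (proj₂ (edge e))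
      ... | yes p = sound t₁ h₁ (p ∷ ps) as
      ... | no ¬p = sound t₀ h₀ ps (¬p ∷ as)
      sound (forced e w z t) {P} {A} (w∈ , (wx ∷ wy ∷ wz ∷ []) , ¬xz , x≢y , x≢z , y≢z , h) ps as
        with vertex (proj₁ (edge e)) ~? vertex (proj₂ (edge e))
      ... | yes p = sound t h (p ∷ ps) as
      ... | no ¬p = All.lookup matching w∈
            (present {P} {A} ps wx) (present {P} {A} ps wy) (present {P} {A} ps wz)
            (x≢y ∘ vertex-injective (proj₁ (proj₂ wx)) (proj₁ (proj₂ wy)))
            (x≢z ∘ vertex-injective (proj₁ (proj₂ wx)) (proj₁ (proj₂ wz)))
            (y≢z ∘ vertex-injective (proj₁ (proj₂ wy)) (proj₁ (proj₂ wz)))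
            ¬p (absent {P} {A} as ¬xz)
      sound (reduce T X D) {P} {A} (tri , apart , |X|≤ , gone , some) ps as =
        irr (map face T′) (map image (map edge X)) (map image D′)
            (AllPairs.map⁺ (disjoint (All.map (λ k → k , All.map (λ (p , q , _) → p , q) k) tri) apart))
            (All.map⁺ (All.map (proj₁ ∘ face-triangle) tri))
            |X|≤′
            (All.map⁺ (All.tabulate λ {t} t∈ →
              All.map (sides⊆D t∈) (proj₂ (face-triangle (All.lookup tri t∈)))))
            (All.map⁺ (All.map (λ {e} → removable {P} {A} as {map edge X} {e}) gone))
            (Any.map⁺ (Any.map (present {P} {A} ps) some))
        where
        T′ = map triangle T
        D′ = concatMap sides T′ ++ map edge D

        face : LTriangle → Triangle n
        face (i , j , k) = sort G (vertex i) (vertex j) (vertex k)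

        Sides : LTriangle → Set
        Sides t = All (λ (i , j) → Known true P i j) (sides t)

        face-triangle : ∀ {t} → Sides t →
          IsTriangle G (face t) × All (_∈± map image (sides t)) (triangleEdges (face t))
        face-triangle (p ∷ q ∷ r ∷ []) =
          sort-triangle G (present {P} {A} ps p) (present {P} {A} ps q) (present {P} {A} ps r)

        |X|≤′ : length (map image (map edge X)) ≤ 2 * length (map face T′)
        |X|≤′ rewrite length-map image (map edge X) | length-map edge X
                    | length-map face T′ | length-map triangle T = |X|≤

        sides⊆D : ∀ {t} → t ∈ T′ → ∀ {e} → e ∈± map image (sides t) → e ∈± map image D′
        sides⊆D {t} t∈ = Sum.map lift lift
          where
          lift : ∀ {e} → e ∈ map image (sides t) → e ∈ map image D′
          lift e∈ with f , f∈ , refl ← ∈-map⁻ image e∈ =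
            ∈-map⁺ image (∈-++⁺ˡ (∈-concatMap⁺ sides {xs = T′} (lose t∈ f∈)))

        ValidSides : LTriangle → Set
        ValidSides t = All (λ (i , j) → Valid i × Valid j) (sides t)

        -- An edge shared in `G` would come from a shared label edge, since distinct valid labels
        -- denote distinct vertices.
        disjoint₂ : ∀ {s t} → Sides s × ValidSides s → (Sides t × ValidSides t) × Apart s t →
                    EdgeDisjoint (face s) (face t)
        disjoint₂ (s , vs) ((t , vt) , ap) (p , q)
          with f , f∈ , f∈± ← ∈±-image⁻ {P} {A} vs vt
            (All.lookup (proj₂ (face-triangle s)) p) (All.lookup (proj₂ (face-triangle t)) q)
          = All.lookup ap f∈ f∈±

        disjoint : ∀ {L} → All (λ t → Sides t × ValidSides t) L → AllPairs Apart L →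
                   AllPairs (λ s t → EdgeDisjoint (face s) (face t)) L
        disjoint []       []         = []
        disjoint (s ∷ ts) (ap ∷ aps) =
          All.map (λ {t} → disjoint₂ {_} {t} s) (All.zip (ts , ap)) ∷ disjoint ts aps


-- Counting vertices by class

⟦_⟧ : Bool → ℕ
⟦ b ⟧ = if b then 1 else 0

# : ∀ {n} → (Fin n → Bool) → ℕ
# f = ∑ (λ x → ⟦ f x ⟧)

∑-zero : ∀ n → ∑ {n} (λ _ → 0) ≡ 0
∑-zero = sum-replicate-zero

∑-mono : ∀ {n} {f g : Fin n → ℕ} → (∀ x → f x ≤ g x) → ∑ f ≤ ∑ g
∑-mono {zero}  _   = z≤n
∑-mono {suc n} f≤g = ℕ.+-mono-≤ (f≤g Fin.zero) (∑-mono (f≤g ∘ Fin.suc))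

∑-single : ∀ {n} (v : Fin n) k → ∑ (λ x → if does (x Fin.≟ v) then k else 0) ≡ k
∑-single {suc n} Fin.zero    k = trans (cong (k +_) (∑-zero n)) (ℕ.+-identityʳ k)
∑-single         (Fin.suc v) k = ∑-single v k

∑-sum : ∀ {n} {A : Set} (h : Fin n → A → ℕ) (xs : List A) →
        ∑ (λ i → sum (map (h i) xs)) ≡ sum (map (λ x → ∑ (λ i → h i x)) xs)
∑-sum {n} h []       = ∑-zero n
∑-sum     h (x ∷ xs) = trans (∑-distrib-+ (λ i → h i x) _) (cong (∑ (λ i → h i x) +_) (∑-sum h xs))

length-filter-tabulate : ∀ {n} {A : Set} {P : Pred A 0ℓ} (P? : Decidable P) (f : Fin n → A) →
                         length (filter P? (tabulate f)) ≡ # (does ∘ P? ∘ f)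
length-filter-tabulate {zero}  P? f = refl
length-filter-tabulate {suc n} P? f with does (P? (f Fin.zero))
... | true  = cong suc (length-filter-tabulate P? (f ∘ Fin.suc))
... | false = length-filter-tabulate P? (f ∘ Fin.suc)

length-filter-allFin : ∀ {n} {P : Pred (Fin n) 0ℓ} (P? : Decidable P) →
                       length (filter P? (allFin n)) ≡ # (does ∘ P?)
length-filter-allFin P? = length-filter-tabulate P? id

#-split : ∀ {n} (f g : Fin n → Bool) → # f ≡ # (λ x → f x ∧ g x) + # (λ x → f x ∧ not (g x))
#-split f g = trans (sum-cong-≗ λ x → cases (f x) (g x)) (∑-distrib-+ (λ x → ⟦ f x ∧ g x ⟧) _)
  where
  cases : ∀ a b → ⟦ a ⟧ ≡ ⟦ a ∧ b ⟧ + ⟦ a ∧ not b ⟧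
  cases false _     = refl
  cases true  false = refl
  cases true  true  = refl

module _ {A : Set} (_≟_ : DecidableEquality A) (h : A → ℕ) {x : A} where

  private
    f : A → ℕ
    f y = if does (x ≟ y) then h y else 0

  sum-absent : ∀ {ys} → x ∉ ys → sum (map f ys) ≡ 0
  sum-absent {[]}     _ = refl
  sum-absent {y ∷ ys} x∉ rewrite dec-false (x ≟ y) (x∉ ∘ here) = sum-absent (x∉ ∘ there)

  sum-present : ∀ {ys} → Unique ys → x ∈ ys → sum (map f ys) ≡ h x
  sum-present {y ∷ ys} (y∉ ∷ _) (here refl) rewrite dec-true (x ≟ x) refl =
    trans (cong (h x +_) (sum-absent λ x∈ → All.lookup y∉ x∈ refl)) (ℕ.+-identityʳ (h x))
  sum-present {y ∷ ys} (y∉ ∷ uniq) (there x∈) rewrite dec-false (x ≟ y) (All.lookup y∉ x∈ ∘ sym) =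
    sum-present uniq x∈

module _ {n : ℕ} where

  open DecMembership (Fin._≟_ {n}) using (_∈?_)

  -- Pigeonhole, in the form that picks one witness after another: `xs` holds those already picked.
  ∃-beyond : (f : Fin n → Bool) (xs : List (Fin n)) → length xs ℕ.< # f →
             ∃[ x ] T (f x) × x ∉ xs
  ∃-beyond f xs xs<f with Any.any? (λ x → ¬? (x ∈? xs)) fs
    where fs = filter (T? ∘ f) (allFin n)
  ... | yes any with x , x∈ , x∉ ← find any = x , proj₂ (∈-filter⁻ (T? ∘ f) {xs = allFin n} x∈) , x∉
  ... | no none = contradiction
        (ℕ.≤-trans (ℕ.≤-reflexive (sym (length-filter-allFin (T? ∘ f))))
          (length-mono-⊆ Fin._≟_ (Unique.filter⁺ (T? ∘ f) (Unique.allFin⁺ n))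
            λ {x} x∈ → decidable-stable (x ∈? xs) λ x∉ → none (lose x∈ x∉)))
        (ℕ.<⇒≱ xs<f)

  #-≤-length : (f : Fin n → Bool) (xs : List (Fin n)) → (∀ {x} → T (f x) → x ∈ xs) → # f ≤ length xs
  #-≤-length f xs sub = ℕ.≮⇒≥ λ xs<f → let (x , fx , x∉) = ∃-beyond f xs xs<f in x∉ (sub fx)

module Count {n : ℕ} (G : Graph n) (s : Fin n) (ss others : List (Fin n))
             (uniq : Unique (s ∷ ss ++ others)) where
  open Graph G
  open Picture G s ss others
  open DecMembership (Fin._≟_ {n}) using (_∈?_)

  private
    r = suc (length ss)

  -- Each vertex is counted through its name or through its class. The condition `g 0 ≡ false` keeps
  -- named vertices, all of class 0, out of the second sum, and it lets the vertices outside the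
  -- picture, whose code is 0, be ignored.
  count : (f : Fin n → Bool) (g : ℕ → Bool) → g 0 ≡ false → (∀ x → f x ≡ g (code x)) →
          # f ≡ sum (map (⟦_⟧ ∘ f) named) +
                sum (map (λ c → if g c then length (part c) else 0) (upTo (2 ^ r)))
  count f g g0 f≡g = begin
    # f
      ≡⟨ sum-cong-≗ pointwise ⟩
    ∑ (λ x → sum (map (named-term x) named) + sum (map (class-term x) (upTo (2 ^ r))))
      ≡⟨ ∑-distrib-+ (λ x → sum (map (named-term x) named)) _ ⟩
    ∑ (λ x → sum (map (named-term x) named)) + ∑ (λ x → sum (map (class-term x) (upTo (2 ^ r))))
      ≡⟨ cong₂ _+_ (∑-sum named-term named) (∑-sum class-term (upTo (2 ^ r))) ⟩
    sum (map (λ v → ∑ (λ x → named-term x v)) named) +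
    sum (map (λ c → ∑ (λ x → class-term x c)) (upTo (2 ^ r)))
      ≡⟨ cong₂ _+_ (cong sum (map-cong (λ v → ∑-single v ⟦ f v ⟧) named))
                   (cong sum (map-cong class-size (upTo (2 ^ r)))) ⟩
    sum (map (⟦_⟧ ∘ f) named) + sum (map (λ c → if g c then length (part c) else 0) (upTo (2 ^ r))) ∎
    where
    named-term : Fin n → Fin n → ℕ
    named-term x v = if does (x Fin.≟ v) then ⟦ f v ⟧ else 0

    class-term : Fin n → ℕ → ℕ
    class-term x c = if does (class x ℕ.≟ c) then ⟦ g c ⟧ else 0

    class-< : ∀ x → class x ℕ.< 2 ^ r
    class-< x with x ∈? named
    ... | yes x∈ = subst (ℕ._< 2 ^ r) (sym (named-class x∈)) (ℕ.m^n>0 2 r)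
    ... | no x∉  = subst (ℕ._< 2 ^ r) (sym (unnamed-class x∉)) (code-< x)

    class-sum : ∀ x → sum (map (class-term x) (upTo (2 ^ r))) ≡ ⟦ g (class x) ⟧
    class-sum x = sum-present ℕ._≟_ (⟦_⟧ ∘ g) (Unique.upTo⁺ (2 ^ r)) (∈-upTo⁺ (class-< x))

    pointwise : ∀ x → ⟦ f x ⟧ ≡ sum (map (named-term x) named) + sum (map (class-term x) (upTo (2 ^ r)))
    pointwise x with x ∈? named
    ... | yes x∈ = sym (trans (cong₂ _+_ (sum-present Fin._≟_ (⟦_⟧ ∘ f) uniq x∈)
                         (trans (class-sum x) (cong ⟦_⟧ (trans (cong g (named-class x∈)) g0))))
                       (ℕ.+-identityʳ _))
    ... | no x∉  = sym (cong₂ _+_ (sum-absent Fin._≟_ (⟦_⟧ ∘ f) x∉)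
                     (trans (class-sum x) (cong ⟦_⟧ (trans (cong g (unnamed-class x∉)) (sym (f≡g x))))))

    if-const : ∀ b → (if b then 0 else 0) ≡ 0
    if-const true  = refl
    if-const false = refl

    class-size : ∀ c → ∑ (λ x → class-term x c) ≡ (if g c then length (part c) else 0)
    class-size zero    rewrite g0 = trans (sum-cong-≗ λ x → if-const (does (class x ℕ.≟ 0))) (∑-zero n)
    class-size (suc c) with g (suc c)
    ... | true  = sym (length-filter-allFin (λ x → class x ℕ.≟ suc c))
    ... | false = trans (sum-cong-≗ λ x → if-const (does (class x ℕ.≟ suc c))) (∑-zero n)


-- Certificates for the reducible configurations

-- The arguments of these functions are the unknown sizes of parts of a picture.  For
-- adjacentTree and nonadjacentTree, these are the numbers of private neighbours of
-- either of two closed vertices and of their common neighbours.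
degreeTree : ℕ → Tree
degreeTree 1 =
  reduce [] [] (10 ∷ [])
degreeTree 2 =
  split 1011
    (reduce [] [] (10 ∷ [])) $
  -- The triangle 0, 10, 11 is packed and only its side 10, 11 is put into `X`. The other two sides
  -- are then in no triangle, vertex 0 having no third neighbour.
  reduce (1011 ∷ []) (1011 ∷ []) []
degreeTree 3 =
  split 1011
    (split 1112
       (reduce [] [] (11 ∷ [])) $
     reduce (1112 ∷ []) (10 ∷ 1112 ∷ []) []) $
  reduce (1011 ∷ []) (12 ∷ 1011 ∷ []) []
degreeTree 4 =
  split 1112
    (split 1012
       (split 1213
          (reduce [] [] (12 ∷ [])) $
        reduce (1213 ∷ []) (13 ∷ 1213 ∷ []) []) $
     split 1113
       (split 1213
          (reduce (1012 ∷ []) (10 ∷ 1012 ∷ []) []) $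
        reduce (1213 ∷ []) (10 ∷ 1213 ∷ []) []) $
     reduce (1012 ∷ 1113 ∷ []) (10 ∷ 12 ∷ 1012 ∷ 1113 ∷ []) []) $
  split 1013
    (split 1012
       (split 1213
          (reduce (1112 ∷ []) (11 ∷ 1112 ∷ []) []) $
        reduce (1213 ∷ []) (11 ∷ 1213 ∷ []) []) $
     split 1113
       (split 1011
          (reduce (1112 ∷ []) (12 ∷ 1112 ∷ []) []) $
        reduce (1011 ∷ []) (12 ∷ 1011 ∷ []) []) $
     reduce (1012 ∷ 1113 ∷ []) (11 ∷ 12 ∷ 1012 ∷ 1113 ∷ []) []) $
  reduce (1013 ∷ 1112 ∷ []) (10 ∷ 13 ∷ 1013 ∷ 1112 ∷ []) []
-- This leaf deletes nothing and fails every check. It merely fills the cases outside the range of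
-- sizes considered.
degreeTree _ = reduce [] [] []

-- Vertex 0 has degree 3 more than the argument, and its neighbour 1 is nonadjacent to its
-- neighbours 2 and 3.
sharedTree : ℕ → Tree
sharedTree 2 =
  split 111
    (split 110
       (reduce [] [] (1 ∷ [])) $
     reduce (110 ∷ []) (10 ∷ 110 ∷ []) []) $
  split 203
    (split 210
       (split 211
          (reduce [] [] (2 ∷ [])) $
        reduce (211 ∷ []) (11 ∷ 211 ∷ []) []) $
     reduce (111 ∷ 210 ∷ []) (10 ∷ 11 ∷ 111 ∷ 210 ∷ []) []) $
  reduce (111 ∷ 203 ∷ []) (10 ∷ 11 ∷ 111 ∷ 203 ∷ []) []
sharedTree 3 =
  split 112
    (split 110
       (split 111
          (reduce [] [] (1 ∷ [])) $
        reduce (111 ∷ []) (11 ∷ 111 ∷ []) []) $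
     split 203
       (split 312
          (split 311
             (split 310
                (reduce [] [] (3 ∷ [])) $
              reduce (310 ∷ []) (10 ∷ 310 ∷ []) []) $
           reduce (110 ∷ 311 ∷ []) (10 ∷ 11 ∷ 110 ∷ 311 ∷ []) []) $
        split 211
          (split 212
             (reduce (110 ∷ 312 ∷ []) (10 ∷ 11 ∷ 110 ∷ 312 ∷ []) []) $
           split 311
             (split 111
                (reduce (110 ∷ []) (10 ∷ 110 ∷ []) []) $
              reduce (111 ∷ 212 ∷ []) (10 ∷ 12 ∷ 111 ∷ 212 ∷ []) []) $
           reduce (110 ∷ 212 ∷ 311 ∷ []) (3 ∷ 10 ∷ 11 ∷ 110 ∷ 212 ∷ 311 ∷ []) []) $
        reduce (110 ∷ 211 ∷ 312 ∷ []) (2 ∷ 10 ∷ 11 ∷ 110 ∷ 211 ∷ 312 ∷ []) []) $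
     split 1112
       (split 111
          (reduce (110 ∷ []) (10 ∷ 110 ∷ []) []) $
        split 1012
          (split 310
             (split 312
                (reduce (110 ∷ 203 ∷ []) (2 ∷ 11 ∷ 110 ∷ 203 ∷ []) []) $
              reduce (110 ∷ 312 ∷ []) (2 ∷ 11 ∷ 110 ∷ 312 ∷ []) []) $
           split 212
             (split 312
                (reduce (110 ∷ 203 ∷ []) (10 ∷ 11 ∷ 110 ∷ 203 ∷ []) []) $
              reduce (312 ∷ []) (3 ∷ 312 ∷ []) []) $
           reduce (111 ∷ 212 ∷ 310 ∷ []) (2 ∷ 3 ∷ 10 ∷ 111 ∷ 212 ∷ 310 ∷ []) []) $
        reduce (111 ∷ 203 ∷ 1012 ∷ []) (2 ∷ 3 ∷ 10 ∷ 111 ∷ 203 ∷ 1012 ∷ []) []) $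
     reduce (110 ∷ 203 ∷ 1112 ∷ []) (10 ∷ 11 ∷ 12 ∷ 110 ∷ 203 ∷ 1112 ∷ []) []) $
  split 203
    (split 211
       (split 311
          (split 212
             (split 210
                (reduce [] [] (2 ∷ [])) $
              reduce (210 ∷ []) (10 ∷ 210 ∷ []) []) $
           split 310
             (split 111
                (split 312
                   (reduce [] [] (3 ∷ [])) $
                 reduce (312 ∷ []) (12 ∷ 312 ∷ []) []) $
              reduce (111 ∷ 212 ∷ []) (10 ∷ 12 ∷ 111 ∷ 212 ∷ []) []) $
           reduce (212 ∷ 310 ∷ []) (10 ∷ 12 ∷ 212 ∷ 310 ∷ []) []) $
        split 210
          (split 212
             (reduce [] [] (2 ∷ [])) $
           split 110
             (reduce (212 ∷ []) (12 ∷ 212 ∷ []) []) $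
           reduce (110 ∷ 212 ∷ 311 ∷ []) (1 ∷ 10 ∷ 12 ∷ 110 ∷ 212 ∷ 311 ∷ []) []) $
        reduce (112 ∷ 210 ∷ 311 ∷ []) (1 ∷ 10 ∷ 12 ∷ 112 ∷ 210 ∷ 311 ∷ []) []) $
     split 310
       (split 110
          (split 210
             (reduce (112 ∷ 211 ∷ []) (11 ∷ 12 ∷ 112 ∷ 211 ∷ []) []) $
           reduce (112 ∷ 210 ∷ []) (11 ∷ 12 ∷ 112 ∷ 210 ∷ []) []) $
        split 312
          (split 210
             (reduce (110 ∷ 211 ∷ []) (11 ∷ 12 ∷ 110 ∷ 211 ∷ []) []) $
           split 311
             (reduce [] [] (3 ∷ [])) $
           reduce (112 ∷ 210 ∷ 311 ∷ []) (2 ∷ 10 ∷ 11 ∷ 112 ∷ 210 ∷ 311 ∷ []) []) $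
        reduce (110 ∷ 211 ∷ 312 ∷ []) (2 ∷ 11 ∷ 12 ∷ 110 ∷ 211 ∷ 312 ∷ []) []) $
     reduce (112 ∷ 211 ∷ 310 ∷ []) (10 ∷ 11 ∷ 12 ∷ 112 ∷ 211 ∷ 310 ∷ []) []) $
  split 1011
    (split 110
       (split 111
          (reduce (112 ∷ []) (12 ∷ 112 ∷ []) []) $
        split 1012
          (split 311
             (split 310
                (reduce (111 ∷ 203 ∷ []) (2 ∷ 12 ∷ 111 ∷ 203 ∷ []) []) $
              reduce (111 ∷ 310 ∷ []) (2 ∷ 12 ∷ 111 ∷ 310 ∷ []) []) $
           split 210
             (split 310
                (reduce (112 ∷ 203 ∷ []) (11 ∷ 12 ∷ 112 ∷ 203 ∷ []) []) $
              reduce (310 ∷ []) (3 ∷ 310 ∷ []) []) $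
           reduce (112 ∷ 210 ∷ 311 ∷ []) (2 ∷ 3 ∷ 11 ∷ 112 ∷ 210 ∷ 311 ∷ []) []) $
        reduce (111 ∷ 203 ∷ 1012 ∷ []) (2 ∷ 3 ∷ 12 ∷ 111 ∷ 203 ∷ 1012 ∷ []) []) $
     split 1112
       (split 111
          (split 311
             (split 310
                (reduce (110 ∷ 203 ∷ []) (2 ∷ 12 ∷ 110 ∷ 203 ∷ []) []) $
              split 211
                (reduce (110 ∷ 203 ∷ []) (10 ∷ 12 ∷ 110 ∷ 203 ∷ []) []) $
              reduce (112 ∷ 211 ∷ 310 ∷ []) (2 ∷ 3 ∷ 10 ∷ 112 ∷ 211 ∷ 310 ∷ []) []) $
           split 210
             (split 312
                (reduce (112 ∷ 311 ∷ []) (2 ∷ 10 ∷ 112 ∷ 311 ∷ []) []) $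
              reduce (110 ∷ 312 ∷ []) (3 ∷ 12 ∷ 110 ∷ 312 ∷ []) []) $
           reduce (112 ∷ 210 ∷ 311 ∷ []) (2 ∷ 3 ∷ 10 ∷ 112 ∷ 210 ∷ 311 ∷ []) []) $
        split 1012
          (split 212
             (split 210
                (split 312
                   (reduce (112 ∷ []) (1 ∷ 112 ∷ []) []) $
                 reduce (110 ∷ 312 ∷ []) (1 ∷ 3 ∷ 110 ∷ 312 ∷ []) []) $
              split 312
                (reduce (112 ∷ []) (1 ∷ 112 ∷ []) []) $
              reduce (111 ∷ 210 ∷ 312 ∷ []) (1 ∷ 2 ∷ 3 ∷ 111 ∷ 210 ∷ 312 ∷ []) []) $
           split 310
             (split 311
                (split 312
                   (reduce (203 ∷ []) (2 ∷ 203 ∷ []) []) $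
                 reduce (111 ∷ 312 ∷ []) (1 ∷ 2 ∷ 111 ∷ 312 ∷ []) []) $
              reduce (110 ∷ 212 ∷ 311 ∷ []) (1 ∷ 2 ∷ 3 ∷ 110 ∷ 212 ∷ 311 ∷ []) []) $
           reduce (111 ∷ 212 ∷ 310 ∷ []) (1 ∷ 2 ∷ 3 ∷ 111 ∷ 212 ∷ 310 ∷ []) []) $
        reduce (111 ∷ 203 ∷ 1012 ∷ []) (1 ∷ 2 ∷ 3 ∷ 111 ∷ 203 ∷ 1012 ∷ []) []) $
     reduce (110 ∷ 203 ∷ 1112 ∷ []) (10 ∷ 11 ∷ 12 ∷ 110 ∷ 203 ∷ 1112 ∷ []) []) $
  reduce (112 ∷ 203 ∷ 1011 ∷ []) (10 ∷ 11 ∷ 12 ∷ 112 ∷ 203 ∷ 1011 ∷ []) []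
sharedTree _ = reduce [] [] []

-- Vertex 0 has degree 5, and its neighbours 1, 2 and 3, 4 are the nonadjacent pairs. The matching
-- forces a wheel on the neighbours, with hub 10 and rim 1, 3, 2, 4. Deleting its eight edges leaves
-- vertex 0 in no triangle, while four edge-disjoint triangles are packed.
disjointTree : Tree
disjointTree  =
  forced 410 0 3 $
  forced 103 0 2 $
  forced 104 0 2 $
  forced 210 0 1 $
  forced 310 0 4 $
  forced 203 0 1 $
  forced 110 0 2 $
  forced 204 0 1 $
  reduce (104 ∷ 203 ∷ 10310 ∷ 20410 ∷ []) (103 ∷ 104 ∷ 110 ∷ 203 ∷ 204 ∷ 210 ∷ 310 ∷ 410 ∷ [])
    []

adjacentTree : ℕ → ℕ → ℕ → Tree
adjacentTree 1 1 3 =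
  forced 1031 0 1 $
  split 2030
    (split 3132
       (forced 3130 0 32 $
        reduce (132 ∷ 1031 ∷ 13031 ∷ []) (1 ∷ 10 ∷ 120 ∷ 1031 ∷ 3031 ∷ 3032 ∷ []) []) $
     reduce (130 ∷ 1031 ∷ 13132 ∷ []) (10 ∷ 30 ∷ 131 ∷ 132 ∷ 1031 ∷ 3132 ∷ []) []) $
  reduce (132 ∷ 1031 ∷ 12030 ∷ []) (30 ∷ 32 ∷ 131 ∷ 132 ∷ 1031 ∷ 2030 ∷ []) []
adjacentTree 1 2 3 =
  split 2021
    (split 2132
       (forced 1031 0 1 $
        split 2032
          (split 3132
             (forced 3130 0 32 $
              reduce (132 ∷ 1031 ∷ 13031 ∷ []) (10 ∷ 32 ∷ 130 ∷ 131 ∷ 1031 ∷ 3031 ∷ []) []) $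
           reduce (130 ∷ 1031 ∷ 13132 ∷ []) (30 ∷ 32 ∷ 130 ∷ 131 ∷ 1031 ∷ 3132 ∷ []) []) $
        reduce (130 ∷ 1031 ∷ 12032 ∷ []) (30 ∷ 32 ∷ 130 ∷ 131 ∷ 1031 ∷ 2032 ∷ []) []) $
     split 2030
       (forced 1031 0 1 $
        split 2130
          (reduce (130 ∷ 12132 ∷ []) (30 ∷ 131 ∷ 132 ∷ 2132 ∷ []) []) $
        reduce (132 ∷ 1031 ∷ 12130 ∷ []) (30 ∷ 32 ∷ 131 ∷ 132 ∷ 1031 ∷ 2130 ∷ []) []) $
     reduce (131 ∷ 12030 ∷ 12132 ∷ []) (31 ∷ 130 ∷ 131 ∷ 132 ∷ 2030 ∷ 2132 ∷ []) []) $
  split 3031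
    (forced 3032 0 31 $
     reduce (131 ∷ 12021 ∷ 13032 ∷ []) (31 ∷ 130 ∷ 131 ∷ 132 ∷ 2021 ∷ 3032 ∷ []) []) $
  reduce (132 ∷ 12021 ∷ 13031 ∷ []) (32 ∷ 130 ∷ 131 ∷ 132 ∷ 2021 ∷ 3031 ∷ []) []
adjacentTree 0 0 4 =
  split 3033
    (forced 3331 0 30 $
     forced 3031 0 33 $
     reduce (132 ∷ 3031 ∷ 13133 ∷ []) (1 ∷ 32 ∷ 132 ∷ 3031 ∷ 3133 ∷ []) []) $
  split 3032
    (forced 3031 0 32 $
     reduce (132 ∷ 3033 ∷ 13031 ∷ []) (1 ∷ 31 ∷ 131 ∷ 3031 ∷ 3033 ∷ 3233 ∷ []) []) $
  reduce (131 ∷ 3032 ∷ 13033 ∷ []) (1 ∷ 31 ∷ 131 ∷ 3032 ∷ 3033 ∷ 3233 ∷ []) []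
adjacentTree 0 1 4 =
  split 3031
    (forced 3033 0 31 $
     forced 3133 0 30 $
     reduce (132 ∷ 3033 ∷ 13133 ∷ []) (1 ∷ 32 ∷ 120 ∷ 132 ∷ 3033 ∷ 3133 ∷ []) []) $
  split 3033
    (forced 3331 0 30 $
     reduce (132 ∷ 3133 ∷ 13031 ∷ []) (1 ∷ 32 ∷ 120 ∷ 132 ∷ 3031 ∷ 3133 ∷ []) []) $
  split 2031
    (split 2032
       (split 3132
          (reduce (132 ∷ 3033 ∷ 13031 ∷ []) (31 ∷ 32 ∷ 130 ∷ 133 ∷ 3031 ∷ 3033 ∷ []) []) $
        reduce (133 ∷ 3031 ∷ 13132 ∷ []) (1 ∷ 33 ∷ 133 ∷ 3031 ∷ 3032 ∷ 3132 ∷ []) []) $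
     reduce (131 ∷ 12032 ∷ 13033 ∷ []) (31 ∷ 130 ∷ 132 ∷ 133 ∷ 2032 ∷ 3033 ∷ []) []) $
  reduce (132 ∷ 3031 ∷ 12031 ∷ 13033 ∷ []) (1 ∷ 32 ∷ 120 ∷ 132 ∷ 2031 ∷ 3031 ∷ 3033 ∷ 3133 ∷ [])
    []
adjacentTree 0 2 4 =
  split 3233
    (forced 3331 0 32 $
     split 2033
       (split 2133
          (forced 3231 0 33 $
           reduce (130 ∷ 3132 ∷ 13133 ∷ []) (1 ∷ 30 ∷ 130 ∷ 131 ∷ 3132 ∷ 3133 ∷ []) []) $
        forced 3231 0 33 $
        reduce (130 ∷ 3133 ∷ 12133 ∷ 13132 ∷ []) (1 ∷ 30 ∷ 120 ∷ 121 ∷ 130 ∷ 2133 ∷ 3132 ∷ 3133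
          ∷ []) []) $
     forced 3231 0 33 $
     reduce (130 ∷ 3133 ∷ 12033 ∷ 13132 ∷ []) (1 ∷ 30 ∷ 120 ∷ 121 ∷ 130 ∷ 2033 ∷ 3132 ∷ 3133 ∷
       []) []) $
  split 3031
    (forced 3032 0 31 $
     split 2021
       (forced 3133 0 30 $
        forced 3033 0 31 $
        split 2130
          (forced 3132 0 30 $
           reduce (130 ∷ 3132 ∷ 13133 ∷ 303233 ∷ []) (1 ∷ 120 ∷ 121 ∷ 3032 ∷ 3033 ∷ 3132 ∷ 3133
             ∷ 3233 ∷ []) []) $
        reduce (132 ∷ 3033 ∷ 12130 ∷ 13133 ∷ []) (1 ∷ 32 ∷ 120 ∷ 121 ∷ 132 ∷ 2130 ∷ 3033 ∷ 3133
          ∷ []) []) $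
     forced 3132 0 30 $
     reduce (133 ∷ 3032 ∷ 12021 ∷ 13132 ∷ []) (1 ∷ 33 ∷ 120 ∷ 121 ∷ 133 ∷ 2021 ∷ 3032 ∷ 3132 ∷
       []) []) $
  split 3033
    (split 2133
       (forced 3331 0 30 $
        forced 3032 0 33 $
        reduce (3032 ∷ 3133 ∷ 13031 ∷ 13233 ∷ []) (1 ∷ 120 ∷ 121 ∷ 3031 ∷ 3032 ∷ 3132 ∷ 3133 ∷
          3233 ∷ []) []) $
     forced 3331 0 30 $
     reduce (132 ∷ 3133 ∷ 12133 ∷ 13031 ∷ []) (1 ∷ 32 ∷ 120 ∷ 121 ∷ 132 ∷ 2133 ∷ 3031 ∷ 3133 ∷
       []) []) $
  split 3032
    (split 2021
       (forced 3231 0 30 $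
        reduce (3033 ∷ 3132 ∷ 13031 ∷ 13233 ∷ []) (1 ∷ 120 ∷ 121 ∷ 3031 ∷ 3033 ∷ 3132 ∷ 3133 ∷
          3233 ∷ []) []) $
     reduce (131 ∷ 3233 ∷ 12021 ∷ 13033 ∷ []) (1 ∷ 31 ∷ 120 ∷ 121 ∷ 131 ∷ 2021 ∷ 3033 ∷ 3233 ∷
       []) []) $
  split 3132
    (forced 3133 0 32 $
     reduce (131 ∷ 3233 ∷ 13032 ∷ 303133 ∷ []) (1 ∷ 120 ∷ 121 ∷ 3031 ∷ 3032 ∷ 3033 ∷ 3133 ∷ 3233
       ∷ []) []) $
  split 2032
    (split 2021
       (split 2130
          (split 2132
             (split 2133
                (split 2131
                   (reduce (131 ∷ 3233 ∷ 13033 ∷ 303132 ∷ []) (1 ∷ 120 ∷ 3031 ∷ 3032 ∷ 3033 ∷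
                      3132 ∷ 3133 ∷ 3233 ∷ []) []) $
                 reduce (3031 ∷ 3233 ∷ 12131 ∷ 13032 ∷ []) (32 ∷ 33 ∷ 130 ∷ 131 ∷ 2131 ∷ 3031 ∷
                   3032 ∷ 3233 ∷ []) []) $
              reduce (131 ∷ 3233 ∷ 12133 ∷ 13032 ∷ []) (1 ∷ 31 ∷ 120 ∷ 131 ∷ 2133 ∷ 3032 ∷ 3033
                ∷ 3233 ∷ []) []) $
           reduce (131 ∷ 3032 ∷ 12132 ∷ 13033 ∷ []) (31 ∷ 32 ∷ 130 ∷ 131 ∷ 133 ∷ 2132 ∷ 3032 ∷
             3033 ∷ []) []) $
        reduce (131 ∷ 3033 ∷ 12130 ∷ 13233 ∷ 303132 ∷ []) (1 ∷ 120 ∷ 121 ∷ 2130 ∷ 3031 ∷ 3032 ∷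
          3033 ∷ 3132 ∷ 3133 ∷ 3233 ∷ []) []) $
     reduce (133 ∷ 3132 ∷ 12021 ∷ 13031 ∷ 303233 ∷ []) (1 ∷ 120 ∷ 121 ∷ 2021 ∷ 3031 ∷ 3032 ∷
       3033 ∷ 3132 ∷ 3133 ∷ 3233 ∷ []) []) $
  reduce (131 ∷ 3233 ∷ 12032 ∷ 13033 ∷ 303132 ∷ []) (1 ∷ 120 ∷ 121 ∷ 2032 ∷ 3031 ∷ 3032 ∷ 3033 ∷
    3132 ∷ 3133 ∷ 3233 ∷ []) []
adjacentTree 1 0 4 =
  forced 1030 0 1 $
  split 3133
    (forced 3332 0 31 $
     forced 3132 0 33 $
     reduce (130 ∷ 3132 ∷ 13233 ∷ []) (1 ∷ 10 ∷ 30 ∷ 130 ∷ 3132 ∷ 3233 ∷ []) []) $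
  split 3031
    (forced 3033 0 31 $
     reduce (132 ∷ 1030 ∷ 3133 ∷ 13033 ∷ []) (1 ∷ 10 ∷ 32 ∷ 132 ∷ 1030 ∷ 3033 ∷ 3133 ∷ []) []) $
  reduce (132 ∷ 1030 ∷ 3133 ∷ 13031 ∷ []) (1 ∷ 10 ∷ 32 ∷ 132 ∷ 1030 ∷ 3031 ∷ 3033 ∷ 3133 ∷ [])
    []
adjacentTree 1 1 4 =
  forced 1031 0 1 $
  split 3132
    (forced 3230 0 31 $
     forced 3130 0 32 $
     reduce (133 ∷ 1031 ∷ 3032 ∷ 13031 ∷ []) (1 ∷ 10 ∷ 33 ∷ 120 ∷ 133 ∷ 1031 ∷ 3031 ∷ 3032 ∷ [])
       []) $
  split 3032
    (forced 3031 0 32 $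
     forced 1032 0 1 $
     reduce (133 ∷ 1032 ∷ 3031 ∷ 13132 ∷ []) (1 ∷ 10 ∷ 33 ∷ 120 ∷ 133 ∷ 1032 ∷ 3031 ∷ 3132 ∷ [])
       []) $
  split 2030
    (split 2032
       (reduce (133 ∷ 1031 ∷ 3032 ∷ 13132 ∷ []) (30 ∷ 32 ∷ 33 ∷ 131 ∷ 133 ∷ 1031 ∷ 3032 ∷ 3132 ∷
          []) []) $
     reduce (133 ∷ 1031 ∷ 3032 ∷ 12032 ∷ []) (30 ∷ 32 ∷ 33 ∷ 131 ∷ 133 ∷ 1031 ∷ 2032 ∷ 3032 ∷
       []) []) $
  reduce (133 ∷ 1031 ∷ 3032 ∷ 12030 ∷ 13132 ∷ []) (10 ∷ 30 ∷ 33 ∷ 131 ∷ 132 ∷ 133 ∷ 1031 ∷ 2030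
    ∷ 3032 ∷ 3132 ∷ []) []
adjacentTree 1 2 4 =
  split 3032
    (split 2130
       (forced 3033 0 32 $
        forced 1030 0 1 $
        forced 3233 0 30 $
        split 2132
          (split 2131
             (forced 3031 0 32 $
              forced 3231 0 30 $
              reduce (133 ∷ 1030 ∷ 3132 ∷ 13031 ∷ []) (1 ∷ 10 ∷ 33 ∷ 120 ∷ 133 ∷ 1030 ∷ 3031 ∷
                3132 ∷ []) []) $
           forced 1033 0 1 $
           forced 3231 0 30 $
           reduce (130 ∷ 1033 ∷ 3132 ∷ 12131 ∷ 13233 ∷ []) (1 ∷ 10 ∷ 33 ∷ 120 ∷ 133 ∷ 1033 ∷
             2131 ∷ 3031 ∷ 3132 ∷ 3233 ∷ []) []) $
        reduce (131 ∷ 1030 ∷ 3233 ∷ 12132 ∷ 13033 ∷ []) (1 ∷ 10 ∷ 31 ∷ 120 ∷ 121 ∷ 131 ∷ 1030 ∷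
          2132 ∷ 3033 ∷ 3233 ∷ []) []) $
     forced 1032 0 1 $
     forced 3031 0 32 $
     forced 3231 0 30 $
     reduce (133 ∷ 1032 ∷ 3031 ∷ 12130 ∷ 13132 ∷ []) (1 ∷ 10 ∷ 33 ∷ 120 ∷ 121 ∷ 133 ∷ 1032 ∷
       2130 ∷ 3031 ∷ 3132 ∷ []) []) $
  split 3033
    (forced 3331 0 30 $
     forced 3031 0 33 $
     forced 1033 0 1 $
     split 2130
       (split 2021
          (split 2030
             (forced 1030 0 1 $
              reduce (132 ∷ 1030 ∷ 3133 ∷ 13031 ∷ []) (1 ∷ 10 ∷ 32 ∷ 131 ∷ 132 ∷ 1030 ∷ 3031 ∷
                3133 ∷ []) []) $
           reduce (132 ∷ 1033 ∷ 3031 ∷ 12030 ∷ 13133 ∷ []) (1 ∷ 10 ∷ 32 ∷ 120 ∷ 121 ∷ 132 ∷ 1033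
             ∷ 2030 ∷ 3031 ∷ 3133 ∷ []) []) $
        reduce (132 ∷ 1033 ∷ 3031 ∷ 12021 ∷ 13133 ∷ []) (1 ∷ 10 ∷ 32 ∷ 120 ∷ 121 ∷ 132 ∷ 1033 ∷
          2021 ∷ 3031 ∷ 3133 ∷ []) []) $
     reduce (132 ∷ 1033 ∷ 3031 ∷ 12130 ∷ 13133 ∷ []) (1 ∷ 10 ∷ 32 ∷ 120 ∷ 121 ∷ 132 ∷ 1033 ∷
       2130 ∷ 3031 ∷ 3133 ∷ []) []) $
  split 2032
    (split 2030
       (forced 1032 0 1 $
        split 2033
          (split 2021
             (forced 1031 0 1 $
              split 2031
                (reduce [] [] (120 ∷ [])) $
              reduce (133 ∷ 1031 ∷ 3032 ∷ 12031 ∷ []) (30 ∷ 32 ∷ 33 ∷ 131 ∷ 133 ∷ 1031 ∷ 2031 ∷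
                3032 ∷ []) []) $
           forced 1033 0 1 $
           reduce (131 ∷ 1033 ∷ 3032 ∷ 12021 ∷ 13033 ∷ []) (30 ∷ 31 ∷ 32 ∷ 121 ∷ 131 ∷ 133 ∷
             1033 ∷ 2021 ∷ 3032 ∷ 3033 ∷ []) []) $
        reduce (131 ∷ 1032 ∷ 3033 ∷ 12033 ∷ 13032 ∷ []) (30 ∷ 31 ∷ 33 ∷ 121 ∷ 131 ∷ 132 ∷ 1032 ∷
          2033 ∷ 3032 ∷ 3033 ∷ []) []) $
     forced 1031 0 1 $
     split 2131
       (split 2133
          (split 3132
             (forced 3133 0 32 $
              forced 3233 0 31 $
              reduce (130 ∷ 1031 ∷ 3233 ∷ 13133 ∷ []) (1 ∷ 10 ∷ 30 ∷ 120 ∷ 130 ∷ 1031 ∷ 3133 ∷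
                3233 ∷ []) []) $
           reduce (133 ∷ 1031 ∷ 3032 ∷ 12030 ∷ 13132 ∷ []) (30 ∷ 32 ∷ 33 ∷ 121 ∷ 131 ∷ 133 ∷
             1031 ∷ 2030 ∷ 3032 ∷ 3132 ∷ []) []) $
        forced 1033 0 1 $
        reduce (131 ∷ 1033 ∷ 3032 ∷ 12030 ∷ 12133 ∷ []) (30 ∷ 31 ∷ 32 ∷ 121 ∷ 131 ∷ 133 ∷ 1033 ∷
          2030 ∷ 2133 ∷ 3032 ∷ []) []) $
     reduce (133 ∷ 1031 ∷ 3032 ∷ 12030 ∷ 12131 ∷ []) (30 ∷ 32 ∷ 33 ∷ 121 ∷ 131 ∷ 133 ∷ 1031 ∷
       2030 ∷ 2131 ∷ 3032 ∷ []) []) $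
  forced 1030 0 1 $
  split 3132
    (forced 1031 0 1 $
     forced 3130 0 32 $
     reduce (133 ∷ 1031 ∷ 3032 ∷ 12032 ∷ 13031 ∷ []) (1 ∷ 10 ∷ 33 ∷ 120 ∷ 121 ∷ 133 ∷ 1031 ∷
       2032 ∷ 3031 ∷ 3032 ∷ []) []) $
  split 3031
    (split 2030
       (forced 1033 0 1 $
        reduce (131 ∷ 1033 ∷ 3032 ∷ 12032 ∷ 13033 ∷ []) (30 ∷ 31 ∷ 32 ∷ 121 ∷ 131 ∷ 133 ∷ 1033 ∷
          2032 ∷ 3032 ∷ 3033 ∷ []) []) $
     forced 1031 0 1 $
     reduce (133 ∷ 1031 ∷ 3032 ∷ 12030 ∷ 13132 ∷ []) (1 ∷ 10 ∷ 33 ∷ 120 ∷ 121 ∷ 133 ∷ 1031 ∷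
       2030 ∷ 3032 ∷ 3132 ∷ []) []) $
  split 3233
    (forced 1033 0 1 $
     reduce (131 ∷ 1033 ∷ 3032 ∷ 12032 ∷ 13033 ∷ []) (1 ∷ 10 ∷ 31 ∷ 120 ∷ 121 ∷ 131 ∷ 1033 ∷
       2032 ∷ 3032 ∷ 3033 ∷ []) []) $
  reduce (133 ∷ 1030 ∷ 3132 ∷ 12032 ∷ 13031 ∷ 303233 ∷ []) (1 ∷ 10 ∷ 120 ∷ 121 ∷ 1030 ∷ 2032 ∷
    3031 ∷ 3032 ∷ 3033 ∷ 3132 ∷ 3133 ∷ 3233 ∷ []) []
adjacentTree 0 0 5 =
  split 3034
    (forced 3432 0 30 $
     forced 3032 0 34 $
     forced 3431 0 30 $
     reduce (133 ∷ 3032 ∷ 3134 ∷ 13234 ∷ []) (1 ∷ 31 ∷ 33 ∷ 131 ∷ 133 ∷ 3032 ∷ 3134 ∷ 3234 ∷ [])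
       []) $
  split 3032
    (forced 3033 0 32 $
     forced 3234 0 30 $
     reduce (131 ∷ 3034 ∷ 13033 ∷ 13234 ∷ []) (1 ∷ 31 ∷ 33 ∷ 131 ∷ 133 ∷ 3033 ∷ 3034 ∷ 3234 ∷
       []) []) $
  split 3334
    (forced 3332 0 34 $
     reduce (131 ∷ 3034 ∷ 3233 ∷ 13032 ∷ []) (1 ∷ 31 ∷ 131 ∷ 3032 ∷ 3033 ∷ 3034 ∷ 3233 ∷ 3234 ∷
       []) []) $
  split 3233
    (reduce (131 ∷ 3034 ∷ 13032 ∷ 13334 ∷ []) (1 ∷ 31 ∷ 131 ∷ 3032 ∷ 3033 ∷ 3034 ∷ 3234 ∷ 3334 ∷
       []) []) $
  reduce (131 ∷ 3034 ∷ 3233 ∷ 13032 ∷ 13334 ∷ []) (1 ∷ 31 ∷ 131 ∷ 3032 ∷ 3033 ∷ 3034 ∷ 3233 ∷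
    3234 ∷ 3334 ∷ []) []
adjacentTree 0 1 5 =
  split 3134
    (forced 3130 0 34 $
     forced 3432 0 31 $
     forced 3430 0 31 $
     forced 3132 0 34 $
     reduce (133 ∷ 3031 ∷ 3234 ∷ 13034 ∷ 13132 ∷ []) (1 ∷ 33 ∷ 120 ∷ 133 ∷ 3031 ∷ 3032 ∷ 3034 ∷
       3132 ∷ 3234 ∷ []) []) $
  split 3334
    (forced 3430 0 33 $
     forced 3330 0 34 $
     forced 3331 0 34 $
     reduce (132 ∷ 3034 ∷ 3133 ∷ 13033 ∷ 13134 ∷ []) (1 ∷ 32 ∷ 120 ∷ 132 ∷ 3031 ∷ 3033 ∷ 3034 ∷
       3133 ∷ 3134 ∷ []) []) $
  split 3031
    (forced 3034 0 31 $
     forced 3132 0 30 $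
     forced 3032 0 31 $
     reduce (133 ∷ 3034 ∷ 3132 ∷ 13032 ∷ 13134 ∷ []) (1 ∷ 33 ∷ 120 ∷ 133 ∷ 3032 ∷ 3034 ∷ 3132 ∷
       3134 ∷ 3234 ∷ []) []) $
  split 3033
    (forced 3032 0 33 $
     forced 3332 0 30 $
     forced 3331 0 30 $
     reduce (134 ∷ 3032 ∷ 3133 ∷ 13031 ∷ 13233 ∷ []) (1 ∷ 34 ∷ 120 ∷ 134 ∷ 3031 ∷ 3032 ∷ 3132 ∷
       3133 ∷ 3233 ∷ []) []) $
  reduce (132 ∷ 3033 ∷ 3134 ∷ 13031 ∷ 13334 ∷ []) (1 ∷ 32 ∷ 120 ∷ 132 ∷ 3031 ∷ 3033 ∷ 3034 ∷
    3133 ∷ 3134 ∷ 3334 ∷ []) []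
adjacentTree _ _ _ = reduce [] [] []

nonadjacentTree : ℕ → ℕ → ℕ → Tree
nonadjacentTree 1 1 4 =
  split 3033
    (forced 3331 0 30 $
     forced 3332 0 30 $
     forced 3031 0 33 $
     forced 3032 0 33 $
     reduce (3032 ∷ 3133 ∷ 13031 ∷ 13233 ∷ []) (10 ∷ 120 ∷ 3031 ∷ 3032 ∷ 3132 ∷ 3133 ∷ 3233 ∷
       []) []) $
  split 3032
    (forced 3031 0 32 $
     forced 3231 0 30 $
     forced 3233 0 30 $
     reduce (3033 ∷ 3132 ∷ 13031 ∷ 13233 ∷ []) (10 ∷ 120 ∷ 3031 ∷ 3033 ∷ 3132 ∷ 3133 ∷ 3233 ∷
       []) []) $
  split 3133
    (forced 3132 0 33 $
     forced 3120 1 33 $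
     reduce (3033 ∷ 3132 ∷ 12031 ∷ 13032 ∷ []) (10 ∷ 120 ∷ 2031 ∷ 3031 ∷ 3032 ∷ 3033 ∷ 3132 ∷
       3233 ∷ []) []) $
  split 3132
    (forced 3120 1 32 $
     reduce (3032 ∷ 3133 ∷ 12031 ∷ 13033 ∷ []) (10 ∷ 120 ∷ 2031 ∷ 3031 ∷ 3032 ∷ 3033 ∷ 3133 ∷
       3233 ∷ []) []) $
  reduce (3032 ∷ 3133 ∷ 13033 ∷ 13132 ∷ []) (10 ∷ 120 ∷ 3031 ∷ 3032 ∷ 3033 ∷ 3132 ∷ 3133 ∷ 3233
    ∷ []) []
nonadjacentTree 1 2 4 =
  split 3032
    (forced 3233 0 30 $
     forced 3231 0 30 $
     forced 3031 0 32 $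
     forced 3033 0 32 $
     reduce (3031 ∷ 3233 ∷ 13033 ∷ 13132 ∷ []) (10 ∷ 120 ∷ 121 ∷ 3031 ∷ 3033 ∷ 3132 ∷ 3133 ∷
       3233 ∷ []) []) $
  split 3031
    (forced 3133 0 30 $
     forced 3132 0 30 $
     forced 3033 0 31 $
     reduce (3033 ∷ 3132 ∷ 13032 ∷ 13133 ∷ []) (10 ∷ 120 ∷ 121 ∷ 3032 ∷ 3033 ∷ 3132 ∷ 3133 ∷
       3233 ∷ []) []) $
  split 3133
    (forced 3332 0 31 $
     forced 3321 1 31 $
     forced 3120 1 33 $
     reduce (3031 ∷ 3233 ∷ 12031 ∷ 12133 ∷ 13032 ∷ []) (10 ∷ 120 ∷ 121 ∷ 2031 ∷ 2133 ∷ 3031 ∷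
       3032 ∷ 3033 ∷ 3132 ∷ 3233 ∷ []) []) $
  split 2021
    (split 3233
       (forced 2033 1 21 $
        forced 2132 1 20 $
        reduce (3032 ∷ 3133 ∷ 12033 ∷ 12132 ∷ 13031 ∷ []) (10 ∷ 120 ∷ 121 ∷ 2033 ∷ 2132 ∷ 3031 ∷
          3032 ∷ 3033 ∷ 3132 ∷ 3133 ∷ []) []) $
     forced 2130 1 20 $
     forced 2031 1 21 $
     split 1032
       (split 3033
          (reduce (3032 ∷ 3133 ∷ 13031 ∷ 13233 ∷ []) (10 ∷ 120 ∷ 121 ∷ 3031 ∷ 3032 ∷ 3132 ∷ 3133
             ∷ 3233 ∷ []) []) $
        forced 1031 0 32 $
        reduce (1031 ∷ 3032 ∷ 12031 ∷ 12130 ∷ 13233 ∷ 303133 ∷ []) (10 ∷ 120 ∷ 121 ∷ 1031 ∷ 2031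
          ∷ 2130 ∷ 3031 ∷ 3032 ∷ 3033 ∷ 3132 ∷ 3133 ∷ 3233 ∷ []) []) $
     split 3132
       (reduce (3031 ∷ 3233 ∷ 13032 ∷ 13133 ∷ []) (10 ∷ 120 ∷ 121 ∷ 3031 ∷ 3032 ∷ 3033 ∷ 3133 ∷
          3233 ∷ []) []) $
     reduce (1032 ∷ 3133 ∷ 12031 ∷ 12130 ∷ 13233 ∷ 303132 ∷ []) (10 ∷ 120 ∷ 121 ∷ 1032 ∷ 2031 ∷
       2130 ∷ 3031 ∷ 3032 ∷ 3033 ∷ 3132 ∷ 3133 ∷ 3233 ∷ []) []) $
  split 3233
    (forced 3210 0 33 $
     reduce (1032 ∷ 3031 ∷ 12021 ∷ 13032 ∷ 13133 ∷ []) (10 ∷ 120 ∷ 121 ∷ 1032 ∷ 2021 ∷ 3031 ∷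
       3032 ∷ 3033 ∷ 3132 ∷ 3133 ∷ []) []) $
  reduce (3031 ∷ 3233 ∷ 12021 ∷ 13032 ∷ 13133 ∷ []) (10 ∷ 120 ∷ 121 ∷ 2021 ∷ 3031 ∷ 3032 ∷ 3033
    ∷ 3132 ∷ 3133 ∷ 3233 ∷ []) []
nonadjacentTree 2 2 4 =
  split 1011
    (split 3133
       (forced 3132 0 33 $
        forced 1030 0 11 $
        split 2130
          (forced 3332 0 31 $
           forced 1131 0 10 $
           forced 2120 1 30 $
           forced 3330 0 31 $
           reduce (1030 ∷ 1131 ∷ 3233 ∷ 12021 ∷ 13033 ∷ 13132 ∷ []) (10 ∷ 11 ∷ 30 ∷ 120 ∷ 121 ∷
             130 ∷ 1030 ∷ 1131 ∷ 2021 ∷ 3033 ∷ 3132 ∷ 3233 ∷ []) []) $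
        forced 1133 0 10 $
        forced 3332 0 31 $
        forced 3120 1 33 $
        reduce (1030 ∷ 1133 ∷ 3132 ∷ 12031 ∷ 12130 ∷ 13233 ∷ []) (10 ∷ 11 ∷ 30 ∷ 120 ∷ 121 ∷ 130
          ∷ 1030 ∷ 1133 ∷ 2031 ∷ 2130 ∷ 3132 ∷ 3233 ∷ []) []) $
     split 2032
       (forced 2030 1 32 $
        forced 1032 0 11 $
        split 3033
          (forced 3031 0 33 $
           forced 3221 1 20 $
           forced 1133 0 10 $
           reduce (1032 ∷ 1133 ∷ 3031 ∷ 12030 ∷ 12132 ∷ 13133 ∷ []) (10 ∷ 11 ∷ 32 ∷ 120 ∷ 121 ∷
             132 ∷ 1032 ∷ 1133 ∷ 2030 ∷ 2132 ∷ 3031 ∷ 3133 ∷ []) []) $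
        forced 1130 0 10 $
        forced 3231 1 20 $
        forced 3233 1 20 $
        forced 3230 1 20 $
        split 2133
          (forced 2130 1 33 $
           forced 2033 1 32 $
           reduce (1032 ∷ 1130 ∷ 3133 ∷ 12033 ∷ 12130 ∷ 13132 ∷ 303233 ∷ []) (10 ∷ 11 ∷ 120 ∷
             121 ∷ 1032 ∷ 1130 ∷ 2033 ∷ 2130 ∷ 3031 ∷ 3032 ∷ 3033 ∷ 3132 ∷ 3133 ∷ 3233 ∷ []) [])
             $
        reduce (1032 ∷ 1130 ∷ 3133 ∷ 12030 ∷ 12133 ∷ 13132 ∷ 303233 ∷ []) (10 ∷ 11 ∷ 120 ∷ 121 ∷
          1032 ∷ 1130 ∷ 2030 ∷ 2133 ∷ 3031 ∷ 3032 ∷ 3033 ∷ 3132 ∷ 3133 ∷ 3233 ∷ []) []) $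
     forced 1131 0 10 $
     forced 1033 0 11 $
     split 3233
       (forced 3230 0 33 $
        split 2131
          (forced 2120 1 31 $
           forced 1032 0 11 $
           forced 3330 0 32 $
           reduce (1032 ∷ 1131 ∷ 3033 ∷ 12021 ∷ 13032 ∷ 13133 ∷ []) (10 ∷ 11 ∷ 31 ∷ 120 ∷ 121 ∷
             131 ∷ 1032 ∷ 1131 ∷ 2021 ∷ 3032 ∷ 3033 ∷ 3133 ∷ []) []) $
        forced 3330 0 32 $
        reduce (1033 ∷ 1131 ∷ 3032 ∷ 12032 ∷ 12131 ∷ 13033 ∷ []) (10 ∷ 11 ∷ 31 ∷ 120 ∷ 121 ∷ 131
          ∷ 1033 ∷ 1131 ∷ 2032 ∷ 2131 ∷ 3032 ∷ 3033 ∷ []) []) $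
     split 3132
       (split 2130
          (forced 2120 1 30 $
           forced 3130 0 32 $
           forced 3230 0 31 $
           reduce (1033 ∷ 1131 ∷ 3032 ∷ 12021 ∷ 13031 ∷ 13233 ∷ []) (10 ∷ 11 ∷ 33 ∷ 120 ∷ 121 ∷
             133 ∷ 1033 ∷ 1131 ∷ 2021 ∷ 3031 ∷ 3032 ∷ 3233 ∷ []) []) $
        forced 1030 0 11 $
        reduce (1030 ∷ 1131 ∷ 3233 ∷ 12032 ∷ 12130 ∷ 13133 ∷ []) (10 ∷ 11 ∷ 30 ∷ 120 ∷ 121 ∷ 130
          ∷ 1030 ∷ 1131 ∷ 2032 ∷ 2130 ∷ 3133 ∷ 3233 ∷ []) []) $
     split 3032
       (forced 3031 0 32 $
        split 2133
          (forced 1132 0 10 $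
           forced 3033 0 32 $
           reduce (1033 ∷ 1132 ∷ 3031 ∷ 12032 ∷ 13033 ∷ 313233 ∷ []) (10 ∷ 11 ∷ 120 ∷ 121 ∷ 1033
             ∷ 1132 ∷ 2032 ∷ 3031 ∷ 3033 ∷ 3132 ∷ 3133 ∷ 3233 ∷ []) []) $
        forced 3033 0 32 $
        reduce (1131 ∷ 3033 ∷ 12032 ∷ 12133 ∷ 13031 ∷ 313233 ∷ []) (10 ∷ 11 ∷ 120 ∷ 121 ∷ 1131 ∷
          2032 ∷ 2133 ∷ 3031 ∷ 3033 ∷ 3132 ∷ 3133 ∷ 3233 ∷ []) []) $
     split 3033
       (forced 3031 0 33 $
        reduce (1033 ∷ 1131 ∷ 3032 ∷ 12032 ∷ 13031 ∷ 313233 ∷ []) (10 ∷ 11 ∷ 120 ∷ 121 ∷ 1033 ∷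
          1131 ∷ 2032 ∷ 3031 ∷ 3032 ∷ 3132 ∷ 3133 ∷ 3233 ∷ []) []) $
     split 2131
       (forced 3130 1 21 $
        forced 2133 1 31 $
        reduce (1033 ∷ 1131 ∷ 3032 ∷ 12032 ∷ 12133 ∷ 13031 ∷ 313233 ∷ []) (10 ∷ 11 ∷ 120 ∷ 121 ∷
          1033 ∷ 1131 ∷ 2032 ∷ 2133 ∷ 3031 ∷ 3032 ∷ 3033 ∷ 3132 ∷ 3133 ∷ 3233 ∷ []) []) $
     reduce (1033 ∷ 1131 ∷ 3032 ∷ 12032 ∷ 12131 ∷ 13033 ∷ 313233 ∷ []) (10 ∷ 11 ∷ 120 ∷ 121 ∷
       1033 ∷ 1131 ∷ 2032 ∷ 2131 ∷ 3031 ∷ 3032 ∷ 3033 ∷ 3132 ∷ 3133 ∷ 3233 ∷ []) []) $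
  split 2021
    (forced 2033 1 21 $
     split 3032
       (forced 2132 1 20 $
        forced 3031 0 32 $
        forced 3033 0 32 $
        forced 3231 0 30 $
        reduce (1011 ∷ 3033 ∷ 3132 ∷ 12033 ∷ 12132 ∷ 13031 ∷ []) (10 ∷ 11 ∷ 33 ∷ 120 ∷ 121 ∷ 133
          ∷ 1011 ∷ 2033 ∷ 2132 ∷ 3031 ∷ 3033 ∷ 3132 ∷ []) []) $
     split 3031
       (forced 3132 0 30 $
        forced 3133 0 30 $
        forced 2130 1 20 $
        reduce (1011 ∷ 3032 ∷ 3133 ∷ 12033 ∷ 12130 ∷ 13132 ∷ []) (10 ∷ 11 ∷ 33 ∷ 120 ∷ 121 ∷ 133
          ∷ 1011 ∷ 2033 ∷ 2130 ∷ 3032 ∷ 3132 ∷ 3133 ∷ []) []) $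
     forced 2032 1 21 $
     split 3233
       (forced 2133 1 20 $
        forced 3331 0 32 $
        reduce (1011 ∷ 3032 ∷ 3133 ∷ 12032 ∷ 12133 ∷ 13031 ∷ []) (10 ∷ 11 ∷ 120 ∷ 121 ∷ 1011 ∷
          2032 ∷ 2133 ∷ 3031 ∷ 3032 ∷ 3033 ∷ 3132 ∷ 3133 ∷ []) []) $
     split 3132
       (forced 3133 0 32 $
        reduce (1011 ∷ 3032 ∷ 3133 ∷ 13031 ∷ 13233 ∷ []) (10 ∷ 11 ∷ 120 ∷ 121 ∷ 1011 ∷ 3031 ∷
          3032 ∷ 3033 ∷ 3133 ∷ 3233 ∷ []) []) $
     split 3033
       (forced 2131 1 20 $
        reduce (1011 ∷ 3031 ∷ 3233 ∷ 12033 ∷ 12131 ∷ 13032 ∷ []) (10 ∷ 11 ∷ 31 ∷ 120 ∷ 121 ∷ 131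
          ∷ 1011 ∷ 2033 ∷ 2131 ∷ 3031 ∷ 3032 ∷ 3233 ∷ []) []) $
     split 3133
       (reduce (1011 ∷ 3031 ∷ 3233 ∷ 13033 ∷ 13132 ∷ []) (10 ∷ 11 ∷ 120 ∷ 121 ∷ 1011 ∷ 3031 ∷
          3032 ∷ 3033 ∷ 3132 ∷ 3233 ∷ []) []) $
     forced 2031 1 21 $
     forced 2030 1 21 $
     reduce (1011 ∷ 3031 ∷ 3233 ∷ 13033 ∷ 13132 ∷ 203032 ∷ 203133 ∷ []) (10 ∷ 11 ∷ 121 ∷ 1011 ∷
       2030 ∷ 2031 ∷ 2032 ∷ 2033 ∷ 3031 ∷ 3032 ∷ 3033 ∷ 3132 ∷ 3133 ∷ 3233 ∷ []) []) $
  split 3033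
    (forced 3332 0 30 $
     forced 3032 0 33 $
     forced 3331 0 30 $
     forced 3031 0 33 $
     reduce (1011 ∷ 3032 ∷ 3133 ∷ 12021 ∷ 13031 ∷ 13233 ∷ []) (10 ∷ 11 ∷ 120 ∷ 121 ∷ 1011 ∷ 2021
       ∷ 3031 ∷ 3032 ∷ 3132 ∷ 3133 ∷ 3233 ∷ []) []) $
  split 3133
    (forced 3130 0 33 $
     forced 3332 0 31 $
     forced 3132 0 33 $
     reduce (1011 ∷ 3033 ∷ 3132 ∷ 12021 ∷ 13031 ∷ 13233 ∷ []) (10 ∷ 11 ∷ 120 ∷ 121 ∷ 1011 ∷ 2021
       ∷ 3031 ∷ 3032 ∷ 3033 ∷ 3132 ∷ 3233 ∷ []) []) $
  split 3032
    (forced 3233 0 30 $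
     forced 3031 0 32 $
     forced 3231 0 30 $
     reduce (1011 ∷ 3031 ∷ 3233 ∷ 13033 ∷ 13132 ∷ []) (10 ∷ 11 ∷ 120 ∷ 121 ∷ 1011 ∷ 3031 ∷ 3033
       ∷ 3132 ∷ 3133 ∷ 3233 ∷ []) []) $
  split 3132
    (forced 3233 0 31 $
     forced 3130 0 32 $
     reduce (1011 ∷ 3031 ∷ 3233 ∷ 13032 ∷ 13133 ∷ []) (10 ∷ 11 ∷ 120 ∷ 121 ∷ 1011 ∷ 3031 ∷ 3032
       ∷ 3033 ∷ 3133 ∷ 3233 ∷ []) []) $
  reduce (1011 ∷ 3032 ∷ 3133 ∷ 12021 ∷ 13033 ∷ 13132 ∷ []) (10 ∷ 11 ∷ 120 ∷ 121 ∷ 1011 ∷ 2021 ∷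
    3031 ∷ 3032 ∷ 3033 ∷ 3132 ∷ 3133 ∷ 3233 ∷ []) []
nonadjacentTree 0 0 5 =
  split 3133
    (forced 3334 0 31 $
     forced 3134 0 33 $
     forced 3132 0 33 $
     forced 3332 0 31 $
     reduce (3132 ∷ 3334 ∷ 13134 ∷ 13233 ∷ []) (30 ∷ 130 ∷ 3132 ∷ 3134 ∷ 3233 ∷ 3234 ∷ 3334 ∷
       []) []) $
  split 3233
    (forced 3231 0 33 $
     forced 3334 0 32 $
     forced 3230 0 33 $
     reduce (3132 ∷ 3334 ∷ 13032 ∷ 13133 ∷ []) (30 ∷ 34 ∷ 130 ∷ 134 ∷ 3032 ∷ 3132 ∷ 3133 ∷ 3334
       ∷ []) []) $
  split 3031
    (forced 3034 0 31 $
     forced 3032 0 31 $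
     reduce (3032 ∷ 3133 ∷ 13034 ∷ 13233 ∷ []) (34 ∷ 134 ∷ 3032 ∷ 3033 ∷ 3034 ∷ 3132 ∷ 3133 ∷
       3233 ∷ []) []) $
  split 3032
    (forced 3234 0 30 $
     reduce (3031 ∷ 3233 ∷ 13133 ∷ 13234 ∷ []) (34 ∷ 134 ∷ 3031 ∷ 3033 ∷ 3132 ∷ 3133 ∷ 3233 ∷
       3234 ∷ []) []) $
  reduce (3031 ∷ 3233 ∷ 13032 ∷ 13133 ∷ []) (34 ∷ 134 ∷ 3031 ∷ 3032 ∷ 3033 ∷ 3132 ∷ 3133 ∷ 3233
    ∷ []) []
nonadjacentTree 0 1 5 =
  split 3034
    (forced 3033 0 34 $
     forced 3031 0 34 $
     forced 3431 0 30 $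
     forced 3433 0 30 $
     reduce (3033 ∷ 3134 ∷ 13031 ∷ 13334 ∷ []) (32 ∷ 120 ∷ 132 ∷ 3031 ∷ 3033 ∷ 3133 ∷ 3134 ∷
       3334 ∷ []) []) $
  split 3234
    (forced 3231 0 34 $
     forced 3431 0 32 $
     forced 3230 0 34 $
     reduce (3032 ∷ 3134 ∷ 13034 ∷ 13132 ∷ []) (33 ∷ 120 ∷ 133 ∷ 3031 ∷ 3032 ∷ 3034 ∷ 3132 ∷
       3134 ∷ []) []) $
  split 2031
    (forced 2033 1 31 $
     forced 3132 1 20 $
     forced 3130 1 20 $
     reduce (3031 ∷ 3234 ∷ 12033 ∷ 13034 ∷ 13132 ∷ []) (33 ∷ 120 ∷ 133 ∷ 2033 ∷ 3031 ∷ 3032 ∷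
       3034 ∷ 3132 ∷ 3134 ∷ 3234 ∷ []) []) $
  split 3033
    (forced 3332 0 30 $
     forced 3031 0 33 $
     reduce (3031 ∷ 3234 ∷ 12031 ∷ 13034 ∷ 13233 ∷ []) (31 ∷ 120 ∷ 131 ∷ 2031 ∷ 3031 ∷ 3032 ∷
       3034 ∷ 3233 ∷ 3234 ∷ 3334 ∷ []) []) $
  split 3233
    (forced 3331 0 32 $
     reduce (3034 ∷ 3133 ∷ 12031 ∷ 13033 ∷ 13234 ∷ []) (31 ∷ 120 ∷ 131 ∷ 2031 ∷ 3032 ∷ 3033 ∷
       3034 ∷ 3133 ∷ 3234 ∷ 3334 ∷ []) []) $
  reduce (3034 ∷ 3233 ∷ 12031 ∷ 13033 ∷ 13234 ∷ []) (31 ∷ 120 ∷ 131 ∷ 2031 ∷ 3032 ∷ 3033 ∷ 3034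
    ∷ 3233 ∷ 3234 ∷ 3334 ∷ []) []
nonadjacentTree 1 1 5 =
  split 2034
    (split 1033
       (forced 3430 1 20 $
        forced 3431 1 20 $
        forced 3330 0 10 $
        forced 1032 0 33 $
        forced 2032 1 34 $
        forced 3331 0 10 $
        reduce (1032 ∷ 3034 ∷ 3133 ∷ 12032 ∷ 13033 ∷ 13134 ∷ []) (10 ∷ 32 ∷ 120 ∷ 132 ∷ 1032 ∷
          2032 ∷ 3031 ∷ 3033 ∷ 3034 ∷ 3133 ∷ 3134 ∷ 3334 ∷ []) []) $
     forced 3432 1 20 $
     split 3031
       (forced 3134 0 30 $
        forced 3033 0 31 $
        forced 2031 1 34 $
        forced 3032 0 31 $
        reduce (1033 ∷ 3032 ∷ 3134 ∷ 12031 ∷ 13033 ∷ 13234 ∷ []) (10 ∷ 33 ∷ 120 ∷ 133 ∷ 1033 ∷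
          2031 ∷ 3032 ∷ 3033 ∷ 3034 ∷ 3132 ∷ 3134 ∷ 3234 ∷ []) []) $
     forced 3430 1 20 $
     split 3132
       (forced 2032 1 34 $
        forced 3133 0 32 $
        reduce (1033 ∷ 3031 ∷ 3234 ∷ 12032 ∷ 13034 ∷ 13133 ∷ []) (10 ∷ 33 ∷ 120 ∷ 133 ∷ 1033 ∷
          2032 ∷ 3031 ∷ 3032 ∷ 3034 ∷ 3133 ∷ 3134 ∷ 3234 ∷ []) []) $
     forced 2033 1 34 $
     reduce (1033 ∷ 3034 ∷ 3132 ∷ 12033 ∷ 13031 ∷ 13234 ∷ []) (10 ∷ 33 ∷ 120 ∷ 133 ∷ 1033 ∷ 2033
       ∷ 3031 ∷ 3032 ∷ 3034 ∷ 3132 ∷ 3134 ∷ 3234 ∷ []) []) $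
  split 3233
    (forced 3234 0 33 $
     forced 3230 0 33 $
     forced 3330 0 32 $
     split 1031
       (forced 3132 0 10 $
        forced 3133 0 10 $
        reduce (3033 ∷ 3132 ∷ 12034 ∷ 13032 ∷ 13133 ∷ []) (10 ∷ 34 ∷ 120 ∷ 134 ∷ 2034 ∷ 3031 ∷
          3032 ∷ 3033 ∷ 3132 ∷ 3133 ∷ []) []) $
     forced 3334 0 32 $
     reduce (1031 ∷ 3032 ∷ 3334 ∷ 13033 ∷ 13234 ∷ []) (10 ∷ 31 ∷ 120 ∷ 131 ∷ 1031 ∷ 3032 ∷ 3033
       ∷ 3034 ∷ 3234 ∷ 3334 ∷ []) []) $
  split 3031
    (forced 3132 0 30 $
     forced 3134 0 30 $
     forced 3033 0 31 $
     forced 3010 0 31 $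
     reduce (1030 ∷ 3134 ∷ 3233 ∷ 12034 ∷ 13033 ∷ 13132 ∷ []) (10 ∷ 34 ∷ 120 ∷ 134 ∷ 1030 ∷ 2034
       ∷ 3032 ∷ 3033 ∷ 3132 ∷ 3133 ∷ 3134 ∷ 3233 ∷ []) []) $
  split 3032
    (forced 3033 0 32 $
     forced 3231 0 30 $
     reduce (3031 ∷ 3233 ∷ 12034 ∷ 13033 ∷ 13132 ∷ []) (10 ∷ 34 ∷ 120 ∷ 134 ∷ 2034 ∷ 3031 ∷ 3033
       ∷ 3132 ∷ 3133 ∷ 3233 ∷ []) []) $
  split 1034
    (forced 1033 0 34 $
     forced 3430 0 10 $
     forced 3433 0 10 $
     forced 3431 0 10 $
     split 3033
       (reduce (1033 ∷ 3032 ∷ 3134 ∷ 12034 ∷ 13031 ∷ 13233 ∷ []) (10 ∷ 31 ∷ 34 ∷ 120 ∷ 131 ∷ 134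
          ∷ 1033 ∷ 2034 ∷ 3031 ∷ 3032 ∷ 3134 ∷ 3233 ∷ []) []) $
     reduce (1033 ∷ 3032 ∷ 3134 ∷ 12034 ∷ 13031 ∷ 13233 ∷ 303334 ∷ []) (10 ∷ 31 ∷ 120 ∷ 131 ∷
       1033 ∷ 2034 ∷ 3031 ∷ 3032 ∷ 3033 ∷ 3034 ∷ 3134 ∷ 3233 ∷ 3234 ∷ 3334 ∷ []) []) $
  split 3133
    (forced 3134 0 33 $
     forced 3320 1 31 $
     reduce (1034 ∷ 3031 ∷ 3233 ∷ 12033 ∷ 13032 ∷ 13134 ∷ []) (10 ∷ 34 ∷ 120 ∷ 134 ∷ 1034 ∷ 2033
       ∷ 3031 ∷ 3032 ∷ 3033 ∷ 3132 ∷ 3134 ∷ 3233 ∷ []) []) $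
  reduce (1034 ∷ 3032 ∷ 3133 ∷ 12034 ∷ 13031 ∷ 13233 ∷ []) (10 ∷ 34 ∷ 120 ∷ 134 ∷ 1034 ∷ 2034 ∷
    3031 ∷ 3032 ∷ 3033 ∷ 3132 ∷ 3133 ∷ 3233 ∷ []) []
nonadjacentTree 0 0 6 =
  split 3335
    (forced 3531 0 33 $
     forced 3532 0 33 $
     split 3034
       (forced 3033 0 34 $
        forced 3334 0 35 $
        forced 3031 0 34 $
        forced 3431 0 30 $
        reduce (3031 ∷ 3235 ∷ 3334 ∷ 13033 ∷ 13134 ∷ []) (32 ∷ 35 ∷ 132 ∷ 135 ∷ 3031 ∷ 3033 ∷
          3133 ∷ 3134 ∷ 3235 ∷ 3334 ∷ []) []) $
     forced 3331 0 35 $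
     forced 3332 0 35 $
     reduce (3133 ∷ 3235 ∷ 13034 ∷ 13135 ∷ 13233 ∷ []) (30 ∷ 34 ∷ 130 ∷ 134 ∷ 3034 ∷ 3132 ∷ 3133
       ∷ 3135 ∷ 3233 ∷ 3235 ∷ []) []) $
  split 3034
    (forced 3032 0 34 $
     forced 3031 0 34 $
     forced 3432 0 30 $
     forced 3431 0 30 $
     reduce (3031 ∷ 3234 ∷ 3335 ∷ 13032 ∷ 13134 ∷ []) (33 ∷ 35 ∷ 133 ∷ 135 ∷ 3031 ∷ 3032 ∷ 3132
       ∷ 3134 ∷ 3234 ∷ 3335 ∷ []) []) $
  split 3134
    (forced 3132 0 34 $
     forced 3130 0 34 $
     forced 3432 0 31 $
     reduce (3031 ∷ 3234 ∷ 13034 ∷ 13132 ∷ 13335 ∷ []) (33 ∷ 35 ∷ 133 ∷ 135 ∷ 3031 ∷ 3032 ∷ 3034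
       ∷ 3132 ∷ 3234 ∷ 3335 ∷ []) []) $
  split 3132
    (forced 3233 0 31 $
     forced 3230 0 31 $
     forced 3135 0 32 $
     reduce (3034 ∷ 3135 ∷ 3233 ∷ 13032 ∷ 13134 ∷ 13335 ∷ []) (30 ∷ 34 ∷ 130 ∷ 134 ∷ 3032 ∷ 3034
       ∷ 3133 ∷ 3134 ∷ 3135 ∷ 3233 ∷ 3235 ∷ 3335 ∷ []) []) $
  split 3235
    (forced 3233 0 35 $
     forced 3531 0 32 $
     reduce (3034 ∷ 3135 ∷ 3233 ∷ 13132 ∷ 13335 ∷ []) (30 ∷ 34 ∷ 130 ∷ 134 ∷ 3034 ∷ 3132 ∷ 3133
       ∷ 3135 ∷ 3233 ∷ 3335 ∷ []) []) $
  split 3033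
    (forced 3334 0 30 $
     forced 3035 0 33 $
     reduce (3034 ∷ 3335 ∷ 13035 ∷ 13132 ∷ 13334 ∷ []) (31 ∷ 32 ∷ 131 ∷ 132 ∷ 3034 ∷ 3035 ∷ 3132
       ∷ 3334 ∷ 3335 ∷ 3435 ∷ []) []) $
  split 3135
    (reduce (3034 ∷ 3132 ∷ 3335 ∷ 13033 ∷ 13134 ∷ 13235 ∷ []) (30 ∷ 33 ∷ 34 ∷ 130 ∷ 133 ∷ 134 ∷
       3033 ∷ 3034 ∷ 3132 ∷ 3134 ∷ 3235 ∷ 3335 ∷ []) []) $
  split 3031
    (reduce (3033 ∷ 3134 ∷ 3235 ∷ 13034 ∷ 13132 ∷ 13335 ∷ []) (32 ∷ 33 ∷ 35 ∷ 132 ∷ 133 ∷ 135 ∷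
       3033 ∷ 3034 ∷ 3132 ∷ 3134 ∷ 3235 ∷ 3335 ∷ []) []) $
  split 3035
    (reduce (3034 ∷ 3132 ∷ 3335 ∷ 13033 ∷ 13134 ∷ 13235 ∷ []) (31 ∷ 32 ∷ 34 ∷ 131 ∷ 132 ∷ 134 ∷
       3033 ∷ 3034 ∷ 3132 ∷ 3134 ∷ 3235 ∷ 3335 ∷ []) []) $
  reduce (3033 ∷ 3134 ∷ 3235 ∷ 13034 ∷ 13132 ∷ 13335 ∷ 303135 ∷ []) (32 ∷ 33 ∷ 132 ∷ 133 ∷ 3031
    ∷ 3033 ∷ 3034 ∷ 3035 ∷ 3132 ∷ 3134 ∷ 3135 ∷ 3235 ∷ 3335 ∷ 3435 ∷ []) []
nonadjacentTree _ _ _ = reduce [] [] []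

-- The sizes left over by `tight-sizes`: vertex 0 has degree 8 and shares exactly four neighbours
-- with each of its low neighbours 1 and 2. The arguments are the excesses of the degrees of 1 and 2
-- over 5.
richTree : ℕ → ℕ → Tree
richTree 0 0 =
  split 7071
    (forced 7150 2 70 $
     forced 7030 1 71 $
     reduce (171 ∷ 270 ∷ 13070 ∷ 25071 ∷ []) (70 ∷ 71 ∷ 130 ∷ 131 ∷ 250 ∷ 251 ∷ 3070 ∷ 5071 ∷
       []) []) $
  split 5071
    (forced 5051 2 71 $
     forced 5070 2 71 $
     reduce (131 ∷ 271 ∷ 5070 ∷ 17071 ∷ 25051 ∷ []) (31 ∷ 50 ∷ 70 ∷ 71 ∷ 130 ∷ 131 ∷ 251 ∷ 5051
       ∷ 5070 ∷ 7071 ∷ []) []) $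
  split 3171
    (forced 3170 1 71 $
     reduce (130 ∷ 251 ∷ 3170 ∷ 5071 ∷ 17071 ∷ []) (1 ∷ 2 ∷ 30 ∷ 50 ∷ 51 ∷ 130 ∷ 251 ∷ 3170 ∷
       5071 ∷ 7071 ∷ []) []) $
  split 5070
    (reduce (130 ∷ 251 ∷ 7071 ∷ 13171 ∷ 25071 ∷ []) (1 ∷ 2 ∷ 30 ∷ 51 ∷ 130 ∷ 251 ∷ 3170 ∷ 3171 ∷
       5071 ∷ 7071 ∷ []) []) $
  reduce (130 ∷ 251 ∷ 3171 ∷ 5070 ∷ 17071 ∷ 25071 ∷ []) (1 ∷ 2 ∷ 30 ∷ 31 ∷ 51 ∷ 130 ∷ 131 ∷ 251
    ∷ 3171 ∷ 5070 ∷ 5071 ∷ 7071 ∷ []) []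
richTree 0 1 =
  split 3070
    (forced 4070 2 0 $
     forced 3031 1 70 $
     forced 7031 1 30 $
     split 5170
       (reduce (171 ∷ 270 ∷ 3031 ∷ 13170 ∷ []) (1 ∷ 50 ∷ 51 ∷ 71 ∷ 171 ∷ 270 ∷ 3031 ∷ 3170 ∷ [])
          []) $
     reduce (171 ∷ 250 ∷ 3031 ∷ 5170 ∷ 13170 ∷ 24070 ∷ []) (1 ∷ 50 ∷ 51 ∷ 71 ∷ 171 ∷ 240 ∷ 250 ∷
       270 ∷ 3031 ∷ 3170 ∷ 4070 ∷ 5170 ∷ []) []) $
  split 3071
    (forced 7170 1 30 $
     split 5051
       (forced 4051 2 0 $
        forced 5171 2 50 $
        reduce (131 ∷ 250 ∷ 3070 ∷ 5171 ∷ 24051 ∷ 27071 ∷ []) (1 ∷ 31 ∷ 50 ∷ 51 ∷ 131 ∷ 240 ∷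
          270 ∷ 271 ∷ 3070 ∷ 4051 ∷ 5171 ∷ 7071 ∷ []) []) $
     forced 4070 2 0 $
     reduce (131 ∷ 271 ∷ 3070 ∷ 17071 ∷ 24070 ∷ 25051 ∷ []) (30 ∷ 31 ∷ 70 ∷ 71 ∷ 131 ∷ 240 ∷ 250
       ∷ 251 ∷ 3070 ∷ 4070 ∷ 5051 ∷ 7071 ∷ []) []) $
  forced 4050 2 0 $
  split 7071
    (forced 7150 2 70 $
     reduce (131 ∷ 251 ∷ 3070 ∷ 5071 ∷ 13071 ∷ 24050 ∷ []) (1 ∷ 31 ∷ 50 ∷ 51 ∷ 131 ∷ 251 ∷ 270 ∷
       271 ∷ 3070 ∷ 3071 ∷ 4050 ∷ 5071 ∷ []) []) $
  reduce (131 ∷ 251 ∷ 3071 ∷ 13070 ∷ 24050 ∷ 27071 ∷ []) (1 ∷ 31 ∷ 50 ∷ 51 ∷ 131 ∷ 251 ∷ 270 ∷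
    271 ∷ 3070 ∷ 3071 ∷ 4050 ∷ 7071 ∷ []) []
richTree 1 1 =
  split 7071
    (forced 7031 1 71 $
     forced 7131 1 70 $
     forced 7051 2 71 $
     forced 4051 2 0 $
     forced 2071 1 0 $
     reduce (130 ∷ 250 ∷ 3171 ∷ 5170 ∷ 12071 ∷ 13170 ∷ 24051 ∷ []) (1 ∷ 30 ∷ 50 ∷ 51 ∷ 120 ∷ 130
       ∷ 250 ∷ 270 ∷ 271 ∷ 2071 ∷ 3170 ∷ 3171 ∷ 4051 ∷ 5170 ∷ []) []) $
  split 5171
    (forced 7150 2 51 $
     forced 4070 2 0 $
     split 5070
       (forced 2031 1 0 $
        split 3170
          (forced 3171 1 70 $
           forced 5051 2 70 $
           reduce (130 ∷ 270 ∷ 3171 ∷ 5051 ∷ 17071 ∷ 25071 ∷ []) (1 ∷ 2 ∷ 30 ∷ 31 ∷ 120 ∷ 130 ∷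
             240 ∷ 3171 ∷ 5051 ∷ 5071 ∷ 5170 ∷ 7071 ∷ []) []) $
        reduce (130 ∷ 251 ∷ 3170 ∷ 5071 ∷ 12031 ∷ 17071 ∷ 24070 ∷ []) (2 ∷ 30 ∷ 31 ∷ 51 ∷ 130 ∷
          170 ∷ 171 ∷ 240 ∷ 251 ∷ 2031 ∷ 3170 ∷ 4070 ∷ 5071 ∷ 7071 ∷ []) []) $
     split 3171
       (forced 2031 1 0 $
        reduce (130 ∷ 251 ∷ 5070 ∷ 12031 ∷ 17071 ∷ 24070 ∷ 25071 ∷ []) (2 ∷ 30 ∷ 31 ∷ 51 ∷ 130 ∷
          170 ∷ 171 ∷ 240 ∷ 251 ∷ 2031 ∷ 4070 ∷ 5070 ∷ 5071 ∷ 7071 ∷ []) []) $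
     reduce (130 ∷ 251 ∷ 3171 ∷ 5070 ∷ 17071 ∷ 24070 ∷ 25071 ∷ []) (2 ∷ 30 ∷ 31 ∷ 51 ∷ 130 ∷ 170
       ∷ 171 ∷ 240 ∷ 251 ∷ 3171 ∷ 4070 ∷ 5070 ∷ 5071 ∷ 7071 ∷ []) []) $
  split 3071
    (forced 2071 1 0 $
     forced 4070 2 0 $
     forced 3070 1 71 $
     reduce (131 ∷ 250 ∷ 7071 ∷ 12071 ∷ 13070 ∷ 24070 ∷ 25171 ∷ []) (1 ∷ 2 ∷ 31 ∷ 50 ∷ 120 ∷ 131
       ∷ 240 ∷ 250 ∷ 2071 ∷ 3070 ∷ 4070 ∷ 5170 ∷ 5171 ∷ 7071 ∷ []) []) $
  split 3070
    (forced 3031 1 70 $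
     split 5070
       (forced 4070 2 0 $
        forced 5071 2 70 $
        reduce (131 ∷ 251 ∷ 7071 ∷ 13071 ∷ 24070 ∷ 25071 ∷ []) (1 ∷ 2 ∷ 31 ∷ 51 ∷ 120 ∷ 131 ∷
          240 ∷ 251 ∷ 3071 ∷ 4070 ∷ 5071 ∷ 7071 ∷ []) []) $
     forced 4050 2 0 $
     forced 7031 1 30 $
     reduce (171 ∷ 251 ∷ 3031 ∷ 5070 ∷ 13170 ∷ 24050 ∷ 27071 ∷ []) (1 ∷ 50 ∷ 51 ∷ 71 ∷ 120 ∷ 171
       ∷ 251 ∷ 270 ∷ 271 ∷ 3031 ∷ 3170 ∷ 4050 ∷ 5070 ∷ 7071 ∷ []) []) $
  forced 4051 2 0 $
  forced 2070 1 0 $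
  reduce (131 ∷ 250 ∷ 3070 ∷ 5171 ∷ 12070 ∷ 13071 ∷ 24051 ∷ 27071 ∷ []) (1 ∷ 31 ∷ 50 ∷ 51 ∷ 120
    ∷ 131 ∷ 250 ∷ 270 ∷ 271 ∷ 2070 ∷ 3070 ∷ 3071 ∷ 4051 ∷ 5171 ∷ 7071 ∷ []) []
richTree _ _ = reduce [] [] []


-- Verification of the certificates by evaluation

abstract

  degreeTree-holds : All (λ k → Check.Holds 1 (1 ∷ k ∷ []) [] [] [] (degreeTree k)) (1 ∷ 2 ∷ 3 ∷ 4 ∷ [])
  degreeTree-holds = toWitness
    {a? = All.all? (λ k → Check.holds? 1 (1 ∷ k ∷ []) [] [] [] (degreeTree k)) _} tt

abstract

  sharedTree-holds : All (λ k → Check.Holds 1 (4 ∷ k ∷ []) []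
                          (map edge (1 ∷ 2 ∷ 3 ∷ [])) (map edge (102 ∷ 103 ∷ [])) (sharedTree k))
                 (2 ∷ 3 ∷ [])
  sharedTree-holds = toWitness
    {a? = All.all? (λ k → Check.holds? 1 (4 ∷ k ∷ []) [] _ _ (sharedTree k)) _} tt

abstract

  disjointTree-holds : Check.Holds 1 (5 ∷ 1 ∷ []) (0 ∷ [])
                         (map edge (1 ∷ 2 ∷ 3 ∷ 4 ∷ [])) (map edge (102 ∷ 304 ∷ [])) disjointTree
  disjointTree-holds = toWitness {a? = Check.holds? 1 (5 ∷ 1 ∷ []) (0 ∷ []) _ _ disjointTree} tt

Low : ℕ → Set
Low d = 5 ≤ d × d ≤ 6

low? : ∀ d → Dec (Low d)
low? d = 5 ℕ.≤? d ×-dec d ℕ.≤? 6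

-- In the adjacent case the degrees are `1 + (p + c)` and `1 + (q + c)`, and the bound by `c + 2` is
-- `deg≤codeg+2`. In the nonadjacent case `p ≤ q` uses the symmetry between the two vertices to save
-- certificates.
AdjacentSizes NonadjacentSizes : ℕ → ℕ → ℕ → Set
AdjacentSizes p q c = Low (1 + (p + c)) × 1 + (p + c) ≤ c + 2 ×
                5 ≤ 1 + (q + c) × (1 + (q + c) ≤ 6 ⊎ 1 + (q + c) ≤ 7 × 4 ≤ c)
NonadjacentSizes p q c = Low (p + c) × Low (q + c) × 4 ≤ c × p ≤ q

abstract

  adjacentTree-holds : All (λ p → All (λ q → All (λ c → AdjacentSizes p q c →
              Check.Holds 2 (2 ∷ p ∷ q ∷ c ∷ []) (0 ∷ []) (map edge (1 ∷ [])) [] (adjacentTree p q c))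
            (upTo 6)) (upTo 7)) (upTo 6)
  adjacentTree-holds = toWitness
    {a? = All.all? (λ p → All.all? (λ q → All.all? (λ c →
            (low? (1 + (p + c)) ×-dec 1 + (p + c) ℕ.≤? c + 2 ×-dec 5 ℕ.≤? 1 + (q + c) ×-dec
             (1 + (q + c) ℕ.≤? 6 ⊎-dec 1 + (q + c) ℕ.≤? 7 ×-dec 4 ℕ.≤? c)) →-dec
            Check.holds? 2 (2 ∷ p ∷ q ∷ c ∷ []) (0 ∷ []) _ _ (adjacentTree p q c)) _) _) _} tt

abstract

  nonadjacentTree-holds : All (λ p → All (λ q → All (λ c → NonadjacentSizes p q c →
              Check.Holds 2 (2 ∷ p ∷ q ∷ c ∷ []) (0 ∷ 1 ∷ []) [] (map edge (1 ∷ [])) (nonadjacentTree p q c))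
            (upTo 7)) (upTo 7)) (upTo 7)
  nonadjacentTree-holds = toWitness
    {a? = All.all? (λ p → All.all? (λ q → All.all? (λ c →
            (low? (p + c) ×-dec low? (q + c) ×-dec 4 ℕ.≤? c ×-dec p ℕ.≤? q) →-dec
            Check.holds? 2 (2 ∷ p ∷ q ∷ c ∷ []) (0 ∷ 1 ∷ []) _ _ (nonadjacentTree p q c)) _) _) _} tt

abstract

  richTree-holds : All (λ p → All (λ q → p ≤ q →
              Check.Holds 3 (3 ∷ 0 ∷ p ∷ 2 ∷ q ∷ 2 ∷ 0 ∷ 2 ∷ []) (1 ∷ 2 ∷ [])
                (map edge (1 ∷ 2 ∷ [])) (map edge (102 ∷ [])) (richTree p q))
            (upTo 2)) (upTo 2)
  richTree-holds = toWitness
    {a? = All.all? (λ p → All.all? (λ q → p ℕ.≤? q →-dec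
            Check.holds? 3 (3 ∷ 0 ∷ p ∷ 2 ∷ q ∷ 2 ∷ 0 ∷ 2 ∷ []) (1 ∷ 2 ∷ []) _ _ (richTree p q)) _) _} tt


-- Degrees and common neighbours in an irreducible graph

module Neighbourhoods {n : ℕ} (G : Graph n) where
  open Graph G

  adj : Fin n → Fin n → Bool
  adj v x = does (v ~? x)

  deg : Fin n → ℕ
  deg v = # (adj v)

  codeg : Fin n → Fin n → ℕ
  codeg v w = # (λ x → adj v x ∧ adj w x)

  adj-true : ∀ {v x} → v ~ x → adj v x ≡ true
  adj-true {v} {x} = dec-true (v ~? x)

  adj-false : ∀ {v x} → ¬ v ~ x → adj v x ≡ false
  adj-false {v} {x} = dec-false (v ~? x)

  adj-loop : ∀ v → adj v v ≡ false
  adj-loop v = adj-false ~-irref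

  adj-sym : ∀ v x → adj v x ≡ adj x v
  adj-sym v x with v ~? x
  ... | yes vx = sym (adj-true (~-sym vx))
  ... | no ¬vx = sym (adj-false (¬vx ∘ ~-sym))

  T-adj⁻ : ∀ {v x} → T (adj v x) → v ~ x
  T-adj⁻ {v} {x} _ with v ~? x
  ... | yes vx = vx

  T-adj⁺ : ∀ {v x} → v ~ x → T (adj v x)
  T-adj⁺ vx rewrite adj-true vx = tt

  T-nonadj⁻ : ∀ {v x} → T (not (adj v x)) → ¬ v ~ x
  T-nonadj⁻ {v} {x} _ with v ~? x
  ... | no ¬vx = ¬vx

  ~⇒≢ : ∀ {v x} → v ~ x → v ≢ x
  ~⇒≢ vx refl = ~-irref vx

  codeg-comm : ∀ v w → codeg v w ≡ codeg w v
  codeg-comm v w = sum-cong-≗ λ x → cong ⟦_⟧ (∧-comm (adj v x) (adj w x))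

  module Pair (v w : Fin n) (v≢w : v ≢ w) where

    open Picture G v (w ∷ []) []

    uniq : Unique named
    uniq = (v≢w ∷ []) ∷ [] ∷ []

    -- In binary, code 1 means adjacent to `v` alone, code 2 to `w` alone and code 3 to both.
    p q c : ℕ
    p = length (part 1)
    q = length (part 2)
    c = length (part 3)

    deg₁ : deg v ≡ ⟦ adj v w ⟧ + (p + c)
    deg₁ = trans (Count.count G v (w ∷ []) [] uniq (adj v) (bit 0) refl
                   (λ x → sym (bit-code {0} {x} z<s)))
                 (trans (cong (λ b → (⟦ b ⟧ + (⟦ adj v w ⟧ + 0)) + (p + (c + 0))) (adj-loop v))
                        (tidy ⟦ adj v w ⟧ p c))
      where
      tidy : ∀ a p c → (a + 0) + (p + (c + 0)) ≡ a + (p + c)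
      tidy = solve-∀

    deg₂ : deg w ≡ ⟦ adj v w ⟧ + (q + c)
    deg₂ = trans (Count.count G v (w ∷ []) [] uniq (adj w) (bit 1) refl
                   (λ x → sym (bit-code {1} {x} (s<s z<s))))
                 (trans (cong₂ (λ a b → (⟦ a ⟧ + (⟦ b ⟧ + 0)) + (q + (c + 0))) (adj-sym w v) (adj-loop w))
                        (tidy ⟦ adj v w ⟧ q c))
      where
      tidy : ∀ a p c → (a + 0) + (p + (c + 0)) ≡ a + (p + c)
      tidy = solve-∀

    codeg≡ : codeg v w ≡ c
    codeg≡ = trans (Count.count G v (w ∷ []) [] uniq
                     (λ x → adj v x ∧ adj w x) (λ k → bit 0 k ∧ bit 1 k) refl
                     (λ x → sym (cong₂ _∧_ (bit-code {0} {x} z<s) (bit-code {1} {x} (s<s z<s)))))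
                   (trans (cong₂ (λ a b → (⟦ a ∧ adj w v ⟧ + (⟦ adj v w ∧ b ⟧ + 0)) + (c + 0))
                                 (adj-loop v) (adj-loop w))
                     (trans (cong (λ b → (⟦ b ⟧ + 0) + (c + 0)) (∧-zeroʳ (adj v w))) (ℕ.+-identityʳ c)))

  deg-positive : ∀ {v x} → v ~ x → 1 ≤ deg v
  deg-positive {v} {x} vx = subst (1 ≤_) (length-filter-allFin (v ~?_))
    (∈-length (∈-filter⁺ (v ~?_) (∈-allFin x) vx))

  module Reducibility (irr : Irreducible G) where

    5≤deg : ∀ {v} → 1 ≤ deg v → 5 ≤ deg v
    5≤deg {v} 1≤d = ℕ.≮⇒≥ λ d<5 →
      sound ([] ∷ []) irr (1 ∷ k ∷ []) [] (refl ∷ refl ∷ []) [] (degreeTree k)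
        (All.lookup degreeTree-holds (small (subst (1 ≤_) deg≡ 1≤d) (subst (ℕ._< 5) deg≡ d<5))) [] []
      where
      open Picture G v [] []
      k = length (part 1)
      deg≡ : deg v ≡ k
      deg≡ = trans (Count.count G v [] [] ([] ∷ []) (adj v) (bit 0) refl
                     (λ x → sym (bit-code {0} {x} z<s)))
                   (trans (cong (λ b → (⟦ b ⟧ + 0) + (k + 0)) (adj-loop v)) (ℕ.+-identityʳ k))
      small : ∀ {k} → 1 ≤ k → k ℕ.< 5 → k ∈ 1 ∷ 2 ∷ 3 ∷ 4 ∷ []
      small {1} _ _ = here refl
      small {2} _ _ = there (here refl)
      small {3} _ _ = there (there (here refl))
      small {4} _ _ = there (there (there (here refl)))
      small {suc (suc (suc (suc (suc _))))} _ (s<s (s<s (s<s (s<s (s<s ())))))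

    matched : ∀ {w} → Low (deg w) → MatchedNonadjacency G w
    matched {w} (5≤d , d≤6) {x} {y} {z} wx wy wz x≢y x≢z y≢z ¬xy ¬xz =
      sound uniq irr (4 ∷ k ∷ []) [] (refl ∷ refl ∷ []) [] (sharedTree k)
        (All.lookup sharedTree-holds (small (subst (5 ≤_) deg≡ 5≤d) (subst (_≤ 6) deg≡ d≤6)))
        (wx ∷ wy ∷ wz ∷ []) (¬xy ∷ ¬xz ∷ [])
      where
      open Picture G w [] (x ∷ y ∷ z ∷ [])
      uniq : Unique named
      uniq = (~⇒≢ wx ∷ ~⇒≢ wy ∷ ~⇒≢ wz ∷ []) ∷ (x≢y ∷ x≢z ∷ []) ∷ (y≢z ∷ []) ∷ [] ∷ []
      k = length (part 1)
      deg≡ : deg w ≡ 3 + k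
      deg≡ = trans (Count.count G w [] _ uniq (adj w) (bit 0) refl (λ x → sym (bit-code {0} {x} z<s)))
        count-named
        where
        count-named : (⟦ adj w w ⟧ + (⟦ adj w x ⟧ + (⟦ adj w y ⟧ + (⟦ adj w z ⟧ + 0)))) + (k + 0) ≡ 3 + k
        count-named rewrite adj-loop w | adj-true wx | adj-true wy | adj-true wz =
          cong (3 +_) (ℕ.+-identityʳ k)
      small : ∀ {k} → 5 ≤ 3 + k → 3 + k ≤ 6 → k ∈ 2 ∷ 3 ∷ []
      small {0} (s≤s (s≤s (s≤s ()))) _
      small {1} (s≤s (s≤s (s≤s (s≤s ())))) _
      small {2} _ _ = here refl
      small {3} _ _ = there (here refl)
      small {suc (suc (suc (suc _)))} _ (s≤s (s≤s (s≤s (s≤s (s≤s (s≤s ()))))))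

    no-two-nonadjacencies : ∀ {w x y z t} → deg w ≡ 5 → w ~ x → w ~ y → w ~ z → w ~ t →
                            x ≢ y → x ≢ z → x ≢ t → y ≢ z → y ≢ t → z ≢ t →
                            ¬ x ~ y → ¬ z ~ t → ⊥
    no-two-nonadjacencies {w} {x} {y} {z} {t} d≡5 wx wy wz wt x≢y x≢z x≢t y≢z y≢t z≢t ¬xy ¬zt =
      sound uniq irr (5 ∷ 1 ∷ []) (0 ∷ []) (refl ∷ k≡1 ∷ [])
        (matched (ℕ.≤-reflexive (sym d≡5) , ℕ.≤-trans (ℕ.≤-reflexive d≡5) (ℕ.n≤1+n 5)) ∷ []) disjointTree
        disjointTree-holds (wx ∷ wy ∷ wz ∷ wt ∷ []) (¬xy ∷ ¬zt ∷ [])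
      where
      open Picture G w [] (x ∷ y ∷ z ∷ t ∷ [])
      uniq : Unique named
      uniq = (~⇒≢ wx ∷ ~⇒≢ wy ∷ ~⇒≢ wz ∷ ~⇒≢ wt ∷ []) ∷ (x≢y ∷ x≢z ∷ x≢t ∷ []) ∷ (y≢z ∷ y≢t ∷ []) ∷
             (z≢t ∷ []) ∷ [] ∷ []
      k = length (part 1)
      count-named :
        (⟦ adj w w ⟧ + (⟦ adj w x ⟧ + (⟦ adj w y ⟧ + (⟦ adj w z ⟧ + (⟦ adj w t ⟧ + 0))))) + (k + 0) ≡
        4 + k
      count-named rewrite adj-loop w | adj-true wx | adj-true wy | adj-true wz | adj-true wt =
        cong (4 +_) (ℕ.+-identityʳ k)
      k≡1 : k ≡ 1
      k≡1 = ℕ.+-cancelˡ-≡ 4 k 1 (trans (sym (trans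
        (Count.count G w [] _ uniq (adj w) (bit 0) refl (λ x → sym (bit-code {0} {x} z<s)))
        count-named)) d≡5)

    private
      ∧⁻ : ∀ {a b} → T (a ∧ b) → T a × T b
      ∧⁻ = Equivalence.to T-∧

    -- Among the neighbours of `w`, the vertex `u` misses itself and, by `matched`, at most one
    -- other.
    deg≤codeg+2 : ∀ {w u} → Low (deg w) → w ~ u → deg w ≤ codeg w u + 2
    deg≤codeg+2 {w} {u} low wu = subst (_≤ codeg w u + 2) (sym (#-split (adj w) (adj u)))
      (ℕ.+-monoʳ-≤ (codeg w u) (ℕ.≮⇒≥ λ 2<nonadj →
        let y , Ty , y∉ = ∃-beyond missed (u ∷ []) (ℕ.<-trans (s<s z<s) 2<nonadj)
            z , Tz , z∉ = ∃-beyond missed (u ∷ y ∷ []) 2<nonadj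
            wy , uy = ∧⁻ Ty
            wz , uz = ∧⁻ Tz
        in matched low wu (T-adj⁻ wy) (T-adj⁻ wz)
             (λ u≡y → y∉ (here (sym u≡y))) (λ u≡z → z∉ (here (sym u≡z)))
             (λ y≡z → z∉ (there (here (sym y≡z))))
             (T-nonadj⁻ uy) (T-nonadj⁻ uz)))
      where
      missed : Fin n → Bool
      missed x = adj w x ∧ not (adj u x)

    -- The first alternative keeps low vertices apart, the second keeps vertices of degree 7 from
    -- paying. As `u` has a neighbour, its degree is at least 5, and finitely many sizes remain for
    -- the certificates.
    neighbour-deg : ∀ {w u} → Low (deg w) → w ~ u →
                    ¬ (deg u ≤ 6 ⊎ deg u ≤ 7 × 4 ≤ codeg w u)
    neighbour-deg {w} {u} low wu small =
      sound uniq irr (2 ∷ p ∷ q ∷ c ∷ []) (0 ∷ []) (refl ∷ refl ∷ refl ∷ refl ∷ []) (matched low ∷ [])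
        (adjacentTree p q c)
        (All.lookup (All.lookup (All.lookup adjacentTree-holds (∈-upTo⁺ p<6)) (∈-upTo⁺ q<7)) (∈-upTo⁺ c<6)
          (low′ , subst₂ (λ d k → d ≤ k + 2) d₁ codeg≡ (deg≤codeg+2 low wu) ,
           subst (5 ≤_) d₂ (5≤deg (deg-positive (~-sym wu))) ,
           small′))
        (wu ∷ []) []
      where
      open Pair w u (~⇒≢ wu)
      open Picture G w (u ∷ []) []
      d₁ : deg w ≡ 1 + (p + c)
      d₁ = trans deg₁ (cong (λ b → ⟦ b ⟧ + (p + c)) (adj-true wu))
      d₂ : deg u ≡ 1 + (q + c)
      d₂ = trans deg₂ (cong (λ b → ⟦ b ⟧ + (q + c)) (adj-true wu))
      low′ : Low (1 + (p + c))
      low′ = subst Low d₁ low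
      p<6 : p ℕ.< 6
      p<6 = ℕ.≤-trans (s≤s (ℕ.m≤m+n p c)) (proj₂ low′)
      c<6 : c ℕ.< 6
      c<6 = ℕ.≤-trans (s≤s (ℕ.m≤n+m c p)) (proj₂ low′)
      small′ : 1 + (q + c) ≤ 6 ⊎ 1 + (q + c) ≤ 7 × 4 ≤ c
      small′ = Sum.map (subst (_≤ 6) d₂) (λ (l , m) → subst (_≤ 7) d₂ l , subst (4 ≤_) codeg≡ m) small
      q<7 : q ℕ.< 7
      q<7 = ℕ.≤-trans (s≤s (ℕ.m≤m+n q c)) ([ ℕ.m≤n⇒m≤1+n , proj₁ ]′ small′)

    nonadjacent-low : ∀ {v w} → Low (deg v) → Low (deg w) → ¬ v ~ w
    nonadjacent-low low-v (_ , d≤6) vw = neighbour-deg low-v vw (inj₁ d≤6)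

    private
      codeg-ordered : ∀ {v w} → Low (deg v) → Low (deg w) → v ≢ w → deg v ≤ deg w → codeg v w ≤ 3
      codeg-ordered {v} {w} low-v low-w v≢w d≤ = ℕ.≮⇒≥ λ 3<c →
        sound uniq irr (2 ∷ p ∷ q ∷ c ∷ []) (0 ∷ 1 ∷ []) (refl ∷ refl ∷ refl ∷ refl ∷ [])
          (matched low-v ∷ matched low-w ∷ []) (nonadjacentTree p q c)
          (All.lookup (All.lookup (All.lookup nonadjacentTree-holds
             (∈-upTo⁺ (s≤s (ℕ.m+n≤o⇒m≤o p (proj₂ low-p)))))
             (∈-upTo⁺ (s≤s (ℕ.m+n≤o⇒m≤o q (proj₂ low-q)))))
             (∈-upTo⁺ (s≤s (ℕ.m+n≤o⇒n≤o p (proj₂ low-p))))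
             (low-p , low-q , subst (4 ≤_) codeg≡ 3<c ,
              ℕ.+-cancelʳ-≤ c p q (subst₂ _≤_ d₁ d₂ d≤)))
          [] (nonadjacent-low low-v low-w ∷ [])
        where
        open Pair v w v≢w
        open Picture G v (w ∷ []) []
        ¬vw : adj v w ≡ false
        ¬vw = adj-false (nonadjacent-low low-v low-w)
        d₁ : deg v ≡ p + c
        d₁ = trans deg₁ (cong (λ b → ⟦ b ⟧ + (p + c)) ¬vw)
        d₂ : deg w ≡ q + c
        d₂ = trans deg₂ (cong (λ b → ⟦ b ⟧ + (q + c)) ¬vw)
        low-p = subst Low d₁ low-v
        low-q = subst Low d₂ low-w

    codeg-low : ∀ {v w} → Low (deg v) → Low (deg w) → v ≢ w → codeg v w ≤ 3
    codeg-low {v} {w} low-v low-w v≢w with ℕ.≤-total (deg v) (deg w)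
    ... | inj₁ d≤ = codeg-ordered low-v low-w v≢w d≤
    ... | inj₂ d≥ = subst (_≤ 3) (codeg-comm w v) (codeg-ordered low-w low-v (v≢w ∘ sym) d≥)


-- Discharging

-- C = c₃ + c₅ + c₇ ≥ 8 ∸ c₇ ≥ 6, so the hypothesis c₁ + 3 C ≤ 18 leaves one solution.
tight-sizes : ∀ c₁ c₃ c₅ c₆ c₇ → 4 ≤ c₃ + c₇ → 4 ≤ c₅ + c₇ → c₆ + c₇ ≤ 2 →
              3 * (2 + (c₁ + (c₃ + (c₅ + c₇)))) ℕ.< 21 + 2 * (2 + c₁) →
              c₁ ≡ 0 × c₃ ≡ 2 × c₅ ≡ 2 × c₆ ≡ 0 × c₇ ≡ 2
tight-sizes c₁ c₃ c₅ c₆ c₇ 4≤₃ 4≤₅ ≤2 bound with ℕ.m+n≤o⇒n≤o c₆ ≤2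
tight-sizes c₁ c₃ c₅ c₆ 0 4≤₃ 4≤₅ ≤2 bound | _
  with a , refl ← ℕ.m≤n⇒∃[o]m+o≡n (subst (4 ≤_) (ℕ.+-identityʳ c₃) 4≤₃)
     | b , refl ← ℕ.m≤n⇒∃[o]m+o≡n (subst (4 ≤_) (ℕ.+-identityʳ c₅) 4≤₅) =
  -- `expand` writes the left side of `bound` as its strict upper bound plus an excess, which is
  -- absurd.
  contradiction (ℕ.≤-trans (ℕ.m≤m+n _ _) (ℕ.≤-reflexive (sym (expand c₁ a b)))) (ℕ.<⇒≱ bound)
  where
  expand : ∀ c a b → 3 * (2 + (c + (4 + a + (4 + b + 0)))) ≡ 21 + 2 * (2 + c) + (5 + c + 3 * (a + b))
  expand = solve-∀
tight-sizes c₁ c₃ c₅ c₆ 1 4≤₃ 4≤₅ ≤2 bound | _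
  with a , refl ← ℕ.m≤n⇒∃[o]m+o≡n (ℕ.+-cancelʳ-≤ 1 3 c₃ 4≤₃)
     | b , refl ← ℕ.m≤n⇒∃[o]m+o≡n (ℕ.+-cancelʳ-≤ 1 3 c₅ 4≤₅) =
  contradiction (ℕ.≤-trans (ℕ.m≤m+n _ _) (ℕ.≤-reflexive (sym (expand c₁ a b)))) (ℕ.<⇒≱ bound)
  where
  expand : ∀ c a b → 3 * (2 + (c + (3 + a + (3 + b + 1)))) ≡ 21 + 2 * (2 + c) + (2 + c + 3 * (a + b))
  expand = solve-∀
tight-sizes c₁ c₃ c₅ c₆ 2 4≤₃ 4≤₅ ≤2 bound | _
  with a , refl ← ℕ.m≤n⇒∃[o]m+o≡n (ℕ.+-cancelʳ-≤ 2 2 c₃ 4≤₃)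
     | b , refl ← ℕ.m≤n⇒∃[o]m+o≡n (ℕ.+-cancelʳ-≤ 2 2 c₅ 4≤₅) =
  ℕ.m+n≡0⇒m≡0 c₁ slack , cong (2 +_) (ℕ.m+n≡0⇒m≡0 a a+b≡0) , cong (2 +_) (ℕ.m+n≡0⇒n≡0 a a+b≡0) ,
  ℕ.n≤0⇒n≡0 (ℕ.+-cancelʳ-≤ 2 c₆ 0 ≤2) , refl
  where
  -- The `suc` absorbs the strictness of `bound`, so the remainder on the right is at most 0 and all
  -- its variables vanish.
  expand : ∀ c a b → suc (3 * (2 + (c + (2 + a + (2 + b + 2))))) ≡ 21 + 2 * (2 + c) + (c + 3 * (a + b))
  expand = solve-∀
  slack : c₁ + 3 * (a + b) ≡ 0
  slack = ℕ.n≤0⇒n≡0 (ℕ.+-cancelˡ-≤ (21 + 2 * (2 + c₁)) _ 0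
    (subst₂ _≤_ (expand c₁ a b) (sym (ℕ.+-identityʳ _)) bound))
  a+b≡0 : a + b ≡ 0
  a+b≡0 = ℕ.m+n≡0⇒m≡0 (a + b) (ℕ.m+n≡0⇒n≡0 c₁ slack)
tight-sizes c₁ c₃ c₅ c₆ (suc (suc (suc c₇))) 4≤₃ 4≤₅ ≤2 bound | s≤s (s≤s ())

cong₃ : ∀ {a b c a′ b′ c′ : Bool} (f : Bool → Bool → Bool → ℕ) →
        a ≡ a′ → b ≡ b′ → c ≡ c′ → f a b c ≡ f a′ b′ c′
cong₃ f refl refl refl = refl

∧-falseˡ : ∀ {a} → a ≡ false → ∀ b → a ∧ b ≡ false
∧-falseˡ refl _ = refl

∧-falseʳ : ∀ a {b} → b ≡ false → a ∧ b ≡ false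
∧-falseʳ a refl = ∧-zeroʳ a

module Discharging {n : ℕ} (G : Graph n) (irr : Irreducible G) where
  open Graph G
  open Neighbourhoods G
  open Reducibility irr

  ∧⁻ : ∀ {a b} → T (a ∧ b) → T a × T b
  ∧⁻ = Equivalence.to T-∧

  T-does : {P : Set} (P? : Dec P) → T (does P?) → P
  T-does (yes p) _ = p

  T-not-does : {P : Set} (P? : Dec P) → T (not (does P?)) → ¬ P
  T-not-does (no ¬p) _ = ¬p

  close : Fin n → Fin n → Bool
  close w u = does (4 ℕ.≤? codeg w u)

  -- The recipient comes first: `u` pays the low vertex `w`.
  pays : Fin n → Fin n → Bool
  pays w u = does (low? (deg w)) ∧ (adj w u ∧ close w u)

  -- Numbers of payments, each worth 2/3. In `charge` everything is multiplied by 3.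
  paid received : Fin n → ℕ
  received w = # (pays w)
  paid u     = # (λ w → pays w u)

  pays⁻ : ∀ {w u} → T (pays w u) → Low (deg w) × w ~ u × 4 ≤ codeg w u
  pays⁻ {w} {u} t = let l , t′ = ∧⁻ t ; a , c = ∧⁻ t′ in
    T-does (low? (deg w)) l , T-adj⁻ a , T-does (4 ℕ.≤? codeg w u) c

  -- With at most two payers, `w` has three neighbours sharing at most three neighbours with it. One
  -- such neighbour `x` caps the degree at 5 by `deg≤codeg+2`, and it misses another neighbour `y`.
  -- A third such neighbour `z`, other than `x` and `y`, misses some `t`. Since nonadjacency is a
  -- matching, the pairs `x`, `y` and `z`, `t` are disjoint, which degree 5 forbids.
  received-≥ : ∀ {w} → Low (deg w) → 3 ≤ received w
  received-≥ {w} low@(5≤d , d≤6) = ℕ.≮⇒≥ impossible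
    where
    far : Fin n → Bool
    far u = adj w u ∧ not (close w u)

    far⁻ : ∀ {u} → T (far u) → w ~ u × codeg w u ≤ 3
    far⁻ {u} t = let a , c = ∧⁻ t in T-adj⁻ a , ℕ.≮⇒≥ (T-not-does (4 ℕ.≤? codeg w u) c)

    received≡ : received w ≡ # (λ u → adj w u ∧ close w u)
    received≡ = cong (λ b → # (λ u → b ∧ (adj w u ∧ close w u))) (dec-true (low? (deg w)) low)

    many-far : received w ℕ.< 3 → 3 ≤ # far
    many-far few = ℕ.+-cancelˡ-≤ 2 3 (# far) (ℕ.≤-trans 5≤d
      (ℕ.≤-trans (ℕ.≤-reflexive (trans (#-split (adj w) (close w)) (cong (_+ # far) (sym received≡))))
                 (ℕ.+-monoˡ-≤ (# far) (ℕ.≤-pred few))))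

    -- The count includes `x` itself, so two are needed to find a genuine nonneighbour.
    missing : ∀ {x} → w ~ x → codeg w x ≤ 3 → 1 ℕ.< # (λ t → adj w t ∧ not (adj x t))
    missing {x} wx c≤3 = ℕ.+-cancelˡ-≤ 3 2 _ (ℕ.≤-trans 5≤d
      (ℕ.≤-trans (ℕ.≤-reflexive (#-split (adj w) (adj x))) (ℕ.+-monoˡ-≤ _ c≤3)))

    missing⁻ : ∀ {x t} → T (adj w t ∧ not (adj x t)) → w ~ t × ¬ x ~ t
    missing⁻ {x} m = let a , b = ∧⁻ m in T-adj⁻ a , T-nonadj⁻ b

    impossible : ¬ received w ℕ.< 3
    impossible few
      with x , Tx , _  ← ∃-beyond far [] (ℕ.<-≤-trans z<s (many-far few))
      with wx , cx     ← far⁻ Tx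
      with y , Ty , y∉ ← ∃-beyond (λ t → adj w t ∧ not (adj x t)) (x ∷ []) (missing wx cx)
      with wy , ¬xy    ← missing⁻ {x} Ty
      with z , Tz , z∉ ← ∃-beyond far (x ∷ y ∷ []) (many-far few)
      with wz , cz     ← far⁻ Tz
      with t , Tt , t∉ ← ∃-beyond (λ t → adj w t ∧ not (adj z t)) (z ∷ []) (missing wz cz)
      with wt , ¬zt    ← missing⁻ {z} Tt
      = no-two-nonadjacencies d≡5 wx wy wz wt x≢y x≢z
          (λ x≡t → matched low wx wy wz x≢y x≢z y≢z ¬xy λ xz → ¬zt (subst (z ~_) x≡t (~-sym xz)))
          y≢z
          (λ y≡t → matched low wy wx wz (x≢y ∘ sym) y≢z x≢z (¬xy ∘ ~-sym)
            λ yz → ¬zt (subst (z ~_) y≡t (~-sym yz)))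
          (λ z≡t → t∉ (here (sym z≡t))) ¬xy ¬zt
      where
      d≡5 : deg w ≡ 5
      d≡5 = ℕ.≤-antisym (ℕ.≤-trans (deg≤codeg+2 low wx) (ℕ.+-monoˡ-≤ 2 cx)) 5≤d
      x≢y : x ≢ y
      x≢y x≡y = y∉ (here (sym x≡y))
      x≢z : x ≢ z
      x≢z x≡z = z∉ (here (sym x≡z))
      y≢z : y ≢ z
      y≢z y≡z = z∉ (there (here (sym y≡z)))

  module Rich (v w₁ w₂ : Fin n) (p₁ : T (pays w₁ v)) (p₂ : T (pays w₂ v)) (w₁≢w₂ : w₁ ≢ w₂) where

    open Picture G v (w₁ ∷ w₂ ∷ []) []

    low₁ = proj₁ (pays⁻ p₁)
    low₂ = proj₁ (pays⁻ p₂)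
    w₁v  = proj₁ (proj₂ (pays⁻ p₁))
    w₂v  = proj₁ (proj₂ (pays⁻ p₂))

    ¬w₁w₂ : ¬ w₁ ~ w₂
    ¬w₁w₂ = nonadjacent-low low₁ low₂

    uniq : Unique named
    uniq = (~⇒≢ (~-sym w₁v) ∷ ~⇒≢ (~-sym w₂v) ∷ []) ∷ (w₁≢w₂ ∷ []) ∷ [] ∷ []

    -- The binary digits of `k`, from the lowest, record adjacency to `v`, `w₁` and `w₂`.
    c : ℕ → ℕ
    c k = length (part k)

    bits₀ : ∀ x → adj v x ≡ bit 0 (code x)
    bits₀ x = sym (bit-code {0} {x} z<s)

    bits₁ : ∀ x → adj w₁ x ≡ bit 1 (code x)
    bits₁ x = sym (bit-code {1} {x} (s<s z<s))

    bits₂ : ∀ x → adj w₂ x ≡ bit 2 (code x)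
    bits₂ x = sym (bit-code {2} {x} (s<s (s<s z<s)))

    open Count G v (w₁ ∷ w₂ ∷ []) [] uniq

    tidy₂ : ∀ a b → a + (b + 0) ≡ a + b
    tidy₂ = solve-∀

    tidy₄ : ∀ a b c d → a + (b + (c + (d + 0))) ≡ a + (b + (c + d))
    tidy₄ = solve-∀

    deg₀ : deg v ≡ 2 + (c 1 + (c 3 + (c 5 + (c 7))))
    deg₀ = trans (count (adj v) (bit 0) refl bits₀)
      (trans (cong₃ (λ x y z → ⟦ x ⟧ + (⟦ y ⟧ + (⟦ z ⟧ + 0)) + (c 1 + (c 3 + (c 5 + (c 7 + 0)))))
               (adj-loop v)
               (adj-true (~-sym w₁v))
               (adj-true (~-sym w₂v)))
             (cong (2 +_) (tidy₄ (c 1) (c 3) (c 5) (c 7))))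

    deg₁ : deg w₁ ≡ 1 + (c 2 + (c 3 + (c 6 + (c 7))))
    deg₁ = trans (count (adj w₁) (bit 1) refl bits₁)
      (trans (cong₃ (λ x y z → ⟦ x ⟧ + (⟦ y ⟧ + (⟦ z ⟧ + 0)) + (c 2 + (c 3 + (c 6 + (c 7 + 0)))))
               (adj-true w₁v)
               (adj-loop w₁)
               (adj-false ¬w₁w₂))
             (cong suc (tidy₄ (c 2) (c 3) (c 6) (c 7))))

    deg₂ : deg w₂ ≡ 1 + (c 4 + (c 5 + (c 6 + (c 7))))
    deg₂ = trans (count (adj w₂) (bit 2) refl bits₂)
      (trans (cong₃ (λ x y z → ⟦ x ⟧ + (⟦ y ⟧ + (⟦ z ⟧ + 0)) + (c 4 + (c 5 + (c 6 + (c 7 + 0)))))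
               (adj-true w₂v)
               (adj-false (¬w₁w₂ ∘ ~-sym))
               (adj-loop w₂))
             (cong suc (tidy₄ (c 4) (c 5) (c 6) (c 7))))

    codeg₁ : codeg w₁ v ≡ c 3 + c 7
    codeg₁ = trans (count (λ x → adj w₁ x ∧ adj v x) (λ k → bit 1 k ∧ bit 0 k) refl
        (λ x → cong₂ _∧_ (bits₁ x) (bits₀ x)))
      (trans (cong₃ (λ x y z → ⟦ x ⟧ + (⟦ y ⟧ + (⟦ z ⟧ + 0)) + (c 3 + (c 7 + 0)))
               (∧-falseʳ (adj w₁ v) (adj-loop v))
               (∧-falseˡ (adj-loop w₁) (adj v w₁))
               (∧-falseˡ (adj-false ¬w₁w₂) (adj v w₂)))
             (tidy₂ (c 3) (c 7)))

    codeg₂ : codeg w₂ v ≡ c 5 + c 7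
    codeg₂ = trans (count (λ x → adj w₂ x ∧ adj v x) (λ k → bit 2 k ∧ bit 0 k) refl
        (λ x → cong₂ _∧_ (bits₂ x) (bits₀ x)))
      (trans (cong₃ (λ x y z → ⟦ x ⟧ + (⟦ y ⟧ + (⟦ z ⟧ + 0)) + (c 5 + (c 7 + 0)))
               (∧-falseʳ (adj w₂ v) (adj-loop v))
               (∧-falseˡ (adj-false (¬w₁w₂ ∘ ~-sym)) (adj v w₁))
               (∧-falseˡ (adj-loop w₂) (adj v w₂)))
             (tidy₂ (c 5) (c 7)))

    codeg₁₂ : codeg w₁ w₂ ≡ 1 + (c 6 + c 7)
    codeg₁₂ = trans (count (λ x → adj w₁ x ∧ adj w₂ x) (λ k → bit 1 k ∧ bit 2 k) refl
        (λ x → cong₂ _∧_ (bits₁ x) (bits₂ x)))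
      (trans (cong₃ (λ x y z → ⟦ x ⟧ + (⟦ y ⟧ + (⟦ z ⟧ + 0)) + (c 6 + (c 7 + 0)))
               (cong₂ _∧_ (adj-true w₁v) (adj-true w₂v))
               (∧-falseˡ (adj-loop w₁) (adj w₂ w₁))
               (∧-falseˡ (adj-false ¬w₁w₂) (adj w₂ w₂)))
             (cong suc (tidy₂ (c 6) (c 7))))

    -- A further recipient is low, hence nonadjacent to `w₁` and `w₂`. Its only closed neighbour is
    -- `v`, which puts it into class 1.
    paid-≤ : paid v ≤ 2 + c 1
    paid-≤ = #-≤-length (λ w → pays w v) (w₁ ∷ w₂ ∷ part 1) λ {w} p → elsewhere w p
      where
      elsewhere : ∀ w → T (pays w v) → w ∈ w₁ ∷ w₂ ∷ part 1
      elsewhere w p with w Fin.≟ w₁ | w Fin.≟ w₂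
      ... | yes w≡ | _      = here w≡
      ... | no _   | yes w≡ = there (here w≡)
      ... | no w≢₁ | no w≢₂ = there (there (∈-filter⁺ (λ x → class x ℕ.≟ 1) (∈-allFin w)
              (trans (unnamed-class w∉) code≡1)))
        where
        low = proj₁ (pays⁻ p)
        wv  = proj₁ (proj₂ (pays⁻ p))
        w∉ : w ∉ named
        w∉ (here refl)                 = ~-irref wv
        w∉ (there (here w≡))           = w≢₁ w≡
        w∉ (there (there (here w≡)))   = w≢₂ w≡
        code≡1 : code w ≡ 1
        code≡1 = cong₃ (λ x y z → fromBits (x ∷ y ∷ z ∷ [])) (adj-true (~-sym wv))
          (adj-false (nonadjacent-low low₁ low)) (adj-false (nonadjacent-low low₂ low))

    tight : 3 * deg v ℕ.< 21 + 2 * paid v → c 1 ≡ 0 × c 3 ≡ 2 × c 5 ≡ 2 × c 6 ≡ 0 × c 7 ≡ 2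
    tight short = tight-sizes (c 1) (c 3) (c 5) (c 6) (c 7)
      (subst (4 ≤_) codeg₁ (proj₂ (proj₂ (pays⁻ p₁))))
      (subst (4 ≤_) codeg₂ (proj₂ (proj₂ (pays⁻ p₂))))
      -- One of the at most three common neighbours of `w₁` and `w₂` is `v`, which leaves two for
      -- classes 6 and 7.
      (ℕ.≤-pred (subst (_≤ 3) codeg₁₂ (codeg-low low₁ low₂ w₁≢w₂)))
      (ℕ.<-≤-trans (subst (λ d → 3 * d ℕ.< 21 + 2 * paid v) deg₀ short)
        (ℕ.+-monoʳ-≤ 21 (ℕ.*-monoʳ-≤ 2 paid-≤)))

    not-tight : deg w₁ ≤ deg w₂ → ¬ (c 1 ≡ 0 × c 3 ≡ 2 × c 5 ≡ 2 × c 6 ≡ 0 × c 7 ≡ 2)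
    not-tight d₁≤d₂ (c₁ , c₃ , c₅ , c₆ , c₇) =
      sound uniq irr (3 ∷ 0 ∷ c 2 ∷ 2 ∷ c 4 ∷ 2 ∷ 0 ∷ 2 ∷ []) (1 ∷ 2 ∷ [])
        (refl ∷ c₁ ∷ refl ∷ c₃ ∷ refl ∷ c₅ ∷ c₆ ∷ c₇ ∷ [])
        (matched low₁ ∷ matched low₂ ∷ []) (richTree (c 2) (c 4))
        (All.lookup (All.lookup richTree-holds
            (∈-upTo⁺ (s≤s (ℕ.+-cancelʳ-≤ 5 (c 2) 1 (subst (_≤ 6) d₁≡ (proj₂ low₁))))))
          (∈-upTo⁺ (s≤s (ℕ.+-cancelʳ-≤ 5 (c 4) 1 (subst (_≤ 6) d₂≡ (proj₂ low₂)))))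
          (ℕ.+-cancelʳ-≤ 5 (c 2) (c 4) (subst₂ _≤_ d₁≡ d₂≡ d₁≤d₂)))
        (~-sym w₁v ∷ ~-sym w₂v ∷ []) (¬w₁w₂ ∷ [])
      where
      d₁≡ : deg w₁ ≡ c 2 + 5
      d₁≡ = trans deg₁ (trans (cong (λ k → 1 + (c 2 + k)) (cong₂ _+_ c₃ (cong₂ _+_ c₆ c₇)))
                              (sym (ℕ.+-suc (c 2) 4)))
      d₂≡ : deg w₂ ≡ c 4 + 5
      d₂≡ = trans deg₂ (trans (cong (λ k → 1 + (c 4 + k)) (cong₂ _+_ c₅ (cong₂ _+_ c₆ c₇)))
                              (sym (ℕ.+-suc (c 4) 4)))

    enough : deg w₁ ≤ deg w₂ → 21 + 2 * paid v ≤ 3 * deg v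
    enough d₁≤d₂ = ℕ.≮⇒≥ (not-tight d₁≤d₂ ∘ tight)

  -- Three times the statement that `v` ends with at least 7: a payment of 2/3 becomes 2, and 7
  -- becomes 21.
  charge : ∀ v → 1 ≤ deg v → 21 + 2 * paid v ≤ 3 * deg v + 2 * received v
  charge v 1≤d with deg v ℕ.≤? 6 | deg v ℕ.≤? 7
  ... | yes d≤6 | _ = subst (λ k → 21 + 2 * k ≤ 3 * deg v + 2 * received v) (sym unpaid)
        -- Degree 5 with three payments received is tight: 15 + 6 = 21.
        (ℕ.+-mono-≤ {15} (ℕ.*-monoʳ-≤ 3 5≤d) (ℕ.*-monoʳ-≤ 2 (received-≥ (5≤d , d≤6))))
    where
    5≤d = 5≤deg 1≤d
    unpaid : paid v ≡ 0
    unpaid = ℕ.n≤0⇒n≡0 (#-≤-length (λ w → pays w v) [] λ p →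
      let low , wv , _ = pays⁻ p in ⊥-elim (neighbour-deg low wv (inj₁ d≤6)))
  ... | no d≰6 | yes d≤7 = subst (λ k → 21 + 2 * k ≤ 3 * deg v + 2 * received v) (sym unpaid)
        (ℕ.≤-trans (ℕ.*-monoʳ-≤ 3 (ℕ.≰⇒> d≰6)) (ℕ.m≤m+n _ _))
    where
    unpaid : paid v ≡ 0
    unpaid = ℕ.n≤0⇒n≡0 (#-≤-length (λ w → pays w v) [] λ p →
      let low , wv , 4≤c = pays⁻ p in ⊥-elim (neighbour-deg low wv (inj₂ (d≤7 , 4≤c))))
  ... | no _ | no d≰7 with paid v ℕ.≤? 1
  ...   | yes ≤1 = ℕ.≤-trans (ℕ.+-monoʳ-≤ 21 (ℕ.*-monoʳ-≤ 2 ≤1))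
          -- A single payment is affordable from degree 8 on: 21 + 2 is less than 24.
          (ℕ.≤-trans (ℕ.n≤1+n 23) (ℕ.≤-trans (ℕ.*-monoʳ-≤ 3 (ℕ.≰⇒> d≰7)) (ℕ.m≤m+n _ _)))
  ...   | no ≰1 = ℕ.≤-trans rich (ℕ.m≤m+n _ _)
    where
    rich : 21 + 2 * paid v ≤ 3 * deg v
    rich with w₁ , p₁ , _   ← ∃-beyond (λ w → pays w v) [] (ℕ.<-trans z<s (ℕ.≰⇒> ≰1))
         with w₂ , p₂ , w₂∉ ← ∃-beyond (λ w → pays w v) (w₁ ∷ []) (ℕ.≰⇒> ≰1)
         with ℕ.≤-total (deg w₁) (deg w₂)
    ... | inj₁ d≤ = Rich.enough v w₁ w₂ p₁ p₂ (λ w₁≡w₂ → w₂∉ (here (sym w₁≡w₂))) d≤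
    ... | inj₂ d≥ = Rich.enough v w₂ w₁ p₂ p₁ (λ w₂≡w₁ → w₂∉ (here w₂≡w₁)) d≥


-- From charges to the average degree

sum-allFin : ∀ {n} (f : Fin n → ℕ) → sum (map f (allFin n)) ≡ ∑ f
sum-allFin {n} f = trans (cong sum (map-tabulate id f)) (sum-tabulate f)
  where
  sum-tabulate : ∀ {n} (f : Fin n → ℕ) → sum (tabulate f) ≡ ∑ f
  sum-tabulate {zero}  f = refl
  sum-tabulate {suc n} f = cong (f Fin.zero +_) (sum-tabulate (f ∘ Fin.suc))

length-filter-map : {A B : Set} {P : Pred B 0ℓ} (P? : Decidable P) (f : A → B) (xs : List A) →
                    length (filter P? (map f xs)) ≡ length (filter (P? ∘ f) xs)
length-filter-map P? f []       = refl
length-filter-map P? f (x ∷ xs) with does (P? (f x))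
... | true  = cong suc (length-filter-map P? f xs)
... | false = length-filter-map P? f xs

length-filter-× : {A B : Set} {P : Pred (A × B) 0ℓ} (P? : Decidable P) (xs : List A) (ys : List B) →
                  length (filter P? (cartesianProduct xs ys)) ≡
                  sum (map (λ x → length (filter (λ y → P? (x , y)) ys)) xs)
length-filter-× P? []       ys = refl
length-filter-× P? (x ∷ xs) ys = begin
  length (filter P? (map (x ,_) ys ++ cartesianProduct xs ys))
    ≡⟨ cong length (filter-++ P? (map (x ,_) ys) _) ⟩
  length (filter P? (map (x ,_) ys) ++ filter P? (cartesianProduct xs ys))
    ≡⟨ length-++ (filter P? (map (x ,_) ys)) ⟩
  length (filter P? (map (x ,_) ys)) + length (filter P? (cartesianProduct xs ys))
    ≡⟨ cong₂ _+_ (length-filter-map P? (x ,_) ys) (length-filter-× P? xs ys) ⟩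
  sum (map (λ x → length (filter (λ y → P? (x , y)) ys)) (x ∷ xs)) ∎

module _ {n : ℕ} (G : Graph n) where
  open Graph G
  open Neighbourhoods G

  length-edges : length (edges G) ≡ ∑ (λ u → ∑ (λ v → ⟦ does (isEdge? G (u , v)) ⟧))
  length-edges = trans (length-filter-× (isEdge? G) (allFin n) (allFin n))
    (trans (sum-allFin (λ u → length (filter (λ v → isEdge? G (u , v)) (allFin n))))
      (sum-cong-≗ λ u → length-filter-allFin (λ v → isEdge? G (u , v))))

  -- Of the two orientations of an adjacent pair, exactly one is increasing and listed in `edges G`.
  handshake : ∑ deg ≡ 2 * length (edges G)
  handshake = begin
    ∑ (λ u → ∑ (λ v → ⟦ adj u v ⟧))
      ≡⟨ sum-cong-≗ (λ u → trans (sum-cong-≗ (oriented u)) (∑-distrib-+ (e u) _)) ⟩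
    ∑ (λ u → ∑ (e u) + ∑ (λ v → e v u))
      ≡⟨ ∑-distrib-+ (λ u → ∑ (e u)) _ ⟩
    ∑ (λ u → ∑ (e u)) + ∑ (λ u → ∑ (λ v → e v u))
      ≡⟨ cong (∑ (λ u → ∑ (e u)) +_) (∑-comm (λ u v → e v u)) ⟩
    ∑ (λ u → ∑ (e u)) + ∑ (λ u → ∑ (e u))
      ≡⟨ cong₂ _+_ (sym length-edges) (trans (sym length-edges) (sym (ℕ.+-identityʳ _))) ⟩
    2 * length (edges G) ∎
    where
    e : Fin n → Fin n → ℕ
    e u v = ⟦ does (isEdge? G (u , v)) ⟧

    oriented : ∀ u v → ⟦ adj u v ⟧ ≡ e u v + e v u
    oriented u v with Fin.<-cmp u v
    ... | tri< u<v _ v≮u rewrite dec-true (u Fin.<? v) u<v | dec-false (v Fin.<? u) v≮u =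
          sym (ℕ.+-identityʳ _)
    ... | tri≈ u≮v refl _ rewrite dec-false (u Fin.<? u) u≮v = cong ⟦_⟧ (adj-loop u)
    ... | tri> u≮v _ v<u rewrite dec-false (u Fin.<? v) u≮v | dec-true (v Fin.<? u) v<u =
          cong ⟦_⟧ (adj-sym u v)

  nonisolated? : Decidable (λ v → 1 ≤ deg v)
  nonisolated? v = 1 ℕ.≤? deg v

  nonisolated : List (Fin n)
  nonisolated = filter nonisolated? (allFin n)

  -- Summing `charge` over all vertices cancels payments against receipts, which leaves 21 per
  -- nonisolated vertex against three times the degree sum. An isolated vertex pays nothing, so its
  -- inequality is trivial.
  dense : Irreducible G → 7 * length nonisolated ≤ 2 * length (edges G)
  dense irr = ℕ.*-cancelˡ-≤ 3 (subst₂ _≤_ (ℕ.*-assoc 3 7 (length nonisolated)) (cong (3 *_) handshake)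
    (ℕ.+-cancelʳ-≤ (2 * ∑ received) (21 * length nonisolated) (3 * ∑ deg)
      (subst₂ _≤_ left right (∑-mono λ v → pointwise v (nonisolated? v)))))
    where
    open Discharging G irr

    pointwise : ∀ v (nonisolated : Dec (1 ≤ deg v)) →
                21 * ⟦ does nonisolated ⟧ + 2 * paid v ≤ 3 * deg v + 2 * received v
    pointwise v (yes 1≤d) = charge v 1≤d
    pointwise v (no 1≰d)  = subst (λ k → 2 * k ≤ 3 * deg v + 2 * received v)
      (sym (ℕ.n≤0⇒n≡0 (#-≤-length (λ w → pays w v) [] λ p →
        contradiction (deg-positive (~-sym (proj₁ (proj₂ (pays⁻ p))))) 1≰d)))
      z≤n

    ∑-linear : ∀ a b (f g : Fin n → ℕ) → ∑ (λ v → a * f v + b * g v) ≡ a * ∑ f + b * ∑ g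
    ∑-linear a b f g = trans (∑-distrib-+ (λ v → a * f v) _)
      (cong₂ _+_ (sym (*-distribˡ-sum a f)) (sym (*-distribˡ-sum b g)))

    number-nonisolated : # (does ∘ nonisolated?) ≡ length nonisolated
    number-nonisolated = sym (length-filter-allFin nonisolated?)

    balance : ∑ paid ≡ ∑ received
    balance = ∑-comm (λ v w → ⟦ pays w v ⟧)

    left : ∑ (λ v → 21 * ⟦ does (nonisolated? v) ⟧ + 2 * paid v) ≡
           21 * length nonisolated + 2 * ∑ received
    left = trans (∑-linear 21 2 (λ v → ⟦ does (nonisolated? v) ⟧) paid)
      (cong₂ (λ k l → 21 * k + 2 * l) number-nonisolated balance)

    right : ∑ (λ v → 3 * deg v + 2 * received v) ≡ 3 * ∑ deg + 2 * ∑ received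
    right = ∑-linear 3 2 deg received

module _ {n : ℕ} (G : Graph n) (mad<7 : mad G ℚ.< (ℤ.+ 7) ℚ./ 1) where

  sparse : ∀ (S : List⁺ (Fin n)) F → toList S ∈ sublists (allFin n) → F ∈ sublists (edges G) →
           IsSubgraph (S , F) → 2 * length F ℕ.< 7 * List⁺.length S
  sparse S@(s ∷ ss) F S∈ F∈ sub = from-ℚ (ℚ.≤-<-trans
    (All.lookup (Extrema.xs≤max (DecTotalOrder.totalOrder ℚ.≤-decTotalOrder) 0ℚ _)
      (∈-map⁺ averageDegree (∈-filter⁺ isSubgraph?
        (∈-cartesianProduct⁺
          (Any.mapMaybe⁺ List⁺.fromList _ (Any.map⁺ (Any.map (λ { refl → just refl }) S∈))) F∈) sub)))
    mad<7)
    where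
    -- `_/_` reduces to lowest terms. Passing to the unnormalised fraction restores `k` and `suc d`
    -- as numerator and denominator, and the comparison becomes a cross-multiplication.
    from-ℚ : ∀ {k d} → (ℤ.+ k) ℚ./ suc d ℚ.< (ℤ.+ 7) ℚ./ 1 → k ℕ.< 7 * suc d
    from-ℚ {k} {d} lt with *<* q ← ℚᵘ.<-respˡ-≃ (ℚ.toℚᵘ-fromℚᵘ (mkℚᵘ (ℤ.+ k) d)) (ℚ.toℚᵘ-mono-< lt) =
      subst (ℕ._< 7 * suc d) (ℕ.*-identityʳ k)
        (ℤ.drop‿+<+ (subst₂ ℤ._<_ (sym (ℤ.pos-* k 1)) (sym (ℤ.pos-* 7 (suc d))) q))

  private
    -- The invariant of the induction. Every graph reached is tested against the bound for the
    -- original `G`, so `mad` of smaller graphs is never considered.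
    Subgraph : Graph n → Set
    Subgraph H = ∀ {u v} → Graph._~_ H u v → Graph._~_ G u v

    -- If all vertices are isolated, the empty packing and cover suffice. Otherwise the nonisolated
    -- vertices with the edges of `H` form a subgraph of `G` that is too dense by `dense` and too
    -- sparse by `sparse`.
    solvable : ∀ H → Subgraph H → Irreducible H → ¬ ¬ Solution H
    solvable H H⊆G irr none with nonisolated H in eq
    ... | [] = none record
          { packing = [] ; disjoint = [] ; triangle = [] ; cover = [] ; bound = z≤n
          ; covers = λ { u v w ((_ , u~v , _) ∷ _) →
              contradiction (subst (u ∈_) eq (positive u~v)) λ () } }
      where
      positive : ∀ {u v} → Graph._~_ H u v → u ∈ nonisolated H
      positive {u} u~v = ∈-filter⁺ (nonisolated? H) (∈-allFin u) (Neighbourhoods.deg-positive H u~v)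
    ... | s ∷ ss = ℕ.<⇒≱
          (sparse (s ∷ ss) F
            (subst (_∈ sublists (allFin n)) eq (filter-∈-sublists (nonisolated? H) (allFin n)))
            (filter-∈-sublists (isEdge? H) (edges G))
            (All.tabulate λ e∈ → endpoints (proj₂ (∈-filter⁻ (isEdge? H) {xs = edges G} e∈))))
          (ℕ.≤-trans (subst (λ S → 7 * length S ≤ 2 * length (edges H)) eq (dense H irr))
            (ℕ.*-monoʳ-≤ 2 (length-mono-⊆ _≟ᴱ_ (edges-unique {G = H}) inherited)))
      where
      -- The edges of `H` are drawn from `edges G`, because `mad G` ranges over sublists of that
      -- list.
      F = filter (isEdge? H) (edges G)

      positive : ∀ {u v} → Graph._~_ H u v → u ∈ s ∷ ss
      positive {u} u~v = subst (u ∈_) eq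
        (∈-filter⁺ (nonisolated? H) (∈-allFin u) (Neighbourhoods.deg-positive H u~v))

      endpoints : ∀ {e} → IsEdge H e → proj₁ e ∈ s ∷ ss × proj₂ e ∈ s ∷ ss
      endpoints (_ , u~v) = positive u~v , positive (Graph.~-sym H u~v)

      inherited : ∀ {e} → e ∈ edges H → e ∈ F
      inherited e∈ with _ , e@(u<v , u~v) ←
          ∈-filter⁻ (isEdge? H) {xs = cartesianProduct (allFin n) (allFin n)} e∈ =
        ∈-filter⁺ (isEdge? H) (isEdge⇒∈-edges {G = G} (u<v , H⊆G u~v)) e

  tuza : τ G ≤ 2 * ν G
  -- Decidability of the inequality removes the double negation left by `irreducible-induction`.
  tuza = decidable-stable (τ G ℕ.≤? 2 * ν G) λ fails →
    irreducible-induction Subgraph (λ Y H⊆G → H⊆G ∘ proj₁) solvable G id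
      (fails ∘ solution⇒τ≤2ν)


open import Data.Integer using (+_)
open import Data.Rational using (_<_; _/_)

theorem1p2 : (n : ℕ) (G : Graph n) → mad G < + 7 / 1 → τ G ≤ 2 * ν G
theorem1p2 n G = tuza G
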